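{- There is an absolute constant $c>0$ such that for every $n\ge 3$ and every $3$-uniform hypergraph $H$ on $n$ vertices with at least one hyperedge, $Q(f_{[H]}) \ge c\, n^{3/2}$.
   Context: For $3$-uniform hypergraphs $H$ and $G$, a homomorphism from $H$ to $G$ is a map $h:V(H)\to V(G)$ such that for every hyperedge $\{u,v,w\}\in E(H)$, the set $\{h(u),h(v),h(w)\}$ is a hyperedge of $G$ (in particular has three distinct elements). For a fixed $3$-uniform hypergraph $H$ on $n$ vertices, $f_{[H]}:\{0,1\}^{\binom n3}\to\{0,1\}$ takes as input a $3$-uniform hypergraph $G$ on $[n]$ given by its $\binom n3$ hyperedge-indicator bits, and $f_{[H]}(G)=1$ iff $H$ admits a homomorphism into $G$. $Q(f)$ denotes the bounded-error (success probability at least $2/3$) quantum query complexity of a Boolean function $f$. -}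

module Defs where

open import Data.Bool using (Bool; true; false; _xor_; if_then_else_)
import Data.Bool.Properties as Bool
open import Data.Fin using (Fin; zero; suc; cast)
open import Data.Fin.Properties using (any?; all?; +↔⊎)
import Data.Fin.Properties as Fin
open import Data.Fin.Subset using (Subset; ⁅_⁆; _∪_) renaming (∣_∣ to card)
open import Data.Integer using (+_; +[1+_])
import Data.Integer as ℤ
import Data.Integer.Properties as ℤ
open import Data.Nat using (ℕ; zero; suc; _⊔_)
import Data.Nat as ℕ
open import Data.Nat.Combinatorics using (_C_; nCk+nC[k+1]≡[n+1]C[k+1])
import Data.Nat.Properties as ℕ
open import Data.Nat.Solver using (module +-*-Solver)
open import Data.Product using (Σ; ∃; ∃-syntax; _×_; _,_; proj₁; proj₂)
open import Data.Rational using (ℚ; mkℚ; 0ℚ; 1ℚ; ½; ∣_∣; _/_; positive; 1/_)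
import Data.Rational as ℚ
import Data.Rational.Properties as ℚ
import Data.Rational.Solver as ℚSolver
import Data.Rational.Unnormalised as ℚᵘ
import Data.Rational.Unnormalised.Properties as ℚᵘ
open import Data.Sum using (_⊎_; inj₁; inj₂)
open import Data.Sum.Function.Propositional using (_⊎-↔_)
open import Data.Vec using ([]; _∷_)
open import Data.Vec.Functional using (foldr) renaming (_∷_ to _∷ᶠ_)
open import Function using (_∘_)
open import Function.Bundles using (_↔_; mk↔ₛ′; Inverse)
open import Function.Construct.Composition using (_↔-∘_)
open import Function.Construct.Symmetry using (↔-sym)
open import Relation.Binary.PropositionalEquality
  using (_≡_; refl; sym; trans; cong; cong₂; subst; subst₂; _≗_)
open import Relation.Nullary using (Dec; yes; no; does)
open import Relation.Nullary.Decidable using (map′; _→-dec_)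
open import Relation.Unary using (Decidable)

Eventually : (ℕ → Set) → Set
Eventually P = ∃[ N ] ∀ n → N ℕ.≤ n → P n

IsCauchy : (ℕ → ℚ) → Set
IsCauchy s = ∀ ε → 0ℚ ℚ.< ε →
  ∃[ N ] ∀ m n → N ℕ.≤ m → N ℕ.≤ n → ∣ s m ℚ.- s n ∣ ℚ.≤ ε

-- Equality of reals is _≈ᴿ_, not _≡_.
record ℝ : Set where
  constructor mkℝ
  field
    seq    : ℕ → ℚ
    cauchy : IsCauchy seq

open ℝ public

infix 4 _≈ᴿ_ _≤ᴿ_ _<ᴿ_

_≈ᴿ_ : ℝ → ℝ → Set
x ≈ᴿ y = ∀ ε → 0ℚ ℚ.< ε → Eventually λ n → ∣ seq x n ℚ.- seq y n ∣ ℚ.≤ ε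

_≤ᴿ_ : ℝ → ℝ → Set
x ≤ᴿ y = ∀ ε → 0ℚ ℚ.< ε → Eventually λ n → seq x n ℚ.≤ seq y n ℚ.+ ε

_<ᴿ_ : ℝ → ℝ → Set
x <ᴿ y = ∃[ ε ] 0ℚ ℚ.< ε × Eventually λ n → seq x n ℚ.+ ε ℚ.≤ seq y n

half-pos : ∀ {ε} → 0ℚ ℚ.< ε → 0ℚ ℚ.< ½ ℚ.* ε
half-pos {ε} 0<ε =
  subst (ℚ._< ½ ℚ.* ε) (ℚ.*-zeroʳ ½) (ℚ.*-monoʳ-<-pos ½ 0<ε)

half+half : ∀ ε → ½ ℚ.* ε ℚ.+ ½ ℚ.* ε ≡ ε
half+half ε = trans (sym (ℚ.*-distribʳ-+ ε ½ ½)) (ℚ.*-identityˡ ε)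

∣+∣≤ : ∀ p q {ε} → ∣ p ∣ ℚ.≤ ½ ℚ.* ε → ∣ q ∣ ℚ.≤ ½ ℚ.* ε → ∣ p ℚ.+ q ∣ ℚ.≤ ε
∣+∣≤ p q {ε} hp hq = ℚ.≤-trans (ℚ.∣p+q∣≤∣p∣+∣q∣ p q)
  (subst (∣ p ∣ ℚ.+ ∣ q ∣ ℚ.≤_) (half+half ε) (ℚ.+-mono-≤ hp hq))

∣*∣≤ : ∀ p q {M δ η} → 0ℚ ℚ.< M → M ℚ.* δ ≡ η →
       ∣ p ∣ ℚ.≤ M → ∣ q ∣ ℚ.≤ δ → ∣ p ℚ.* q ∣ ℚ.≤ η
∣*∣≤ p q {M} {δ} {η} 0<M Mδ≡η hp hq = begin
  ∣ p ℚ.* q ∣      ≡⟨ ℚ.∣p*q∣≡∣p∣*∣q∣ p q ⟩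
  ∣ p ∣ ℚ.* ∣ q ∣  ≤⟨ ℚ.*-monoʳ-≤-nonNeg ∣ q ∣ {{ℚ.∣-∣-nonNeg q}} hp ⟩
  M ℚ.* ∣ q ∣      ≤⟨ ℚ.*-monoˡ-≤-nonNeg M {{ℚ.pos⇒nonNeg M {{positive 0<M}}}} hq ⟩
  M ℚ.* δ          ≡⟨ Mδ≡η ⟩
  η                ∎
  where open ℚ.≤-Reasoning

split-difference : ∀ a b → b ℚ.+ (a ℚ.- b) ≡ a
split-difference = let open ℚSolver.+-*-Solver in
  solve 2 (λ a b → b :+ (a :- b) := a) refl

∣p∣≤∣q∣+∣p-q∣ : ∀ p q → ∣ p ∣ ℚ.≤ ∣ q ∣ ℚ.+ ∣ p ℚ.- q ∣
∣p∣≤∣q∣+∣p-q∣ p q =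
  subst (λ r → ∣ r ∣ ℚ.≤ ∣ q ∣ ℚ.+ ∣ p ℚ.- q ∣) (split-difference p q)
    (ℚ.∣p+q∣≤∣p∣+∣q∣ q (p ℚ.- q))

eventually-bounded : ∀ s → IsCauchy s →
  ∃[ M ] 0ℚ ℚ.< M × Eventually λ n → ∣ s n ∣ ℚ.≤ M
eventually-bounded s c =
  let N , close = c 1ℚ (ℚ.positive⁻¹ 1ℚ)
  in ∣ s N ∣ ℚ.+ 1ℚ
   , ℚ.+-mono-≤-< (ℚ.0≤∣p∣ (s N)) (ℚ.positive⁻¹ 1ℚ)
   , N
   , λ n N≤n → ℚ.≤-trans (∣p∣≤∣q∣+∣p-q∣ (s n) (s N))
       (ℚ.+-monoʳ-≤ ∣ s N ∣ (close n N N≤n ℕ.≤-refl))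

+-difference : ∀ a b c d → (a ℚ.- b) ℚ.+ (c ℚ.- d) ≡ (a ℚ.+ c) ℚ.- (b ℚ.+ d)
+-difference = let open ℚSolver.+-*-Solver in
  solve 4 (λ a b c d → (a :- b) :+ (c :- d) := (a :+ c) :- (b :+ d)) refl

∣+-+∣≤ : ∀ a b c d {ε} → ∣ a ℚ.- c ∣ ℚ.≤ ½ ℚ.* ε → ∣ b ℚ.- d ∣ ℚ.≤ ½ ℚ.* ε →
         ∣ (a ℚ.+ b) ℚ.- (c ℚ.+ d) ∣ ℚ.≤ ε
∣+-+∣≤ a b c d {ε} hac hbd =
  subst (λ q → ∣ q ∣ ℚ.≤ ε) (+-difference a c b d)
    (∣+∣≤ (a ℚ.- c) (b ℚ.- d) hac hbd)

divide : ∀ M ε → 0ℚ ℚ.< M → 0ℚ ℚ.< ε → ∃[ δ ] 0ℚ ℚ.< δ × M ℚ.* δ ≡ ε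
divide M ε 0<M 0<ε = 1/ M ℚ.* ε , 0<δ , Mδ≡ε
  where
  instance
    M-pos = positive 0<M
    M-nonZero = ℚ.pos⇒nonZero M
  0<δ : 0ℚ ℚ.< 1/ M ℚ.* ε
  0<δ = subst (ℚ._< 1/ M ℚ.* ε) (ℚ.*-zeroʳ (1/ M))
          (ℚ.*-monoʳ-<-pos (1/ M) {{ℚ.1/pos⇒pos M}} 0<ε)
  Mδ≡ε : M ℚ.* (1/ M ℚ.* ε) ≡ ε
  Mδ≡ε = trans (sym (ℚ.*-assoc M (1/ M) ε))
           (trans (cong (ℚ._* ε) (ℚ.*-inverseʳ M)) (ℚ.*-identityˡ ε))

*-difference : ∀ a b c d →
  a ℚ.* (b ℚ.- d) ℚ.+ d ℚ.* (a ℚ.- c) ≡ a ℚ.* b ℚ.- c ℚ.* d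
*-difference = let open ℚSolver.+-*-Solver in
  solve 4 (λ a b c d → a :* (b :- d) :+ d :* (a :- c) := a :* b :- c :* d) refl

∣*-*∣≤ : ∀ a b c d {M δ ε} → 0ℚ ℚ.< M → M ℚ.* δ ≡ ½ ℚ.* ε →
         ∣ a ∣ ℚ.≤ M → ∣ d ∣ ℚ.≤ M → ∣ a ℚ.- c ∣ ℚ.≤ δ → ∣ b ℚ.- d ∣ ℚ.≤ δ →
         ∣ a ℚ.* b ℚ.- c ℚ.* d ∣ ℚ.≤ ε
∣*-*∣≤ a b c d {M} {δ} {ε} 0<M Mδ ha hd hac hbd =
  subst (λ q → ∣ q ∣ ℚ.≤ ε) (*-difference a b c d)
    (∣+∣≤ (a ℚ.* (b ℚ.- d)) (d ℚ.* (a ℚ.- c))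
      (∣*∣≤ a (b ℚ.- d) 0<M Mδ ha hbd)
      (∣*∣≤ d (a ℚ.- c) 0<M Mδ hd hac))

max-left : ∀ {a b c d m} → (a ⊔ b) ⊔ (c ⊔ d) ℕ.≤ m → a ℕ.≤ m × b ℕ.≤ m
max-left {a} {b} {c} {d} h =
  ℕ.m⊔n≤o⇒m≤o a b ab , ℕ.m⊔n≤o⇒n≤o a b ab
  where ab = ℕ.m⊔n≤o⇒m≤o (a ⊔ b) (c ⊔ d) h

max-right : ∀ {a b c d m} → (a ⊔ b) ⊔ (c ⊔ d) ℕ.≤ m → c ℕ.≤ m × d ℕ.≤ m
max-right {a} {b} {c} {d} h =
  ℕ.m⊔n≤o⇒m≤o c d cd , ℕ.m⊔n≤o⇒n≤o c d cd
  where cd = ℕ.m⊔n≤o⇒n≤o (a ⊔ b) (c ⊔ d) h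

p≤p+q : ∀ p {q} → 0ℚ ℚ.< q → p ℚ.≤ p ℚ.+ q
p≤p+q p {q} 0<q =
  subst (ℚ._≤ p ℚ.+ q) (ℚ.+-identityʳ p) (ℚ.+-monoʳ-≤ p (ℚ.<⇒≤ 0<q))

q≤p+q : ∀ {p} q → 0ℚ ℚ.< p → q ℚ.≤ p ℚ.+ q
q≤p+q {p} q 0<p =
  subst (ℚ._≤ p ℚ.+ q) (ℚ.+-identityˡ q) (ℚ.+-monoˡ-≤ q (ℚ.<⇒≤ 0<p))

neg-difference : ∀ a b → b ℚ.- a ≡ (ℚ.- a) ℚ.- (ℚ.- b)
neg-difference = let open ℚSolver.+-*-Solver in
  solve 2 (λ a b → b :- a := (:- a) :- (:- b)) refl

-- Sealed so that normalising a real never unfolds these proofs.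
abstract

  const-cauchy : ∀ q → IsCauchy (λ _ → q)
  const-cauchy q ε 0<ε = 0 , λ _ _ _ _ →
    subst (λ r → ∣ r ∣ ℚ.≤ ε) (sym (ℚ.+-inverseʳ q)) (ℚ.<⇒≤ 0<ε)

  +-cauchy : ∀ s t → IsCauchy s → IsCauchy t → IsCauchy (λ n → s n ℚ.+ t n)
  +-cauchy s t cs ct ε 0<ε =
    let N₁ , h₁ = cs (½ ℚ.* ε) (half-pos 0<ε)
        N₂ , h₂ = ct (½ ℚ.* ε) (half-pos 0<ε)
    in N₁ ⊔ N₂ , λ m n hm hn → ∣+-+∣≤ (s m) (t m) (s n) (t n)
         (h₁ m n (ℕ.m⊔n≤o⇒m≤o N₁ N₂ hm) (ℕ.m⊔n≤o⇒m≤o N₁ N₂ hn))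
         (h₂ m n (ℕ.m⊔n≤o⇒n≤o N₁ N₂ hm) (ℕ.m⊔n≤o⇒n≤o N₁ N₂ hn))

  *-cauchy : ∀ s t → IsCauchy s → IsCauchy t → IsCauchy (λ n → s n ℚ.* t n)
  *-cauchy s t cs ct ε 0<ε =
    let A , 0<A , N₁ , hA = eventually-bounded s cs
        B , 0<B , N₂ , hB = eventually-bounded t ct
        0<A+B = ℚ.+-mono-< 0<A 0<B
        δ , 0<δ , Mδ = divide (A ℚ.+ B) (½ ℚ.* ε) 0<A+B (half-pos 0<ε)
        N₃ , h₃ = cs δ 0<δ
        N₄ , h₄ = ct δ 0<δ
    in (N₁ ⊔ N₂) ⊔ (N₃ ⊔ N₄) , λ m n hm hn →
      let m₁ , _  = max-left {N₁} {N₂} {N₃} {N₄} hm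
          _  , n₂ = max-left {N₁} {N₂} {N₃} {N₄} hn
          m₃ , m₄ = max-right {N₁} {N₂} {N₃} {N₄} hm
          n₃ , n₄ = max-right {N₁} {N₂} {N₃} {N₄} hn
      in ∣*-*∣≤ (s m) (t m) (s n) (t n) 0<A+B Mδ
           (ℚ.≤-trans (hA m m₁) (p≤p+q A 0<B))
           (ℚ.≤-trans (hB n n₂) (q≤p+q B 0<A))
           (h₃ m n m₃ n₃)
           (h₄ m n m₄ n₄)

  neg-cauchy : ∀ s → IsCauchy s → IsCauchy (λ n → ℚ.- s n)
  neg-cauchy s cs ε 0<ε =
    let N , h = cs ε 0<ε
    in N , λ m n hm hn →
      subst (λ q → ∣ q ∣ ℚ.≤ ε) (neg-difference (s m) (s n)) (h n m hn hm)

infixl 6 _+ᴿ_ _-ᴿ_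
infixl 7 _*ᴿ_
infix  8 -ᴿ_

fromℚ : ℚ → ℝ
fromℚ q = mkℝ (λ _ → q) (const-cauchy q)

fromℕ : ℕ → ℝ
fromℕ n = fromℚ (+ n / 1)

0ᴿ 1ᴿ : ℝ
0ᴿ = fromℚ 0ℚ
1ᴿ = fromℚ 1ℚ

_+ᴿ_ : ℝ → ℝ → ℝ
x +ᴿ y = mkℝ (λ n → seq x n ℚ.+ seq y n)
             (+-cauchy (seq x) (seq y) (cauchy x) (cauchy y))

_*ᴿ_ : ℝ → ℝ → ℝ
x *ᴿ y = mkℝ (λ n → seq x n ℚ.* seq y n)
             (*-cauchy (seq x) (seq y) (cauchy x) (cauchy y))

-ᴿ_ : ℝ → ℝ
-ᴿ x = mkℝ (λ n → ℚ.- seq x n) (neg-cauchy (seq x) (cauchy x))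

_-ᴿ_ : ℝ → ℝ → ℝ
x -ᴿ y = x +ᴿ (-ᴿ y)

isqrt : ℕ → ℕ
isqrt zero = zero
isqrt (suc m) with suc (isqrt m) ℕ.* suc (isqrt m) ℕ.≤? suc m
... | yes _ = suc (isqrt m)
... | no  _ = isqrt m

isqrt-lower : ∀ m → isqrt m ℕ.* isqrt m ℕ.≤ m
isqrt-lower zero = ℕ.z≤n
isqrt-lower (suc m) with suc (isqrt m) ℕ.* suc (isqrt m) ℕ.≤? suc m
... | yes p = p
... | no  _ = ℕ.≤-trans (isqrt-lower m) (ℕ.n≤1+n m)

isqrt-upper : ∀ m → m ℕ.< suc (isqrt m) ℕ.* suc (isqrt m)
isqrt-upper zero = ℕ.s≤s ℕ.z≤n
isqrt-upper (suc m) with suc (isqrt m) ℕ.* suc (isqrt m) ℕ.≤? suc m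
... | yes _ = ℕ.≤-<-trans (isqrt-upper m)
  (ℕ.*-mono-< (ℕ.n<1+n (suc (isqrt m))) (ℕ.n<1+n (suc (isqrt m))))
... | no ¬p = ℕ.≰⇒> ¬p

-- ⌊√(m(k+1)²)⌋ / (k+1), which is within 1/(k+1) of √m.
√-seq : ℕ → ℕ → ℚ
√-seq m k = + isqrt (m ℕ.* (suc k ℕ.* suc k)) / suc k

-- ⌊√(mK²)⌋ / K ≤ (⌊√(mL²)⌋ + 1) / L, cross-multiplied
√-cross : ∀ m k l →
  isqrt (m ℕ.* (suc k ℕ.* suc k)) ℕ.* suc l ℕ.≤
  suc (isqrt (m ℕ.* (suc l ℕ.* suc l))) ℕ.* suc k
√-cross m k l = ℕ.≮⇒≥ λ lt → ℕ.<⇒≱ (ℕ.*-mono-< lt lt) (begin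
  (a ℕ.* L) ℕ.* (a ℕ.* L)           ≡⟨ square a L ⟩
  (a ℕ.* a) ℕ.* (L ℕ.* L)           ≤⟨ ℕ.*-monoˡ-≤ (L ℕ.* L) (isqrt-lower (m ℕ.* (K ℕ.* K))) ⟩
  (m ℕ.* (K ℕ.* K)) ℕ.* (L ℕ.* L)   ≡⟨ regroup m (K ℕ.* K) (L ℕ.* L) ⟩
  (m ℕ.* (L ℕ.* L)) ℕ.* (K ℕ.* K)   ≤⟨ ℕ.*-monoˡ-≤ (K ℕ.* K) (ℕ.<⇒≤ (isqrt-upper (m ℕ.* (L ℕ.* L)))) ⟩
  (b ℕ.* b) ℕ.* (K ℕ.* K)           ≡⟨ square b K ⟨
  (b ℕ.* K) ℕ.* (b ℕ.* K)           ∎)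
  where
  open ℕ.≤-Reasoning
  K = suc k
  L = suc l
  a = isqrt (m ℕ.* (K ℕ.* K))
  b = suc (isqrt (m ℕ.* (L ℕ.* L)))
  square : ∀ u v → (u ℕ.* v) ℕ.* (u ℕ.* v) ≡ (u ℕ.* u) ℕ.* (v ℕ.* v)
  square = let open +-*-Solver in
    solve 2 (λ u v → (u :* v) :* (u :* v) := (u :* u) :* (v :* v)) refl
  regroup : ∀ u v w → (u ℕ.* v) ℕ.* w ≡ (u ℕ.* w) ℕ.* v
  regroup = let open +-*-Solver in
    solve 3 (λ u v w → (u :* v) :* w := (u :* w) :* v) refl

/-mono : ∀ a k b l → a ℕ.* suc l ℕ.≤ b ℕ.* suc k → + a / suc k ℚ.≤ + b / suc l
/-mono a k b l h = ℚ.toℚᵘ-cancel-≤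
  (ℚᵘ.≤-respˡ-≃ (ℚᵘ.≃-sym (ℚ.toℚᵘ-fromℚᵘ (ℚᵘ.mkℚᵘ (+ a) k)))
    (ℚᵘ.≤-respʳ-≃ (ℚᵘ.≃-sym (ℚ.toℚᵘ-fromℚᵘ (ℚᵘ.mkℚᵘ (+ b) l)))
      (ℚᵘ.*≤* (subst₂ ℤ._≤_ (ℤ.pos-* a (suc l)) (ℤ.pos-* b (suc k)) (ℤ.+≤+ h)))))

/-suc : ∀ b l → + suc b / suc l ≡ + b / suc l ℚ.+ + 1 / suc l
/-suc b l = ℚ.toℚᵘ-injective (begin
  ℚ.toℚᵘ (+ suc b / suc l)                         ≈⟨ ℚ.toℚᵘ-fromℚᵘ (ℚᵘ.mkℚᵘ (+ suc b) l) ⟩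
  ℚᵘ.mkℚᵘ (+ suc b) l                              ≈⟨ ℚᵘ.*≡* eq ⟩
  ℚᵘ.mkℚᵘ (+ b) l ℚᵘ.+ ℚᵘ.mkℚᵘ (+ 1) l             ≈⟨ ℚᵘ.+-cong (ℚ.toℚᵘ-fromℚᵘ (ℚᵘ.mkℚᵘ (+ b) l)) (ℚ.toℚᵘ-fromℚᵘ (ℚᵘ.mkℚᵘ (+ 1) l)) ⟨
  ℚ.toℚᵘ (+ b / suc l) ℚᵘ.+ ℚ.toℚᵘ (+ 1 / suc l)   ≈⟨ ℚ.toℚᵘ-homo-+ (+ b / suc l) (+ 1 / suc l) ⟨
  ℚ.toℚᵘ (+ b / suc l ℚ.+ + 1 / suc l)             ∎)
  where
  open ℚᵘ.≃-Reasoning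
  L = suc l
  eqℕ : suc b ℕ.* (L ℕ.* L) ≡ (b ℕ.* L ℕ.+ 1 ℕ.* L) ℕ.* L
  eqℕ = let open +-*-Solver in
    solve 2 (λ b L → (con 1 :+ b) :* (L :* L) := (b :* L :+ con 1 :* L) :* L) refl b L
  eq : + suc b ℤ.* + (L ℕ.* L) ≡ (+ b ℤ.* + L ℤ.+ + 1 ℤ.* + L) ℤ.* + L
  eq = trans (sym (ℤ.pos-* (suc b) (L ℕ.* L)))
    (trans (cong +_ eqℕ)
    (trans (ℤ.pos-* (b ℕ.* L ℕ.+ 1 ℕ.* L) L)
      (cong (ℤ._* + L) (cong₂ ℤ._+_ (ℤ.pos-* b L) (ℤ.pos-* 1 L)))))

√-close : ∀ m k l → √-seq m k ℚ.≤ √-seq m l ℚ.+ + 1 / suc l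
√-close m k l = subst (√-seq m k ℚ.≤_) (/-suc b l)
  (/-mono (isqrt (m ℕ.* (suc k ℕ.* suc k))) k (suc b) l (√-cross m k l))
  where b = isqrt (m ℕ.* (suc l ℕ.* suc l))

archimedean : ∀ ε → 0ℚ ℚ.< ε → ∃[ N ] ∀ l → N ℕ.≤ l → + 1 / suc l ℚ.≤ ε
archimedean (mkℚ +[1+ p ] d c) _ = d , λ l d≤l →
  subst (+ 1 / suc l ℚ.≤_) (ℚ.fromℚᵘ-toℚᵘ (mkℚ +[1+ p ] d c))
    (/-mono 1 l (suc p) d
      (ℕ.*-mono-≤ {1} {suc p} (ℕ.s≤s ℕ.z≤n) (ℕ.s≤s d≤l)))
archimedean (mkℚ (+ 0) d c) (ℚ.*<* (ℤ.+<+ ()))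
archimedean (mkℚ (ℤ.-[1+ _ ]) d c) (ℚ.*<* ())

∣-∣≤ : ∀ p q {ε} → p ℚ.≤ q ℚ.+ ε → q ℚ.≤ p ℚ.+ ε → ∣ p ℚ.- q ∣ ℚ.≤ ε
∣-∣≤ p q {ε} h₁ h₂ with ℚ.∣p∣≡p∨∣p∣≡-p (p ℚ.- q)
... | inj₁ e = subst₂ ℚ._≤_ (sym e) (cancel q ε) (ℚ.+-monoˡ-≤ (ℚ.- q) h₁)
  where
  cancel : ∀ a b → (a ℚ.+ b) ℚ.- a ≡ b
  cancel = let open ℚSolver.+-*-Solver in
    solve 2 (λ a b → (a :+ b) :- a := b) refl
... | inj₂ e = subst₂ ℚ._≤_ (trans (flip p q) (sym e)) (cancel p ε)
                 (ℚ.+-monoˡ-≤ (ℚ.- p) h₂)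
  where
  cancel : ∀ a b → (a ℚ.+ b) ℚ.- a ≡ b
  cancel = let open ℚSolver.+-*-Solver in
    solve 2 (λ a b → (a :+ b) :- a := b) refl
  flip : ∀ a b → b ℚ.- a ≡ ℚ.- (a ℚ.- b)
  flip = let open ℚSolver.+-*-Solver in
    solve 2 (λ a b → b :- a := :- (a :- b)) refl

abstract

  √-cauchy : ∀ m → IsCauchy (√-seq m)
  √-cauchy m ε 0<ε =
    let N , small = archimedean ε 0<ε
    in N , λ k l hk hl → ∣-∣≤ (√-seq m k) (√-seq m l)
      (ℚ.≤-trans (√-close m k l) (ℚ.+-monoʳ-≤ (√-seq m l) (small l hl)))
      (ℚ.≤-trans (√-close m l k) (ℚ.+-monoʳ-≤ (√-seq m k) (small k hk)))

√ : ℕ → ℝ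
√ m = mkℝ (√-seq m) (√-cauchy m)

record ℂ : Set where
  constructor _+i_
  field
    re im : ℝ

open ℂ public

infix  4 _≈ᶜ_
infixl 6 _+ᶜ_
infixl 7 _*ᶜ_

_≈ᶜ_ : ℂ → ℂ → Set
z ≈ᶜ w = re z ≈ᴿ re w × im z ≈ᴿ im w

0ᶜ 1ᶜ : ℂ
0ᶜ = 0ᴿ +i 0ᴿ
1ᶜ = 1ᴿ +i 0ᴿ

_+ᶜ_ : ℂ → ℂ → ℂ
z +ᶜ w = (re z +ᴿ re w) +i (im z +ᴿ im w)

_*ᶜ_ : ℂ → ℂ → ℂ
z *ᶜ w = (re z *ᴿ re w -ᴿ im z *ᴿ im w) +i (re z *ᴿ im w +ᴿ im z *ᴿ re w)

conj : ℂ → ℂ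
conj z = re z +i (-ᴿ im z)

normSq : ℂ → ℝ
normSq z = re z *ᴿ re z +ᴿ im z *ᴿ im z

-- |i, b, z⟩: query index, answer bit, workspace.  The label also fixes the
-- dimension N · 2 · w of the state space.
Basis : ℕ → ℕ → Set
Basis N w = Fin N × Bool × Fin w

_≟ᴮ_ : ∀ {N w} (a b : Basis N w) → Dec (a ≡ b)
_≟ᴮ_ = ≡-dec Fin._≟_ (≡-dec Bool._≟_ Fin._≟_)
  where open import Data.Product.Properties using (≡-dec)

module _ {A : Set} (_⊕_ : A → A → A) (0# : A) where

  sumBasis : ∀ {N w} → (Basis N w → A) → A
  sumBasis g = foldr _⊕_ 0# λ i → foldr _⊕_ 0# λ z →
    g (i , false , z) ⊕ g (i , true , z)

∑ᴿ : ∀ {N w} → (Basis N w → ℝ) → ℝ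
∑ᴿ = sumBasis _+ᴿ_ 0ᴿ

∑ᶜ : ∀ {N w} → (Basis N w → ℂ) → ℂ
∑ᶜ = sumBasis _+ᶜ_ 0ᶜ

State : ℕ → ℕ → Set
State N w = Basis N w → ℂ

Operator : ℕ → ℕ → Set
Operator N w = Basis N w → Basis N w → ℂ

module _ {N w : ℕ} where

  infix  4 _≈ᴼ_
  infixl 7 _∙_ _·_
  infix  8 _†

  ket : Basis N w → State N w
  ket a b = if does (a ≟ᴮ b) then 1ᶜ else 0ᶜ

  identity : Operator N w
  identity = ket

  _∙_ : Operator N w → Operator N w → Operator N w
  (U ∙ V) a b = ∑ᶜ λ c → U a c *ᶜ V c b

  _† : Operator N w → Operator N w
  (U †) a b = conj (U b a)

  _≈ᴼ_ : Operator N w → Operator N w → Set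
  U ≈ᴼ V = ∀ a b → U a b ≈ᶜ V a b

  IsUnitary : Operator N w → Set
  IsUnitary U = (U † ∙ U) ≈ᴼ identity × (U ∙ U †) ≈ᴼ identity

  _·_ : Operator N w → State N w → State N w
  (U · ψ) a = ∑ᶜ λ b → U a b *ᶜ ψ b

  -- O_x |i, b, z⟩ = |i, b ⊕ xᵢ, z⟩; this map on basis labels is an
  -- involution, so it acts on amplitudes by the same formula.
  oracle : (Fin N → Bool) → State N w → State N w
  oracle x ψ (i , b , z) = ψ (i , b xor x i , z)

  -- U_T O_x U_{T-1} O_x ⋯ O_x U_0 ψ
  run : ∀ {T} → (Fin (suc T) → Operator N w) → (Fin N → Bool) → State N w → State N w
  run {zero}  U x ψ = U zero · ψ
  run {suc T} U x ψ = run (U ∘ suc) x (oracle x (U zero · ψ))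

record QueryAlgorithm (N T : ℕ) : Set where
  field
    workspace : ℕ
    start     : Basis N workspace
    U         : Fin (suc T) → Operator N workspace
    unitary   : ∀ t → IsUnitary (U t)
    output    : Basis N workspace → Bool

  finalState : (Fin N → Bool) → State N workspace
  finalState x = run U x (ket start)

  -- Measure in the standard basis, then answer with the label's output bit.
  Pr : (Fin N → Bool) → Bool → ℝ
  Pr x v = ∑ᴿ λ b →
    if does (output b Bool.≟ v) then normSq (finalState x b) else 0ᴿ

BoolFun : ℕ → Set
BoolFun N = (Fin N → Bool) → Bool

ComputableWith : ∀ {N} → ℕ → BoolFun N → Set
ComputableWith {N} T f = Σ (QueryAlgorithm N T) λ A →
  ∀ x → fromℚ (+ 2 / 3) ≤ᴿ QueryAlgorithm.Pr A x (f x)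

-- Q(f) is the least T with ComputableWith T f, so it is bounded below by r
-- exactly when every such T is.
Q[_]≥_ : ∀ {N} → BoolFun N → ℝ → Set
Q[ f ]≥ r = ∀ T → ComputableWith T f → r ≤ᴿ fromℕ T

KSubset : ℕ → ℕ → Set
KSubset n k = Σ (Subset n) λ S → card S ≡ k

-- The vertex set is Fin n.
Hypergraph : ℕ → Set
Hypergraph n = KSubset n 3 → Bool

infix 4 _∈ᴱ_ _∈ᴱ?_

_∈ᴱ_ : ∀ {n} → Subset n → Hypergraph n → Set
S ∈ᴱ G = Σ (card S ≡ 3) λ p → G (S , p) ≡ true

-- {u, v, w}; it has three elements only if u, v, w are distinct.
triple : ∀ {n} → Fin n → Fin n → Fin n → Subset n
triple u v w = ⁅ u ⁆ ∪ ⁅ v ⁆ ∪ ⁅ w ⁆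

IsHom : ∀ {m n} → Hypergraph m → Hypergraph n → (Fin m → Fin n) → Set
IsHom H G h = ∀ u v w → triple u v w ∈ᴱ H → triple (h u) (h v) (h w) ∈ᴱ G

Hom : ∀ {m n} → Hypergraph m → Hypergraph n → Set
Hom {m} {n} H G = Σ (Fin m → Fin n) (IsHom H G)

_∈ᴱ?_ : ∀ {n} (S : Subset n) (G : Hypergraph n) → Dec (S ∈ᴱ G)
S ∈ᴱ? G with card S ℕ.≟ 3
... | no ¬p = no (¬p ∘ proj₁)
... | yes p = map′ (p ,_)
  (λ (q , e) → subst (λ r → G (S , r) ≡ true) (ℕ.≡-irrelevant q p) e)
  (G (S , p) Bool.≟ true)

isHom? : ∀ {m n} (H : Hypergraph m) (G : Hypergraph n) → Decidable (IsHom H G)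
isHom? H G h = all? λ u → all? λ v → all? λ w →
  (triple u v w ∈ᴱ? H) →-dec (triple (h u) (h v) (h w) ∈ᴱ? G)

isHom-resp : ∀ {m n} (H : Hypergraph m) (G : Hypergraph n) {h k} →
             h ≗ k → IsHom H G h → IsHom H G k
isHom-resp H G h≗k hom u v w e
  rewrite sym (h≗k u) | sym (h≗k v) | sym (h≗k w) = hom u v w e

anyFun? : ∀ m {n} {P : (Fin m → Fin n) → Set} →
          (∀ {h k} → h ≗ k → P h → P k) → Decidable P → Dec (∃ P)
anyFun? zero resp P? =
  map′ (_ ,_) (λ (_ , p) → resp (λ ()) p) (P? λ ())
anyFun? (suc m) {P = P} resp P? =
  map′ (λ (x , h , p) → x ∷ᶠ h , p)
       (λ (h , p) → h zero , h ∘ suc , resp (λ { zero → refl ; (suc _) → refl }) p)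
       (any? λ x → anyFun? m (λ h≗k → resp λ { zero → refl ; (suc i) → h≗k i })
                             (λ h → P? (x ∷ᶠ h)))

hom? : ∀ {m n} (H : Hypergraph m) (G : Hypergraph n) → Dec (Hom H G)
hom? {m} H G = anyFun? m (isHom-resp H G) (isHom? H G)

cong-Fin : ∀ {a b} → a ≡ b → Fin a ↔ Fin b
cong-Fin eq = mk↔ₛ′ (cast eq) (cast (sym eq))
  (Fin.cast-involutive eq (sym eq)) (Fin.cast-involutive (sym eq) eq)

KSubset-≡ : ∀ {n k} {S S′ : KSubset n k} → proj₁ S ≡ proj₁ S′ → S ≡ S′
KSubset-≡ {S = _ , p} {_ , q} refl = cong (_ ,_) (ℕ.≡-irrelevant p q)

zeroSubset : ∀ n → KSubset n 0
zeroSubset zero    = [] , refl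
zeroSubset (suc n) = let S , p = zeroSubset n in false ∷ S , p

zeroSubset-unique : ∀ n (S : KSubset n 0) → proj₁ (zeroSubset n) ≡ proj₁ S
zeroSubset-unique zero    ([] , _)        = refl
zeroSubset-unique (suc n) (false ∷ S , p) =
  cong (false ∷_) (zeroSubset-unique n (S , p))

KSubset-pascal : ∀ n k →
  KSubset (suc n) (suc k) ↔ (KSubset n k ⊎ KSubset n (suc k))
KSubset-pascal n k = mk↔ₛ′ to from to∘from from∘to
  where
  to : KSubset (suc n) (suc k) → KSubset n k ⊎ KSubset n (suc k)
  to (true  ∷ S , p) = inj₁ (S , ℕ.suc-injective p)
  to (false ∷ S , p) = inj₂ (S , p)
  from : KSubset n k ⊎ KSubset n (suc k) → KSubset (suc n) (suc k)
  from (inj₁ (S , p)) = true  ∷ S , cong suc p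
  from (inj₂ (S , p)) = false ∷ S , p
  to∘from : ∀ y → to (from y) ≡ y
  to∘from (inj₁ _) = cong inj₁ (KSubset-≡ refl)
  to∘from (inj₂ _) = refl
  from∘to : ∀ x → from (to x) ≡ x
  from∘to (true  ∷ _ , _) = KSubset-≡ refl
  from∘to (false ∷ _ , _) = refl

subsetIndex : ∀ n k → KSubset n k ↔ Fin (n C k)
subsetIndex n zero = mk↔ₛ′ (λ _ → zero) (λ _ → zeroSubset n)
  (λ { zero → refl }) (λ S → KSubset-≡ (zeroSubset-unique n S))
subsetIndex zero (suc k) = mk↔ₛ′ (λ { ([] , ()) }) (λ ()) (λ ()) (λ { ([] , ()) })
subsetIndex (suc n) (suc k) =
  KSubset-pascal n k ⟫ (subsetIndex n k ⊎-↔ subsetIndex n (suc k))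
    ⟫ ↔-sym +↔⊎ ⟫ cong-Fin (nCk+nC[k+1]≡[n+1]C[k+1] n k)
  where
  infixl 5 _⟫_
  _⟫_ : ∀ {A B C : Set} → A ↔ B → B ↔ C → A ↔ C
  f ⟫ g = g ↔-∘ f

decode : ∀ n → (Fin (n C 3) → Bool) → Hypergraph n
decode n x e = x (Inverse.to (subsetIndex n 3) e)

f[_] : ∀ {n} → Hypergraph n → BoolFun (n C 3)
f[_] {n} H x = does (hom? H (decode n x))

-- For q³ variable triples X × Y × Z over a fixed base hypergraph, where q is a power of 2 and the
-- base is invariant under a 2-group acting transitively on X × Y × Z, all orbits on inputs
-- other than the two constant ones have even size.  So if H maps to the base with all of
-- X × Y × Z but not to the base alone, then f[ H ] takes the value 1 an odd number of times on this
-- subcube, and hence on some subcube of dimension s² ≈ q³.  There f xor parity is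
-- unbalanced, so by Huang's argument an eigenvector for the eigenvalue s of the signed
-- adjacency matrix of the cube lives on one of its two sides, where neighbours have different
-- values of f; the adversary method with these weights gives s ≤ 72 T.
--
-- Contrapositively, few queries mean that adding such a box never creates a homomorphism
-- from H.  Starting with the cliques K_{c+1}, which receive a homomorphism from the
-- hypergraph of all triples with two vertices in Fin c, one reaches K_{2^a+c} by boxes:
-- vertices of Vec Bool a lie in nested blocks, and the level of the blocks that may hold
-- two vertices of an edge is raised one bit at a time.  Repeating this reaches K_n, to
-- which H does map.

module Submission where

open import Defs
open import Data.Bool using (Bool; true; false; _xor_; not; if_then_else_; _∧_)
open import Data.Fin using (Fin; zero; suc; toℕ; punchIn; punchOut)
open import Data.Integer using (+_)
open import Data.List
  using (List; []; _∷_; _++_; map; concatMap; allFin; tabulate; length; filterᵇ)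
open import Data.Nat using (ℕ; zero; suc; _≤_; _<_; _^_; _∸_; _⊔_; z≤n; s≤s)
open import Data.Product using (Σ; ∃-syntax; _×_; _,_; proj₁; proj₂)
open import Data.Rational using (ℚ; 0ℚ; 1ℚ; ½; _/_; ∣_∣)
open import Data.Sum using (_⊎_; inj₁; inj₂)
open import Data.Empty using (⊥)
open import Data.Vec using (Vec; []; _∷_; lookup; replicate; insertAt; removeAt)
  renaming (_++_ to _++ⱽ_)
open import Data.Vec.Functional using (foldr)
open import Function using (_∘_; id)
open import Relation.Binary.PropositionalEquality
  using (_≡_; _≢_; refl; sym; trans; cong; cong₂; subst; module ≡-Reasoning)
open import Relation.Nullary using (¬_; Dec; yes; no; does)
open import Relation.Nullary.Negation using (contradiction)
open import Data.List.Relation.Unary.All using (All; []; _∷_)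
open import Data.List.Relation.Unary.Any using (here; there)
open import Data.List.Membership.Propositional using (_∈_)
open import Data.List.Membership.Propositional.Properties using (∈-map⁺; ∈-++⁺ˡ; ∈-++⁺ʳ)
open import Data.List.Properties using (length-++; length-map)
open import Data.Vec.Properties
  using (lookup-++ˡ; lookup-++ʳ; lookup-replicate; insertAt-lookup; insertAt-punchIn;
    insertAt-removeAt; removeAt-insertAt)
open import Data.Fin.Subset using (Subset; ⁅_⁆; _∪_; _∉_; inside; outside)
  renaming (_∈_ to _∈ˢ_; ∣_∣ to card; ⊥ to ∅)
open import Data.Fin.Subset.Properties
  using (∪-identityˡ; ∪-identityʳ; ∪-comm; ∪-assoc; ∪-idem; ∣⁅x⁆∣≡1; x∈⁅x⁆; x∈⁅y⁆⇒x≡y; x∈p∪q⁻;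
    x∈p∪q⁺)
open import Function.Bundles using (Inverse; mk⇔)
open import Relation.Nullary.Decidable
  using (_×-dec_; _⊎-dec_; dec-true; dec-false; does-⇔; _→-dec_)
open import Data.Unit using (⊤; tt)
open import Data.Sum.Properties using (inj₁-injective; inj₂-injective)
open import Data.Nat.Solver using (module +-*-Solver)
import Data.Bool.Properties as Bool
import Data.Fin as Fin
import Data.Fin.Properties as Fin
import Data.Nat as ℕ
import Data.Nat.Properties as ℕ
import Data.Rational as ℚ
import Data.Rational.Properties as ℚ
import Data.Rational.Solver as ℚSolver
import Data.Vec as Vec
import Data.List.Relation.Unary.All as All
import Data.List.Relation.Unary.All.Properties as All
import Data.Sum
import Data.Vec.Properties as Vec

-- Finite sums

-- Why a square dimension: in dimension `M` the signed matrix has eigenvalues ±√M, and an exact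
-- eigenvector is wanted over ℚ, where it can be found by elimination. Why boxes: the parity
-- argument needs a base that does not change when the bits of one side are flipped and the other
-- two sides stay put. This forces whole halves of the vertex set to be filled at once. A box may
-- add more triples than the next hypergraph of the chain has, since absence of a homomorphism
-- passes to subhypergraphs. This overshoot is what makes an explicit chain possible. Nothing is
-- known of H but one hyperedge, so no hard inputs can be written down; the chain only transports
-- the absence of a homomorphism. The hyperedge excludes K_1, and the chain contradicts itself at
-- K_n, to which the identity is a homomorphism. Every box must have order n³ triples, so every side
-- takes a fixed fraction of the vertices: the tree part has 2^(a+1) vertices with 3·2^a ≤ n <
-- 6·2^a, and `Fin c` has at least 2^a of them except at the start, where c = 0 and no side is taken
-- from it.

∑ : {A : Set} → List A → (A → ℚ) → ℚ
∑ []       f = 0ℚ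
∑ (x ∷ xs) f = f x ℚ.+ ∑ xs f

+-interchange : ∀ a b c d → (a ℚ.+ b) ℚ.+ (c ℚ.+ d) ≡ (a ℚ.+ c) ℚ.+ (b ℚ.+ d)
+-interchange = let open ℚSolver.+-*-Solver in
  solve 4 (λ a b c d → (a :+ b) :+ (c :+ d) := (a :+ c) :+ (b :+ d)) refl

module _ {A : Set} where

  ∑-cong : ∀ (xs : List A) {f g} → (∀ x → f x ≡ g x) → ∑ xs f ≡ ∑ xs g
  ∑-cong []       h = refl
  ∑-cong (x ∷ xs) h = cong₂ ℚ._+_ (h x) (∑-cong xs h)

  ∑-0 : ∀ (xs : List A) → ∑ xs (λ _ → 0ℚ) ≡ 0ℚ
  ∑-0 []       = refl
  ∑-0 (x ∷ xs) = trans (ℚ.+-identityˡ _) (∑-0 xs)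

  ∑-+ : ∀ (xs : List A) f g → ∑ xs (λ x → f x ℚ.+ g x) ≡ ∑ xs f ℚ.+ ∑ xs g
  ∑-+ []       f g = refl
  ∑-+ (x ∷ xs) f g =
    trans (cong ((f x ℚ.+ g x) ℚ.+_) (∑-+ xs f g))
          (+-interchange (f x) (g x) (∑ xs f) (∑ xs g))

  ∑-* : ∀ (xs : List A) c f → ∑ xs (λ x → c ℚ.* f x) ≡ c ℚ.* ∑ xs f
  ∑-* []       c f = sym (ℚ.*-zeroʳ c)
  ∑-* (x ∷ xs) c f =
    trans (cong (c ℚ.* f x ℚ.+_) (∑-* xs c f)) (sym (ℚ.*-distribˡ-+ c (f x) (∑ xs f)))

  ∑-*ʳ : ∀ (xs : List A) c f → ∑ xs (λ x → f x ℚ.* c) ≡ ∑ xs f ℚ.* c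
  ∑-*ʳ xs c f = trans (∑-cong xs λ x → ℚ.*-comm (f x) c)
                  (trans (∑-* xs c f) (ℚ.*-comm c (∑ xs f)))

  ∑-≤ : ∀ (xs : List A) {f g} → (∀ x → f x ℚ.≤ g x) → ∑ xs f ℚ.≤ ∑ xs g
  ∑-≤ []       h = ℚ.≤-refl
  ∑-≤ (x ∷ xs) h = ℚ.+-mono-≤ (h x) (∑-≤ xs h)

  ∑-nonneg : ∀ (xs : List A) {f} → (∀ x → 0ℚ ℚ.≤ f x) → 0ℚ ℚ.≤ ∑ xs f
  ∑-nonneg xs {f} h = subst (ℚ._≤ ∑ xs f) (∑-0 xs) (∑-≤ xs h)

  ∑-++ : ∀ (xs ys : List A) f → ∑ (xs ++ ys) f ≡ ∑ xs f ℚ.+ ∑ ys f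
  ∑-++ []       ys f = sym (ℚ.+-identityˡ _)
  ∑-++ (x ∷ xs) ys f =
    trans (cong (f x ℚ.+_) (∑-++ xs ys f)) (sym (ℚ.+-assoc (f x) (∑ xs f) (∑ ys f)))

  ∑-map : ∀ {B : Set} (h : B → A) xs f → ∑ (map h xs) f ≡ ∑ xs (f ∘ h)
  ∑-map h []       f = refl
  ∑-map h (x ∷ xs) f = cong (f (h x) ℚ.+_) (∑-map h xs f)

  ∑-concatMap : ∀ {B : Set} (h : B → List A) xs f →
                ∑ (concatMap h xs) f ≡ ∑ xs (λ x → ∑ (h x) f)
  ∑-concatMap h []       f = refl
  ∑-concatMap h (x ∷ xs) f =
    trans (∑-++ (h x) (concatMap h xs) f) (cong (∑ (h x) f ℚ.+_) (∑-concatMap h xs f))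

∑-swap : ∀ {A B : Set} (xs : List A) (ys : List B) (f : A → B → ℚ) →
         ∑ xs (λ x → ∑ ys (f x)) ≡ ∑ ys (λ y → ∑ xs (λ x → f x y))
∑-swap []       ys f = sym (∑-0 ys)
∑-swap (x ∷ xs) ys f =
  trans (cong (∑ ys (f x) ℚ.+_) (∑-swap xs ys f))
        (sym (∑-+ ys (f x) (λ y → ∑ xs (λ x → f x y))))

∑-tabulate : ∀ {A : Set} {n} (h : Fin n → A) f →
             ∑ (tabulate h) f ≡ foldr ℚ._+_ 0ℚ (f ∘ h)
∑-tabulate {n = zero}  h f = refl
∑-tabulate {n = suc n} h f = cong (f (h zero) ℚ.+_) (∑-tabulate (h ∘ suc) f)

p+0≡p : ∀ p {q} → q ≡ 0ℚ → p ℚ.+ q ≡ p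
p+0≡p p refl = ℚ.+-identityʳ p

0+q≡q : ∀ {p} q → p ≡ 0ℚ → p ℚ.+ q ≡ q
0+q≡q q refl = ℚ.+-identityˡ q

p+q≡0 : ∀ {p q} → p ≡ 0ℚ → q ≡ 0ℚ → p ℚ.+ q ≡ 0ℚ
p+q≡0 refl refl = refl

∑-tabulate-0 : ∀ {A : Set} {n} (h : Fin n → A) (f : A → ℚ) →
               (∀ j → f (h j) ≡ 0ℚ) → ∑ (tabulate h) f ≡ 0ℚ
∑-tabulate-0 {n = zero}  h f z = refl
∑-tabulate-0 {n = suc n} h f z =
  trans (0+q≡q (∑ (tabulate (h ∘ suc)) f) (z zero)) (∑-tabulate-0 (h ∘ suc) f (z ∘ suc))

∑-tabulate-single : ∀ {A : Set} {n} (h : Fin n → A) (f : A → ℚ) i →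
                    (∀ j → j ≢ i → f (h j) ≡ 0ℚ) → ∑ (tabulate h) f ≡ f (h i)
∑-tabulate-single {n = suc n} h f zero off =
  p+0≡p (f (h zero)) (∑-tabulate-0 (h ∘ suc) f λ j → off (suc j) λ ())
∑-tabulate-single {n = suc n} h f (suc i) off =
  trans (0+q≡q (∑ (tabulate (h ∘ suc)) f) (off zero λ ()))
    (∑-tabulate-single (h ∘ suc) f i λ j j≢i → off (suc j) (j≢i ∘ Fin.suc-injective))

∑-single : ∀ {n} (f : Fin n → ℚ) (i : Fin n) → (∀ j → j ≢ i → f j ≡ 0ℚ) → ∑ (allFin n) f ≡ f i
∑-single = ∑-tabulate-single id

basisList : ∀ N w → List (Basis N w)
basisList N w = concatMap
  (λ i → concatMap (λ z → (i , false , z) ∷ (i , true , z) ∷ []) (allFin w)) (allFin N)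

∑-basisList : ∀ {N w} (g : Basis N w → ℚ) →
  ∑ (basisList N w) g ≡
  ∑ (allFin N) λ i → ∑ (allFin w) λ z → g (i , false , z) ℚ.+ g (i , true , z)
∑-basisList {N} {w} g =
  trans (∑-concatMap _ (allFin N) g) (∑-cong (allFin N) λ i →
  trans (∑-concatMap _ (allFin w) g) (∑-cong (allFin w) λ z →
  cong (g (i , false , z) ℚ.+_) (ℚ.+-identityʳ _)))

foldr-cong : ∀ {n} {f g : Fin n → ℚ} → (∀ i → f i ≡ g i) →
             foldr ℚ._+_ 0ℚ f ≡ foldr ℚ._+_ 0ℚ g
foldr-cong {zero}  h = refl
foldr-cong {suc n} h = cong₂ ℚ._+_ (h zero) (foldr-cong (h ∘ suc))

sumBasis≡∑ : ∀ {N w} (g : Basis N w → ℚ) → sumBasis ℚ._+_ 0ℚ g ≡ ∑ (basisList N w) g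
sumBasis≡∑ {N} {w} g = sym (trans (∑-basisList g)
  (trans (∑-tabulate id λ i → ∑ (allFin w) λ z → g (i , false , z) ℚ.+ g (i , true , z))
    (foldr-cong λ i → ∑-tabulate id λ z → g (i , false , z) ℚ.+ g (i , true , z))))

∑-basis-single : ∀ {N w} (g : Basis N w → ℚ) b → (∀ c → c ≢ b → g c ≡ 0ℚ) →
                 ∑ (basisList N w) g ≡ g b
∑-basis-single {N} {w} g (i , b , z) off = trans (∑-basisList g)
  (trans (∑-single (λ j → ∑ (allFin w) λ y → g (j , false , y) ℚ.+ g (j , true , y)) i
      λ j j≢i → trans (∑-cong (allFin w) λ y →
        p+q≡0 (off (j , false , y) (j≢i ∘ cong proj₁)) (off (j , true , y) (j≢i ∘ cong proj₁)))
        (∑-0 (allFin w)))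
  (trans (∑-single (λ y → g (i , false , y) ℚ.+ g (i , true , y)) z λ y y≢z →
      p+q≡0 (off (i , false , y) (y≢z ∘ cong (proj₂ ∘ proj₂)))
            (off (i , true , y) (y≢z ∘ cong (proj₂ ∘ proj₂))))
    (bit b off)))
  where
  bit : ∀ b → (∀ c → c ≢ (i , b , z) → g c ≡ 0ℚ) →
        g (i , false , z) ℚ.+ g (i , true , z) ≡ g (i , b , z)
  bit false off = p+0≡p (g (i , false , z)) (off (i , true , z) λ ())
  bit true  off = 0+q≡q (g (i , true , z)) (off (i , false , z) λ ())

-- Cauchy reals

infix 4 _≃_ _≲_

-- Unlike _≈ᴿ_ and _≤ᴿ_, these do not unfold, so that their arguments can be inferred.
record _≃_ (x y : ℝ) : Set where
  constructor ≃-intro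
  field ≃-elim : x ≈ᴿ y

record _≲_ (x y : ℝ) : Set where
  constructor ≲-intro
  field ≲-elim : x ≤ᴿ y

open _≲_

≗⇒≃ : ∀ {x y} → (∀ n → seq x n ≡ seq y n) → x ≃ y
≗⇒≃ {x} {y} h = ≃-intro λ ε 0<ε → 0 , λ n _ →
  subst (λ q → ∣ q ∣ ℚ.≤ ε)
    (sym (trans (cong (ℚ._- seq y n) (h n)) (ℚ.+-inverseʳ (seq y n)))) (ℚ.<⇒≤ 0<ε)

≃-refl : ∀ {x} → x ≃ x
≃-refl = ≗⇒≃ λ _ → refl

-- Most comparisons of reals below hold at every index of the two sequences and are therefore proved
-- over ℚ. Tolerances come in with the properties of the algorithm, unitarity and success
-- probability, which are given up to `_≈ᴿ_` and `_≤ᴿ_`.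
pointwise-≲ : ∀ {x y} → (∀ n → seq x n ℚ.≤ seq y n) → x ≲ y
pointwise-≲ {x} {y} h = ≲-intro λ ε 0<ε → 0 , λ n _ → ℚ.≤-trans (h n) (p≤p+q (seq y n) 0<ε)

≲-refl : ∀ {x} → x ≲ x
≲-refl = pointwise-≲ λ _ → ℚ.≤-refl

p≤∣p∣ : ∀ p → p ℚ.≤ ∣ p ∣
p≤∣p∣ p with ℚ.≤-total 0ℚ p
... | inj₁ 0≤p = ℚ.≤-reflexive (sym (ℚ.0≤p⇒∣p∣≡p 0≤p))
... | inj₂ p≤0 = ℚ.≤-trans p≤0 (ℚ.0≤∣p∣ p)

≃⇒≲ : ∀ {x y} → x ≃ y → x ≲ y
≃⇒≲ {x} {y} (≃-intro h) = ≲-intro λ ε 0<ε → let N , close = h ε 0<ε in N , λ n N≤n →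
  subst (ℚ._≤ seq y n ℚ.+ ε) (split-difference (seq x n) (seq y n))
    (ℚ.+-monoʳ-≤ (seq y n) (ℚ.≤-trans (p≤∣p∣ (seq x n ℚ.- seq y n)) (close n N≤n)))

both : ∀ {P Q : ℕ → Set} → Eventually P → Eventually Q → Eventually λ n → P n × Q n
both (M , p) (N , q) = M ⊔ N , λ n h →
  p n (ℕ.m⊔n≤o⇒m≤o M N h) , q n (ℕ.m⊔n≤o⇒n≤o M N h)

both-half : ∀ {P Q : ℚ → ℕ → Set} → (∀ ε → 0ℚ ℚ.< ε → Eventually (P ε)) →
  (∀ ε → 0ℚ ℚ.< ε → Eventually (Q ε)) →
  ∀ {ε} → 0ℚ ℚ.< ε → Eventually λ n → P (½ ℚ.* ε) n × Q (½ ℚ.* ε) n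
both-half h k {ε} 0<ε = both (h (½ ℚ.* ε) (half-pos 0<ε)) (k (½ ℚ.* ε) (half-pos 0<ε))

≃-trans : ∀ {x y z} → x ≃ y → y ≃ z → x ≃ z
≃-trans {x} {y} {z} (≃-intro h) (≃-intro k) = ≃-intro λ ε 0<ε →
  let N , close = both-half h k 0<ε in
  N , λ n N≤n → subst (λ q → ∣ q ∣ ℚ.≤ ε) (telescope (seq x n) (seq y n) (seq z n))
    (∣+∣≤ (seq x n ℚ.- seq y n) (seq y n ℚ.- seq z n)
      (proj₁ (close n N≤n)) (proj₂ (close n N≤n)))
  where
  telescope : ∀ a b c → (a ℚ.- b) ℚ.+ (b ℚ.- c) ≡ a ℚ.- c
  telescope = let open ℚSolver.+-*-Solver in
    solve 3 (λ a b c → (a :- b) :+ (b :- c) := a :- c) refl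

≲-trans : ∀ {x y z} → x ≲ y → y ≲ z → x ≲ z
≲-trans {x} {y} {z} (≲-intro h) (≲-intro k) = ≲-intro λ ε 0<ε →
  let N , below = both-half h k 0<ε in
  N , λ n N≤n → ℚ.≤-trans (proj₁ (below n N≤n))
    (subst (seq y n ℚ.+ ½ ℚ.* ε ℚ.≤_)
      (trans (ℚ.+-assoc (seq z n) _ _) (cong (seq z n ℚ.+_) (half+half ε)))
      (ℚ.+-monoˡ-≤ (½ ℚ.* ε) (proj₂ (below n N≤n))))

+ᴿ-cong : ∀ {x y u v} → x ≃ y → u ≃ v → (x +ᴿ u) ≃ (y +ᴿ v)
+ᴿ-cong {x} {y} {u} {v} (≃-intro h) (≃-intro k) = ≃-intro λ ε 0<ε →
  let N , close = both-half h k 0<ε in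
  N , λ n N≤n → ∣+-+∣≤ (seq x n) (seq u n) (seq y n) (seq v n)
    (proj₁ (close n N≤n)) (proj₂ (close n N≤n))

+ᴿ-mono : ∀ {x y u v} → x ≲ y → u ≲ v → (x +ᴿ u) ≲ (y +ᴿ v)
+ᴿ-mono {x} {y} {u} {v} (≲-intro h) (≲-intro k) = ≲-intro λ ε 0<ε →
  let N , below = both-half h k 0<ε in
  N , λ n N≤n → subst (seq x n ℚ.+ seq u n ℚ.≤_)
    (trans (+-interchange (seq y n) _ (seq v n) _)
           (cong (seq y n ℚ.+ seq v n ℚ.+_) (half+half ε)))
    (ℚ.+-mono-≤ (proj₁ (below n N≤n)) (proj₂ (below n N≤n)))

*ᴿ-congʳ : ∀ {x y} z → x ≃ y → (x *ᴿ z) ≃ (y *ᴿ z)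
*ᴿ-congʳ {x} {y} z (≃-intro h) = ≃-intro λ ε 0<ε →
  let M , 0<M , bound = eventually-bounded (seq z) (cauchy z)
      δ , 0<δ , Mδ≡ε = divide M ε 0<M 0<ε
      N , close = both bound (h δ 0<δ)
  in N , λ n N≤n → subst (λ q → ∣ q ∣ ℚ.≤ ε) (factor (seq z n) (seq x n) (seq y n))
       (∣*∣≤ (seq z n) (seq x n ℚ.- seq y n) 0<M Mδ≡ε
         (proj₁ (close n N≤n)) (proj₂ (close n N≤n)))
  where
  factor : ∀ c a b → c ℚ.* (a ℚ.- b) ≡ a ℚ.* c ℚ.- b ℚ.* c
  factor = let open ℚSolver.+-*-Solver in
    solve 3 (λ c a b → c :* (a :- b) := a :* c :- b :* c) refl

*ᴿ-congˡ-ℚ : ∀ q {x y} → x ≃ y → (fromℚ q *ᴿ x) ≃ (fromℚ q *ᴿ y)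
*ᴿ-congˡ-ℚ q {x} {y} h = ≃-trans (≗⇒≃ λ n → ℚ.*-comm q (seq x n))
  (≃-trans (*ᴿ-congʳ (fromℚ q) h) (≗⇒≃ λ n → ℚ.*-comm (seq y n) q))

*ᴿ-mono-ℚ : ∀ q {x y} → 0ℚ ℚ.≤ q → x ≲ y → (fromℚ q *ᴿ x) ≲ (fromℚ q *ᴿ y)
*ᴿ-mono-ℚ q {x} {y} 0≤q (≲-intro h) = ≲-intro λ ε 0<ε →
  let 0<q+1 = ℚ.+-mono-≤-< 0≤q (ℚ.positive⁻¹ 1ℚ)
      δ , 0<δ , e = divide (q ℚ.+ 1ℚ) ε 0<q+1 0<ε
      N , below = h δ 0<δ
  in N , λ n N≤n → begin
    q ℚ.* seq x n                       ≤⟨ ℚ.*-monoˡ-≤-nonNeg q {{ℚ.nonNegative 0≤q}} (below n N≤n) ⟩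
    q ℚ.* (seq y n ℚ.+ δ)               ≡⟨ ℚ.*-distribˡ-+ q (seq y n) δ ⟩
    q ℚ.* seq y n ℚ.+ q ℚ.* δ           ≤⟨ ℚ.+-monoʳ-≤ (q ℚ.* seq y n) (q*δ≤ 0<δ) ⟩
    q ℚ.* seq y n ℚ.+ (q ℚ.+ 1ℚ) ℚ.* δ  ≡⟨ cong (q ℚ.* seq y n ℚ.+_) e ⟩
    q ℚ.* seq y n ℚ.+ ε                 ∎
  where
  open ℚ.≤-Reasoning
  q*δ≤ : ∀ {δ} → 0ℚ ℚ.< δ → q ℚ.* δ ℚ.≤ (q ℚ.+ 1ℚ) ℚ.* δ
  q*δ≤ {δ} 0<δ = ℚ.*-monoʳ-≤-nonNeg δ {{ℚ.nonNegative (ℚ.<⇒≤ 0<δ)}} (p≤p+q q (ℚ.positive⁻¹ 1ℚ))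

fromℚ-cancel : ∀ {p q} → fromℚ p ≲ fromℚ q → p ℚ.≤ q
fromℚ-cancel {p} {q} (≲-intro h) with p ℚ.≤? q
... | yes p≤q = p≤q
... | no  p≰q = contradiction (ℚ.≤-<-trans below middle) (ℚ.<-irrefl refl)
  where
  0<p-q : 0ℚ ℚ.< p ℚ.- q
  0<p-q = subst (ℚ._< p ℚ.- q) (ℚ.+-inverseʳ q) (ℚ.+-monoˡ-< (ℚ.- q) (ℚ.≰⇒> p≰q))
  ε = ½ ℚ.* (p ℚ.- q)
  below : p ℚ.≤ q ℚ.+ ε
  below = let N , b = h ε (half-pos 0<p-q) in b N ℕ.≤-refl
  middle : q ℚ.+ ε ℚ.< p
  middle = subst (q ℚ.+ ε ℚ.<_)
    (trans (cong (q ℚ.+_) (half+half (p ℚ.- q))) (split-difference p q))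
    (ℚ.+-monoʳ-< q (subst (ℚ._< ε ℚ.+ ε) (ℚ.+-identityʳ ε) (ℚ.+-monoʳ-< ε (half-pos 0<p-q))))

∑ᴸ : {A : Set} → List A → (A → ℝ) → ℝ
∑ᴸ []       f = 0ᴿ
∑ᴸ (x ∷ xs) f = f x +ᴿ ∑ᴸ xs f

seq-∑ᴸ : ∀ {A : Set} (xs : List A) f n → seq (∑ᴸ xs f) n ≡ ∑ xs (λ x → seq (f x) n)
seq-∑ᴸ []       f n = refl
seq-∑ᴸ (x ∷ xs) f n = cong (seq (f x) n ℚ.+_) (seq-∑ᴸ xs f n)

∑ᴸ-cong : ∀ {A : Set} (xs : List A) {f g} → (∀ x → f x ≃ g x) → ∑ᴸ xs f ≃ ∑ᴸ xs g
∑ᴸ-cong []       h = ≃-refl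
∑ᴸ-cong (x ∷ xs) h = +ᴿ-cong (h x) (∑ᴸ-cong xs h)

∑ᴸ-mono : ∀ {A : Set} (xs : List A) {f g} → (∀ x → f x ≲ g x) → ∑ᴸ xs f ≲ ∑ᴸ xs g
∑ᴸ-mono []       h = ≲-refl
∑ᴸ-mono (x ∷ xs) h = +ᴿ-mono (h x) (∑ᴸ-mono xs h)

-- Used with `h` reading off one component of a real or complex number at a fixed index. It turns
-- the sums that occur in the definition of a query algorithm into rational sums over a list.
sumBasis-homo : ∀ {A : Set} (h : A → ℚ) {_⊕_ : A → A → A} {z : A} →
  h z ≡ 0ℚ → (∀ a b → h (a ⊕ b) ≡ h a ℚ.+ h b) → ∀ {N w} (g : Basis N w → A) →
  h (sumBasis _⊕_ z g) ≡ ∑ (basisList N w) (h ∘ g)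
sumBasis-homo h {_⊕_} {z} h0 hom {N} {w} g =
  trans (homo {N} λ i → foldr _⊕_ z (pair i))
  (trans (foldr-cong {N} λ i → trans (homo (pair i))
      (foldr-cong {w} λ y → hom (g (i , false , y)) (g (i , true , y))))
    (sumBasis≡∑ (h ∘ g)))
  where
  pair : Fin N → Fin w → _
  pair i y = g (i , false , y) ⊕ g (i , true , y)
  homo : ∀ {n} (f : Fin n → _) → h (foldr _⊕_ z f) ≡ foldr ℚ._+_ 0ℚ (h ∘ f)
  homo {zero}  f = h0
  homo {suc n} f = trans (hom _ _) (cong (h (f zero) ℚ.+_) (homo (f ∘ suc)))

-- The adversary method

square : ℚ → ℚ
square p = p ℚ.* p

0≤* : ∀ {p q} → 0ℚ ℚ.≤ p → 0ℚ ℚ.≤ q → 0ℚ ℚ.≤ p ℚ.* q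
0≤* {p} {q} 0≤p 0≤q = subst (ℚ._≤ p ℚ.* q) (ℚ.*-zeroʳ p)
  (ℚ.*-monoˡ-≤-nonNeg p {{ℚ.nonNegative 0≤p}} 0≤q)

0≤square : ∀ p → 0ℚ ℚ.≤ square p
0≤square p with ℚ.≤-total 0ℚ p
... | inj₁ 0≤p = 0≤* 0≤p 0≤p
... | inj₂ p≤0 = subst (0ℚ ℚ.≤_) (neg*neg p) (0≤* (ℚ.neg-antimono-≤ p≤0) (ℚ.neg-antimono-≤ p≤0))
  where
  neg*neg : ∀ p → (ℚ.- p) ℚ.* (ℚ.- p) ≡ p ℚ.* p
  neg*neg = let open ℚSolver.+-*-Solver in solve 1 (λ p → (:- p) :* (:- p) := p :* p) refl

≤-by-difference : ∀ {p q} d → 0ℚ ℚ.≤ d → p ℚ.+ d ≡ q → p ℚ.≤ q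
≤-by-difference {p} d 0≤d refl =
  subst (ℚ._≤ p ℚ.+ d) (ℚ.+-identityʳ p) (ℚ.+-monoʳ-≤ p 0≤d)

0≤+ : ∀ {p q} → 0ℚ ℚ.≤ p → 0ℚ ℚ.≤ q → 0ℚ ℚ.≤ p ℚ.+ q
0≤+ = ℚ.+-mono-≤

∑-product : ∀ {A B : Set} (xs : List A) (ys : List B) f g →
            ∑ xs f ℚ.* ∑ ys g ≡ ∑ xs λ x → ∑ ys λ y → f x ℚ.* g y
∑-product xs ys f g =
  trans (sym (∑-*ʳ xs (∑ ys g) f)) (∑-cong xs λ x → sym (∑-* ys (f x) g))

module _ {B : Set} (bs : List B) (x y : B → B → ℚ) (α β : B → ℚ) where

  -- The two parts of a summand of `U † ∙ U` for a matrix with entries x + iy, with `ℚ.- y` left in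
  -- the shape to which `conj` unfolds.
  gram-re gram-im : B → B → B → ℚ
  gram-re b c a = x a b ℚ.* x a c ℚ.- (ℚ.- y a b) ℚ.* y a c
  gram-im b c a = x a b ℚ.* y a c ℚ.+ (ℚ.- y a b) ℚ.* x a c

  private
    -- For ψ = α + iβ, `κ b c` and `μ b c` are the real and imaginary part of ψ_b times the
    -- conjugate of ψ_c.
    κ μ : B → B → ℚ
    κ b c = α b ℚ.* α c ℚ.+ β b ℚ.* β c
    μ b c = β b ℚ.* α c ℚ.- α b ℚ.* β c
    f g : B → B → ℚ
    f a b = x a b ℚ.* α b ℚ.- y a b ℚ.* β b
    g a b = x a b ℚ.* β b ℚ.+ y a b ℚ.* α b

    expand : ∀ x y x′ y′ a b a′ b′ →
      (x ℚ.* a ℚ.- y ℚ.* b) ℚ.* (x′ ℚ.* a′ ℚ.- y′ ℚ.* b′) ℚ.+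
      (x ℚ.* b ℚ.+ y ℚ.* a) ℚ.* (x′ ℚ.* b′ ℚ.+ y′ ℚ.* a′) ≡
      (x ℚ.* x′ ℚ.- (ℚ.- y) ℚ.* y′) ℚ.* (a ℚ.* a′ ℚ.+ b ℚ.* b′) ℚ.+
      (x ℚ.* y′ ℚ.+ (ℚ.- y) ℚ.* x′) ℚ.* (b ℚ.* a′ ℚ.- a ℚ.* b′)
    expand = let open ℚSolver.+-*-Solver in
      solve 8 (λ x y x′ y′ a b a′ b′ →
        (x :* a :- y :* b) :* (x′ :* a′ :- y′ :* b′) :+
        (x :* b :+ y :* a) :* (x′ :* b′ :+ y′ :* a′) :=
        (x :* x′ :- (:- y) :* y′) :* (a :* a′ :+ b :* b′) :+
        (x :* y′ :+ (:- y) :* x′) :* (b :* a′ :- a :* b′)) refl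

  -- The squared length of Uψ is the Hermitian form of the Gram matrix of U, evaluated at ψ. As a
  -- rational identity it holds for every matrix, hence at each index of the sequences, where U need
  -- not be unitary.
  norm-gram :
    (∑ bs λ a → square (∑ bs (f a)) ℚ.+ square (∑ bs (g a))) ≡
    (∑ bs λ b → ∑ bs λ c → ∑ bs (gram-re b c) ℚ.* κ b c ℚ.+ ∑ bs (gram-im b c) ℚ.* μ b c)
  norm-gram = begin
    (∑ bs λ a → square (∑ bs (f a)) ℚ.+ square (∑ bs (g a)))
      ≡⟨ ∑-cong bs (λ a → cong₂ ℚ._+_ (∑-product bs bs (f a) (f a)) (∑-product bs bs (g a) (g a))) ⟩
    (∑ bs λ a → (∑ bs λ b → ∑ bs λ c → f a b ℚ.* f a c) ℚ.+ (∑ bs λ b → ∑ bs λ c → g a b ℚ.* g a c))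
      ≡⟨ ∑-cong bs (λ a → trans (sym (∑-+ bs _ _)) (∑-cong bs λ b → trans (sym (∑-+ bs _ _)) (∑-cong bs λ c →
           expand (x a b) (y a b) (x a c) (y a c) (α b) (β b) (α c) (β c)))) ⟩
    (∑ bs λ a → ∑ bs λ b → ∑ bs λ c → gram-re b c a ℚ.* κ b c ℚ.+ gram-im b c a ℚ.* μ b c)
      ≡⟨ ∑-swap bs bs _ ⟩
    (∑ bs λ b → ∑ bs λ a → ∑ bs λ c → gram-re b c a ℚ.* κ b c ℚ.+ gram-im b c a ℚ.* μ b c)
      ≡⟨ ∑-cong bs (λ b → ∑-swap bs bs _) ⟩
    (∑ bs λ b → ∑ bs λ c → ∑ bs λ a → gram-re b c a ℚ.* κ b c ℚ.+ gram-im b c a ℚ.* μ b c)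
      ≡⟨ ∑-cong bs (λ b → ∑-cong bs λ c → trans (∑-+ bs _ _)
           (cong₂ ℚ._+_ (∑-*ʳ bs (κ b c) (gram-re b c)) (∑-*ʳ bs (μ b c) (gram-im b c)))) ⟩
    (∑ bs λ b → ∑ bs λ c → ∑ bs (gram-re b c) ℚ.* κ b c ℚ.+ ∑ bs (gram-im b c) ℚ.* μ b c) ∎
    where open ≡-Reasoning

module _ {N w : ℕ} where

  private
    bs : List (Basis N w)
    bs = basisList N w

  -- This is the squared norm, which keeps square roots out of the argument.
  norm : State N w → ℝ
  norm ψ = ∑ᴸ bs λ b → normSq (ψ b)

  infixl 6 _-ˢ_
  _-ˢ_ : State N w → State N w → State N w
  (ψ -ˢ φ) b = (re (ψ b) -ᴿ re (φ b)) +i (im (ψ b) -ᴿ im (φ b))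

  seq-norm : ∀ ψ n → seq (norm ψ) n ≡
    ∑ bs λ b → square (seq (re (ψ b)) n) ℚ.+ square (seq (im (ψ b)) n)
  seq-norm ψ n = seq-∑ᴸ bs (λ b → normSq (ψ b)) n

  seq-re-∑ᶜ : ∀ (g : Basis N w → ℂ) n → seq (re (∑ᶜ g)) n ≡ ∑ bs λ b → seq (re (g b)) n
  seq-re-∑ᶜ g n = sumBasis-homo (λ z → seq (re z) n) refl (λ _ _ → refl) g

  seq-im-∑ᶜ : ∀ (g : Basis N w → ℂ) n → seq (im (∑ᶜ g)) n ≡ ∑ bs λ b → seq (im (g b)) n
  seq-im-∑ᶜ g n = sumBasis-homo (λ z → seq (im z) n) refl (λ _ _ → refl) g

  norm-cong : ∀ {ψ φ : State N w} n →
    (∀ b → seq (re (ψ b)) n ≡ seq (re (φ b)) n) →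
    (∀ b → seq (im (ψ b)) n ≡ seq (im (φ b)) n) →
    seq (norm ψ) n ≡ seq (norm φ) n
  norm-cong {ψ} {φ} n hr hi = trans (seq-norm ψ n)
    (trans (∑-cong bs λ b → cong₂ ℚ._+_ (cong square (hr b)) (cong square (hi b)))
      (sym (seq-norm φ n)))

  ket-off : ∀ {b c : Basis N w} → b ≢ c → ket b c ≡ 0ᶜ
  ket-off {b} {c} b≢c with b ≟ᴮ c
  ... | yes b≡c = contradiction b≡c b≢c
  ... | no  _   = refl

  ket-diag : ∀ (b : Basis N w) → ket b b ≡ 1ᶜ
  ket-diag b with b ≟ᴮ b
  ... | yes _   = refl
  ... | no  b≢b = contradiction refl b≢b

  -- By `norm-gram` the left side is the form with matrix `U † ∙ U`. Its entries are replaced by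
  -- those of `identity` up to `_≃_`, after which only the diagonal survives.
  norm-unitary : ∀ {U : Operator N w} → IsUnitary U → ∀ ψ → norm (U · ψ) ≃ norm ψ
  norm-unitary {U} (U†U≈1 , _) ψ =
    ≃-trans (≗⇒≃ expand) (≃-trans (∑ᴸ-cong bs λ b → ∑ᴸ-cong bs λ c → +ᴿ-cong
        (*ᴿ-congʳ (κ b c) (≃-intro (proj₁ (U†U≈1 b c))))
        (*ᴿ-congʳ (μ b c) (≃-intro (proj₂ (U†U≈1 b c)))))
      (≗⇒≃ collapse))
    where
    G : Operator N w
    G = U † ∙ U
    κ μ : Basis N w → Basis N w → ℝ
    κ b c = re (ψ b) *ᴿ re (ψ c) +ᴿ im (ψ b) *ᴿ im (ψ c)
    μ b c = im (ψ b) *ᴿ re (ψ c) -ᴿ re (ψ b) *ᴿ im (ψ c)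
    term : ℂ → Basis N w → Basis N w → ℝ
    term g b c = re g *ᴿ κ b c +ᴿ im g *ᴿ μ b c
    row : Operator N w → Basis N w → ℝ
    row V b = ∑ᴸ bs λ c → term (V b c) b c
    form : Operator N w → ℝ
    form V = ∑ᴸ bs (row V)
    seq-form : ∀ V n → seq (form V) n ≡ ∑ bs λ b → ∑ bs λ c → seq (term (V b c) b c) n
    seq-form V n = trans (seq-∑ᴸ bs (row V) n)
      (∑-cong bs λ b → seq-∑ᴸ bs (λ c → term (V b c) b c) n)
    expand : ∀ n → seq (norm (U · ψ)) n ≡ seq (form G) n
    expand n = trans (seq-norm (U · ψ) n)
      (trans (∑-cong bs λ a → cong₂ ℚ._+_ (cong square (seq-re-∑ᶜ (λ b → U a b *ᶜ ψ b) n))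
                                           (cong square (seq-im-∑ᶜ (λ b → U a b *ᶜ ψ b) n)))
      (trans (norm-gram bs (λ a b → seq (re (U a b)) n) (λ a b → seq (im (U a b)) n)
                (λ b → seq (re (ψ b)) n) (λ b → seq (im (ψ b)) n))
      (trans (∑-cong bs λ b → ∑-cong bs λ c → cong₂ ℚ._+_
                (cong (ℚ._* seq (κ b c) n) (sym (seq-re-∑ᶜ (λ a → (U †) b a *ᶜ U a c) n)))
                (cong (ℚ._* seq (μ b c) n) (sym (seq-im-∑ᶜ (λ a → (U †) b a *ᶜ U a c) n))))
        (sym (seq-form G n)))))
    collapse : ∀ n → seq (form identity) n ≡ seq (norm ψ) n
    collapse n = trans (seq-form identity n)
      (trans (∑-cong bs λ b → trans
          (∑-basis-single (λ c → seq (term (identity b c) b c) n) b λ c c≢b → off b c (c≢b ∘ sym))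
          (diag b))
        (sym (seq-norm ψ n)))
      where
      zeros : ∀ p q → 0ℚ ℚ.* p ℚ.+ 0ℚ ℚ.* q ≡ 0ℚ
      zeros = let open ℚSolver.+-*-Solver in
        solve 2 (λ p q → con 0ℚ :* p :+ con 0ℚ :* q := con 0ℚ) refl
      unit : ∀ p q → 1ℚ ℚ.* p ℚ.+ 0ℚ ℚ.* q ≡ p
      unit = let open ℚSolver.+-*-Solver in
        solve 2 (λ p q → con 1ℚ :* p :+ con 0ℚ :* q := p) refl
      off : ∀ b c → b ≢ c → seq (term (identity b c) b c) n ≡ 0ℚ
      off b c b≢c = trans (cong (λ z → seq (term z b c) n) (ket-off b≢c))
        (zeros (seq (κ b c) n) (seq (μ b c) n))
      diag : ∀ b → seq (term (identity b b) b b) n ≡ seq (normSq (ψ b)) n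
      diag b = trans (cong (λ z → seq (term z b b) n) (ket-diag b))
        (unit (seq (κ b b) n) (seq (μ b b) n))

  dist-unitary : ∀ {U : Operator N w} → IsUnitary U → ∀ ψ φ →
                 norm (U · ψ -ˢ U · φ) ≃ norm (ψ -ˢ φ)
  dist-unitary {U} unitary ψ φ =
    ≃-trans
      (≗⇒≃ λ n → norm-cong {U · ψ -ˢ U · φ} {U · (ψ -ˢ φ)} n (linear-re n) (linear-im n))
      (norm-unitary {U} unitary (ψ -ˢ φ))
    where
    ∑-difference : ∀ (f g : Basis N w → ℚ) → ∑ bs f ℚ.- ∑ bs g ≡ ∑ bs λ b → f b ℚ.- g b
    ∑-difference f g = begin
      ∑ bs f ℚ.- ∑ bs g                              ≡⟨ cong (∑ bs f ℚ.+_) (neg≡-1* (∑ bs g)) ⟩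
      ∑ bs f ℚ.+ (ℚ.- 1ℚ) ℚ.* ∑ bs g                 ≡⟨ cong (∑ bs f ℚ.+_) (∑-* bs (ℚ.- 1ℚ) g) ⟨
      ∑ bs f ℚ.+ ∑ bs (λ b → (ℚ.- 1ℚ) ℚ.* g b)       ≡⟨ ∑-+ bs f _ ⟨
      (∑ bs λ b → f b ℚ.+ (ℚ.- 1ℚ) ℚ.* g b)          ≡⟨ ∑-cong bs (λ b → cong (f b ℚ.+_) (neg≡-1* (g b))) ⟨
      (∑ bs λ b → f b ℚ.- g b)                       ∎
      where
      open ≡-Reasoning
      neg≡-1* : ∀ p → ℚ.- p ≡ (ℚ.- 1ℚ) ℚ.* p
      neg≡-1* = let open ℚSolver.+-*-Solver in solve 1 (λ p → :- p := (:- con 1ℚ) :* p) refl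
    distrib-re : ∀ x y a b a′ b′ →
      (x ℚ.* a ℚ.- y ℚ.* b) ℚ.- (x ℚ.* a′ ℚ.- y ℚ.* b′) ≡ x ℚ.* (a ℚ.- a′) ℚ.- y ℚ.* (b ℚ.- b′)
    distrib-re = let open ℚSolver.+-*-Solver in
      solve 6 (λ x y a b a′ b′ → (x :* a :- y :* b) :- (x :* a′ :- y :* b′) :=
        x :* (a :- a′) :- y :* (b :- b′)) refl
    distrib-im : ∀ x y a b a′ b′ →
      (x ℚ.* b ℚ.+ y ℚ.* a) ℚ.- (x ℚ.* b′ ℚ.+ y ℚ.* a′) ≡ x ℚ.* (b ℚ.- b′) ℚ.+ y ℚ.* (a ℚ.- a′)
    distrib-im = let open ℚSolver.+-*-Solver in
      solve 6 (λ x y a b a′ b′ → (x :* b :+ y :* a) :- (x :* b′ :+ y :* a′) :=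
        x :* (b :- b′) :+ y :* (a :- a′)) refl
    linear-re : ∀ n a → seq (re ((U · ψ -ˢ U · φ) a)) n ≡ seq (re ((U · (ψ -ˢ φ)) a)) n
    linear-re n a = begin
      seq (re ((U · ψ) a)) n ℚ.- seq (re ((U · φ) a)) n
        ≡⟨ cong₂ ℚ._-_ (seq-re-∑ᶜ (λ b → U a b *ᶜ ψ b) n) (seq-re-∑ᶜ (λ b → U a b *ᶜ φ b) n) ⟩
      ∑ bs (λ b → seq (re (U a b *ᶜ ψ b)) n) ℚ.- ∑ bs (λ b → seq (re (U a b *ᶜ φ b)) n)
        ≡⟨ ∑-difference (λ b → seq (re (U a b *ᶜ ψ b)) n) (λ b → seq (re (U a b *ᶜ φ b)) n) ⟩
      ∑ bs (λ b → seq (re (U a b *ᶜ ψ b)) n ℚ.- seq (re (U a b *ᶜ φ b)) n)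
        ≡⟨ ∑-cong bs (λ b → distrib-re (seq (re (U a b)) n) (seq (im (U a b)) n)
             (seq (re (ψ b)) n) (seq (im (ψ b)) n) (seq (re (φ b)) n) (seq (im (φ b)) n)) ⟩
      ∑ bs (λ b → seq (re (U a b *ᶜ (ψ -ˢ φ) b)) n)
        ≡⟨ seq-re-∑ᶜ (λ b → U a b *ᶜ (ψ -ˢ φ) b) n ⟨
      seq (re ((U · (ψ -ˢ φ)) a)) n ∎
      where open ≡-Reasoning
    linear-im : ∀ n a → seq (im ((U · ψ -ˢ U · φ) a)) n ≡ seq (im ((U · (ψ -ˢ φ)) a)) n
    linear-im n a = begin
      seq (im ((U · ψ) a)) n ℚ.- seq (im ((U · φ) a)) n
        ≡⟨ cong₂ ℚ._-_ (seq-im-∑ᶜ (λ b → U a b *ᶜ ψ b) n) (seq-im-∑ᶜ (λ b → U a b *ᶜ φ b) n) ⟩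
      ∑ bs (λ b → seq (im (U a b *ᶜ ψ b)) n) ℚ.- ∑ bs (λ b → seq (im (U a b *ᶜ φ b)) n)
        ≡⟨ ∑-difference (λ b → seq (im (U a b *ᶜ ψ b)) n) (λ b → seq (im (U a b *ᶜ φ b)) n) ⟩
      ∑ bs (λ b → seq (im (U a b *ᶜ ψ b)) n ℚ.- seq (im (U a b *ᶜ φ b)) n)
        ≡⟨ ∑-cong bs (λ b → distrib-im (seq (re (U a b)) n) (seq (im (U a b)) n)
             (seq (re (ψ b)) n) (seq (im (ψ b)) n) (seq (re (φ b)) n) (seq (im (φ b)) n)) ⟩
      ∑ bs (λ b → seq (im (U a b *ᶜ (ψ -ˢ φ) b)) n)
        ≡⟨ seq-im-∑ᶜ (λ b → U a b *ᶜ (ψ -ˢ φ) b) n ⟨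
      seq (im ((U · (ψ -ˢ φ)) a)) n ∎
      where open ≡-Reasoning

-- The effect of one query on distances across the edges of a cube of inputs

flip : ∀ {M} → Fin M → Vec Bool M → Vec Bool M
flip zero    (b ∷ z) = not b ∷ z
flip (suc r) (b ∷ z) = b ∷ flip r z

cube : ∀ M → List (Vec Bool M)
cube zero    = [] ∷ []
cube (suc M) = map (false ∷_) (cube M) ++ map (true ∷_) (cube M)

∑-cube-suc : ∀ {M} (f : Vec Bool (suc M) → ℚ) →
  ∑ (cube (suc M)) f ≡ ∑ (cube M) (f ∘ (false ∷_)) ℚ.+ ∑ (cube M) (f ∘ (true ∷_))
∑-cube-suc {M} f = trans (∑-++ (map (false ∷_) (cube M)) (map (true ∷_) (cube M)) f)
  (cong₂ ℚ._+_ (∑-map (false ∷_) (cube M) f) (∑-map (true ∷_) (cube M) f))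

∑-flip : ∀ {M} r (f : Vec Bool M → ℚ) → ∑ (cube M) (f ∘ flip r) ≡ ∑ (cube M) f
∑-flip {suc M} zero f = begin
  ∑ (cube (suc M)) (f ∘ flip zero)
    ≡⟨ ∑-cube-suc (f ∘ flip zero) ⟩
  ∑ (cube M) (f ∘ (true ∷_)) ℚ.+ ∑ (cube M) (f ∘ (false ∷_))
    ≡⟨ ℚ.+-comm (∑ (cube M) (f ∘ (true ∷_))) (∑ (cube M) (f ∘ (false ∷_))) ⟩
  ∑ (cube M) (f ∘ (false ∷_)) ℚ.+ ∑ (cube M) (f ∘ (true ∷_))
    ≡⟨ ∑-cube-suc f ⟨
  ∑ (cube (suc M)) f ∎
  where open ≡-Reasoning
∑-flip {suc M} (suc r) f = trans (∑-cube-suc (f ∘ flip (suc r)))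
  (trans (cong₂ ℚ._+_ (∑-flip r (f ∘ (false ∷_))) (∑-flip r (f ∘ (true ∷_))))
    (sym (∑-cube-suc f)))

2ℚ 4ℚ : ℚ
2ℚ = + 2 / 1
4ℚ = + 4 / 1

module _ {N w : ℕ} where

  private
    bs : List (Basis N w)
    bs = basisList N w

  -- The real or the imaginary parts of a state at one index of the sequences. A query permutes
  -- basis labels, so it acts on the two parts separately.
  Amplitudes : Set
  Amplitudes = Basis N w → ℚ

  query : (Fin N → Bool) → Amplitudes → Amplitudes
  query x f (i , b , z) = f (i , b xor x i , z)

  onlyAt : Fin N → Fin N → ℚ → ℚ
  onlyAt k i q = if does (k Fin.≟ i) then q else 0ℚ

  weightAt : Fin N → Amplitudes → ℚ
  weightAt k f = ∑ bs λ b → onlyAt k (proj₁ b) (square (f b))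

  weight : Amplitudes → ℚ
  weight f = ∑ bs λ b → square (f b)

  xor-pair : ∀ s (g : Bool → ℚ) → g (false xor s) ℚ.+ g (true xor s) ≡ g false ℚ.+ g true
  xor-pair false g = refl
  xor-pair true  g = ℚ.+-comm (g true) (g false)

  weight-query : ∀ x f → weight (query x f) ≡ weight f
  weight-query x f = trans (∑-basisList λ b → square (query x f b))
    (trans (∑-cong (allFin N) λ i → ∑-cong (allFin w) λ z →
        xor-pair (x i) λ b → square (f (i , b , z)))
      (sym (∑-basisList λ b → square (f b))))

  -- Only the cross terms of pq(a - c)² change, and each of them is at most p²a² + q²c².
  query-pair : ∀ p q (a c : Bool → ℚ) s t →
    (p ℚ.* q) ℚ.* square (a (false xor s) ℚ.- c (false xor t)) ℚ.+
    (p ℚ.* q) ℚ.* square (a (true xor s) ℚ.- c (true xor t)) ℚ.≤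
    ((p ℚ.* q) ℚ.* square (a false ℚ.- c false) ℚ.+
     (2ℚ ℚ.* square p ℚ.* square (a false) ℚ.+ 2ℚ ℚ.* square q ℚ.* square (c false))) ℚ.+
    ((p ℚ.* q) ℚ.* square (a true ℚ.- c true) ℚ.+
     (2ℚ ℚ.* square p ℚ.* square (a true) ℚ.+ 2ℚ ℚ.* square q ℚ.* square (c true)))
  query-pair p q a c s t = bound s t
    where
    open ℚSolver.+-*-Solver
    P = p ℚ.* q
    extra : Bool → ℚ
    extra b = 2ℚ ℚ.* square p ℚ.* square (a b) ℚ.+ 2ℚ ℚ.* square q ℚ.* square (c b)
    0≤extra : ∀ b → 0ℚ ℚ.≤ extra b
    0≤extra b = 0≤+ (0≤* (0≤* {2ℚ} (ℚ.nonNegative⁻¹ 2ℚ) (0≤square p)) (0≤square (a b)))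
                    (0≤* (0≤* {2ℚ} (ℚ.nonNegative⁻¹ 2ℚ) (0≤square q)) (0≤square (c b)))
    -- When exactly one of the two inputs has the bit set, the slack of the bound is a sum of four
    -- squares.
    crossed : ∀ p q a₀ a₁ c₀ c₁ →
      ((p ℚ.* q) ℚ.* square (a₀ ℚ.- c₁) ℚ.+ (p ℚ.* q) ℚ.* square (a₁ ℚ.- c₀)) ℚ.+
      ((square (p ℚ.* a₀ ℚ.- q ℚ.* c₀) ℚ.+ square (p ℚ.* a₁ ℚ.- q ℚ.* c₁)) ℚ.+
       (square (p ℚ.* a₀ ℚ.+ q ℚ.* c₁) ℚ.+ square (p ℚ.* a₁ ℚ.+ q ℚ.* c₀))) ≡
      ((p ℚ.* q) ℚ.* square (a₀ ℚ.- c₀) ℚ.+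
        (2ℚ ℚ.* square p ℚ.* square a₀ ℚ.+ 2ℚ ℚ.* square q ℚ.* square c₀)) ℚ.+
      ((p ℚ.* q) ℚ.* square (a₁ ℚ.- c₁) ℚ.+
        (2ℚ ℚ.* square p ℚ.* square a₁ ℚ.+ 2ℚ ℚ.* square q ℚ.* square c₁))
    crossed = solve 6 (λ p q a₀ a₁ c₀ c₁ →
      let sq = λ x → x :* x in
      ((p :* q) :* sq (a₀ :- c₁) :+ (p :* q) :* sq (a₁ :- c₀)) :+
      ((sq (p :* a₀ :- q :* c₀) :+ sq (p :* a₁ :- q :* c₁)) :+
       (sq (p :* a₀ :+ q :* c₁) :+ sq (p :* a₁ :+ q :* c₀))) :=
      ((p :* q) :* sq (a₀ :- c₀) :+ (con 2ℚ :* sq p :* sq a₀ :+ con 2ℚ :* sq q :* sq c₀)) :+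
      ((p :* q) :* sq (a₁ :- c₁) :+ (con 2ℚ :* sq p :* sq a₁ :+ con 2ℚ :* sq q :* sq c₁))) refl
    0≤squares : ∀ a₀ a₁ c₀ c₁ → 0ℚ ℚ.≤
      (square (p ℚ.* a₀ ℚ.- q ℚ.* c₀) ℚ.+ square (p ℚ.* a₁ ℚ.- q ℚ.* c₁)) ℚ.+
      (square (p ℚ.* a₀ ℚ.+ q ℚ.* c₁) ℚ.+ square (p ℚ.* a₁ ℚ.+ q ℚ.* c₀))
    0≤squares a₀ a₁ c₀ c₁ = 0≤+ (0≤+ (0≤square (p ℚ.* a₀ ℚ.- q ℚ.* c₀)) (0≤square (p ℚ.* a₁ ℚ.- q ℚ.* c₁)))
                                (0≤+ (0≤square (p ℚ.* a₀ ℚ.+ q ℚ.* c₁)) (0≤square (p ℚ.* a₁ ℚ.+ q ℚ.* c₀)))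
    D : Bool → Bool → ℚ
    D b b′ = P ℚ.* square (a b ℚ.- c b′)
    bound : ∀ s t → D (false xor s) (false xor t) ℚ.+ D (true xor s) (true xor t) ℚ.≤
                    (D false false ℚ.+ extra false) ℚ.+ (D true true ℚ.+ extra true)
    bound false false = ≤-by-difference (extra false ℚ.+ extra true) (0≤+ (0≤extra false) (0≤extra true))
      (+-interchange (D false false) (D true true) (extra false) (extra true))
    bound true  true  = ≤-by-difference (extra false ℚ.+ extra true) (0≤+ (0≤extra false) (0≤extra true))
      (trans (cong (ℚ._+ (extra false ℚ.+ extra true)) (ℚ.+-comm (D true true) (D false false)))
        (+-interchange (D false false) (D true true) (extra false) (extra true)))
    bound false true  = ≤-by-difference _ (0≤squares (a false) (a true) (c false) (c true))
      (crossed p q (a false) (a true) (c false) (c true))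
    bound true  false = ≤-by-difference _ (0≤squares (a false) (a true) (c false) (c true))
      (trans (cong (ℚ._+ ((square (p ℚ.* a false ℚ.- q ℚ.* c false) ℚ.+ square (p ℚ.* a true ℚ.- q ℚ.* c true)) ℚ.+
                          (square (p ℚ.* a false ℚ.+ q ℚ.* c true) ℚ.+ square (p ℚ.* a true ℚ.+ q ℚ.* c false))))
               (ℚ.+-comm (D true false) (D false true)))
        (crossed p q (a false) (a true) (c false) (c true)))

  -- At an index where the inputs agree, the query permutes the amplitudes of both states in the
  -- same way and no distance changes, so all growth comes from index `k`. It is bounded by separate
  -- terms in `p²` and `q²`, so that each of the two inputs can be charged on its own.
  query-step : ∀ p q (f g : Amplitudes) x y k → (∀ i → i ≢ k → x i ≡ y i) →
    (p ℚ.* q) ℚ.* weight (λ b → query x f b ℚ.- query y g b) ℚ.≤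
    (p ℚ.* q) ℚ.* weight (λ b → f b ℚ.- g b) ℚ.+
    (2ℚ ℚ.* square p ℚ.* weightAt k f ℚ.+ 2ℚ ℚ.* square q ℚ.* weightAt k g)
  query-step p q f g x y k agree = begin
    P ℚ.* weight (λ b → query x f b ℚ.- query y g b)
      ≡⟨ ∑-* bs P (λ b → square (query x f b ℚ.- query y g b)) ⟨
    (∑ bs λ b → P ℚ.* square (query x f b ℚ.- query y g b))
      ≡⟨ ∑-basisList (λ b → P ℚ.* square (query x f b ℚ.- query y g b)) ⟩
    (∑ (allFin N) λ i → ∑ (allFin w) λ z → before i z)
      ≤⟨ ∑-≤ (allFin N) (λ i → ∑-≤ (allFin w) (step i)) ⟩
    (∑ (allFin N) λ i → ∑ (allFin w) λ z → after (i , false , z) ℚ.+ after (i , true , z))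
      ≡⟨ ∑-basisList after ⟨
    ∑ bs after
      ≡⟨ ∑-+ bs (λ b → P ℚ.* square (f b ℚ.- g b)) (λ b → A b ℚ.+ C b) ⟩
    ∑ bs (λ b → P ℚ.* square (f b ℚ.- g b)) ℚ.+ ∑ bs (λ b → A b ℚ.+ C b)
      ≡⟨ cong₂ ℚ._+_ (∑-* bs P λ b → square (f b ℚ.- g b)) (trans (∑-+ bs A C) (cong₂ ℚ._+_
           (∑-* bs (2ℚ ℚ.* square p) λ b → onlyAt k (proj₁ b) (square (f b)))
           (∑-* bs (2ℚ ℚ.* square q) λ b → onlyAt k (proj₁ b) (square (g b))))) ⟩
    P ℚ.* weight (λ b → f b ℚ.- g b) ℚ.+
      (2ℚ ℚ.* square p ℚ.* weightAt k f ℚ.+ 2ℚ ℚ.* square q ℚ.* weightAt k g) ∎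
    where
    open ℚ.≤-Reasoning
    P = p ℚ.* q
    A C after : Basis N w → ℚ
    A b = 2ℚ ℚ.* square p ℚ.* onlyAt k (proj₁ b) (square (f b))
    C b = 2ℚ ℚ.* square q ℚ.* onlyAt k (proj₁ b) (square (g b))
    after b = P ℚ.* square (f b ℚ.- g b) ℚ.+ (A b ℚ.+ C b)
    before : Fin N → Fin w → ℚ
    before i z = P ℚ.* square (query x f (i , false , z) ℚ.- query y g (i , false , z)) ℚ.+
                 P ℚ.* square (query x f (i , true , z) ℚ.- query y g (i , true , z))
    step : ∀ i z → before i z ℚ.≤ after (i , false , z) ℚ.+ after (i , true , z)
    step i z with k Fin.≟ i
    ... | yes _ = query-pair p q (λ b → f (i , b , z)) (λ b → g (i , b , z)) (x i) (y i)
    ... | no k≢i rewrite agree i (k≢i ∘ sym) = ℚ.≤-reflexive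
      (trans (xor-pair (y i) λ b → P ℚ.* square (f (i , b , z) ℚ.- g (i , b , z)))
        (sym (cong₂ ℚ._+_ (drop (P ℚ.* square (f (i , false , z) ℚ.- g (i , false , z))))
                          (drop (P ℚ.* square (f (i , true , z) ℚ.- g (i , true , z)))))))
      where
      drop : ∀ d → d ℚ.+ (2ℚ ℚ.* square p ℚ.* 0ℚ ℚ.+ 2ℚ ℚ.* square q ℚ.* 0ℚ) ≡ d
      drop d = p+0≡p d (p+q≡0 (ℚ.*-zeroʳ (2ℚ ℚ.* square p)) (ℚ.*-zeroʳ (2ℚ ℚ.* square q)))

  ∑-weightAt : ∀ {M} (ι : Fin M → Fin N) → (∀ {r s} → ι r ≡ ι s → r ≡ s) → ∀ f →
               ∑ (allFin M) (λ r → weightAt (ι r) f) ℚ.≤ weight f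
  ∑-weightAt {M} ι inj f = begin
    (∑ (allFin M) λ r → weightAt (ι r) f)
      ≡⟨ ∑-swap (allFin M) bs (λ r b → onlyAt (ι r) (proj₁ b) (square (f b))) ⟩
    (∑ bs λ b → ∑ (allFin M) λ r → onlyAt (ι r) (proj₁ b) (square (f b)))
      ≤⟨ ∑-≤ bs (λ b → atMostOnce (proj₁ b) (0≤square (f b))) ⟩
    weight f ∎
    where
    open ℚ.≤-Reasoning
    onlyAt-off : ∀ {k i} q → k ≢ i → onlyAt k i q ≡ 0ℚ
    onlyAt-off {k} {i} q k≢i with k Fin.≟ i
    ... | yes k≡i = contradiction k≡i k≢i
    ... | no  _   = refl
    onlyAt-≤ : ∀ k i {q} → 0ℚ ℚ.≤ q → onlyAt k i q ℚ.≤ q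
    onlyAt-≤ k i 0≤q with k Fin.≟ i
    ... | yes _ = ℚ.≤-refl
    ... | no  _ = 0≤q
    atMostOnce : ∀ i {q} → 0ℚ ℚ.≤ q → ∑ (allFin M) (λ r → onlyAt (ι r) i q) ℚ.≤ q
    atMostOnce i {q} 0≤q with Fin.any? (λ r → ι r Fin.≟ i)
    ... | yes (r , e) = ℚ.≤-trans
      (ℚ.≤-reflexive (∑-single (λ r → onlyAt (ι r) i q) r λ s s≢r →
        onlyAt-off q λ e′ → s≢r (inj (trans e′ (sym e)))))
      (onlyAt-≤ (ι r) i 0≤q)
    ... | no ∄ = ℚ.≤-trans (ℚ.≤-reflexive (trans
      (∑-cong (allFin M) λ r → onlyAt-off q λ e → ∄ (r , e)) (∑-0 (allFin M)))) 0≤q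

  -- Summing `query-step` over the edges, the charges to `z` and to `flip r z` have equal totals by
  -- reindexing. For a fixed `z` the positions `ι r` are distinct, so the charges over all `r` add
  -- up to at most the full weight of the state. The constant 4 is 2 + 2, one 2 for each end of an
  -- edge.
  query-potential : ∀ {M} (v : Vec Bool M → ℚ) (X : Vec Bool M → Fin N → Bool)
    (ι : Fin M → Fin N) → (∀ {r s} → ι r ≡ ι s → r ≡ s) →
    (∀ z r i → i ≢ ι r → X z i ≡ X (flip r z) i) → (ψ : Vec Bool M → Amplitudes) →
    (∑ (cube M) λ z → ∑ (allFin M) λ r → (v z ℚ.* v (flip r z)) ℚ.*
       weight (λ b → query (X z) (ψ z) b ℚ.- query (X (flip r z)) (ψ (flip r z)) b)) ℚ.≤
    (∑ (cube M) λ z → ∑ (allFin M) λ r → (v z ℚ.* v (flip r z)) ℚ.*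
       weight (λ b → ψ z b ℚ.- ψ (flip r z) b)) ℚ.+
    (∑ (cube M) λ z → 4ℚ ℚ.* square (v z) ℚ.* weight (ψ z))
  query-potential {M} v X ι inj local ψ = begin
    (∑ (cube M) λ z → ∑ (allFin M) λ r → (v z ℚ.* v (flip r z)) ℚ.*
       weight (λ b → query (X z) (ψ z) b ℚ.- query (X (flip r z)) (ψ (flip r z)) b))
      ≤⟨ ∑-≤ (cube M) (λ z → ∑-≤ (allFin M) λ r →
           query-step (v z) (v (flip r z)) (ψ z) (ψ (flip r z)) (X z) (X (flip r z)) (ι r) (local z r)) ⟩
    (∑ (cube M) λ z → ∑ (allFin M) λ r → D z r ℚ.+ (E z r ℚ.+ E (flip r z) r))
      ≡⟨ trans (∑-cong (cube M) λ z → ∑-+ (allFin M) (D z) λ r → E z r ℚ.+ E (flip r z) r)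
           (∑-+ (cube M) (λ z → ∑ (allFin M) (D z)) λ z → ∑ (allFin M) λ r → E z r ℚ.+ E (flip r z) r) ⟩
    total ℚ.+ (∑ (cube M) λ z → ∑ (allFin M) λ r → E z r ℚ.+ E (flip r z) r)
      ≡⟨ cong (total ℚ.+_) (trans (∑-cong (cube M) λ z → ∑-+ (allFin M) (E z) λ r → E (flip r z) r)
           (∑-+ (cube M) (λ z → ∑ (allFin M) (E z)) λ z → ∑ (allFin M) λ r → E (flip r z) r)) ⟩
    total ℚ.+ ((∑ (cube M) λ z → ∑ (allFin M) (E z)) ℚ.+
               (∑ (cube M) λ z → ∑ (allFin M) λ r → E (flip r z) r))
      ≡⟨ cong (λ q → total ℚ.+ ((∑ (cube M) λ z → ∑ (allFin M) (E z)) ℚ.+ q)) reindex ⟩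
    total ℚ.+ ((∑ (cube M) λ z → ∑ (allFin M) (E z)) ℚ.+ (∑ (cube M) λ z → ∑ (allFin M) (E z)))
      ≤⟨ ℚ.+-monoʳ-≤ total (ℚ.+-mono-≤ (∑-≤ (cube M) collect) (∑-≤ (cube M) collect)) ⟩
    total ℚ.+ ((∑ (cube M) λ z → 2ℚ ℚ.* square (v z) ℚ.* weight (ψ z)) ℚ.+
               (∑ (cube M) λ z → 2ℚ ℚ.* square (v z) ℚ.* weight (ψ z)))
      ≡⟨ cong (total ℚ.+_) (trans
           (sym (∑-+ (cube M) (λ z → 2ℚ ℚ.* square (v z) ℚ.* weight (ψ z)) λ z → 2ℚ ℚ.* square (v z) ℚ.* weight (ψ z)))
           (∑-cong (cube M) λ z → double (square (v z)) (weight (ψ z)))) ⟩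
    total ℚ.+ (∑ (cube M) λ z → 4ℚ ℚ.* square (v z) ℚ.* weight (ψ z)) ∎
    where
    open ℚ.≤-Reasoning
    D E : Vec Bool M → Fin M → ℚ
    D z r = (v z ℚ.* v (flip r z)) ℚ.* weight (λ b → ψ z b ℚ.- ψ (flip r z) b)
    E z r = 2ℚ ℚ.* square (v z) ℚ.* weightAt (ι r) (ψ z)
    total : ℚ
    total = ∑ (cube M) λ z → ∑ (allFin M) (D z)
    reindex : (∑ (cube M) λ z → ∑ (allFin M) λ r → E (flip r z) r) ≡
              (∑ (cube M) λ z → ∑ (allFin M) (E z))
    reindex = trans (∑-swap (cube M) (allFin M) (λ z r → E (flip r z) r))
      (trans (∑-cong (allFin M) λ r → ∑-flip r (λ z → E z r))
        (sym (∑-swap (cube M) (allFin M) E)))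
    collect : ∀ z → ∑ (allFin M) (E z) ℚ.≤ 2ℚ ℚ.* square (v z) ℚ.* weight (ψ z)
    collect z = ℚ.≤-trans (ℚ.≤-reflexive (∑-* (allFin M) (2ℚ ℚ.* square (v z)) λ r → weightAt (ι r) (ψ z)))
      (ℚ.*-monoˡ-≤-nonNeg (2ℚ ℚ.* square (v z))
        {{ℚ.nonNegative (0≤* {2ℚ} (ℚ.nonNegative⁻¹ 2ℚ) (0≤square (v z)))}} (∑-weightAt ι inj (ψ z)))
    double : ∀ s t → 2ℚ ℚ.* s ℚ.* t ℚ.+ 2ℚ ℚ.* s ℚ.* t ≡ 4ℚ ℚ.* s ℚ.* t
    double = let open ℚSolver.+-*-Solver in
      solve 2 (λ s t → con 2ℚ :* s :* t :+ con 2ℚ :* s :* t := con 4ℚ :* s :* t) refl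

-- The progress function along a run

module Potential {N w M : ℕ} (v : Vec Bool M → ℚ) where

  private
    bs : List (Basis N w)
    bs = basisList N w

    pairWeight : Vec Bool M → Fin M → ℚ
    pairWeight z r = v z ℚ.* v (flip r z)

    charge : Vec Bool M → ℚ
    charge z = 4ℚ ℚ.* square (v z)

  -- The progress function of the adversary method with the product of `v` at both ends as weight of
  -- an edge. Squared distances replace the usual inner products, so it vanishes when all states are
  -- equal, as they are at the start.
  potential : (Vec Bool M → State N w) → ℝ
  potential ψ = ∑ᴸ (cube M) λ z → ∑ᴸ (allFin M) λ r →
    fromℚ (pairWeight z r) *ᴿ norm (ψ z -ˢ ψ (flip r z))

  mass : (Vec Bool M → State N w) → ℝ
  mass ψ = ∑ᴸ (cube M) λ z → fromℚ (charge z) *ᴿ norm (ψ z)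

  totalCharge : ℚ
  totalCharge = ∑ (cube M) charge

  private
    real imag : (Vec Bool M → State N w) → ℕ → Vec Bool M → Basis N w → ℚ
    real ψ n z b = seq (re (ψ z b)) n
    imag ψ n z b = seq (im (ψ z b)) n

    rationalPotential : (Vec Bool M → Basis N w → ℚ) → ℚ
    rationalPotential f = ∑ (cube M) λ z → ∑ (allFin M) λ r →
      pairWeight z r ℚ.* weight (λ b → f z b ℚ.- f (flip r z) b)

    seq-norm-split : ∀ (φ : State N w) n →
      seq (norm φ) n ≡ weight (λ b → seq (re (φ b)) n) ℚ.+ weight (λ b → seq (im (φ b)) n)
    seq-norm-split φ n = trans (seq-norm φ n)
      (∑-+ bs (λ b → square (seq (re (φ b)) n)) (λ b → square (seq (im (φ b)) n)))

    seq-potential : ∀ ψ n → seq (potential ψ) n ≡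
      rationalPotential (real ψ n) ℚ.+ rationalPotential (imag ψ n)
    seq-potential ψ n = begin
      seq (potential ψ) n
        ≡⟨ seq-∑ᴸ (cube M) (λ z → ∑ᴸ (allFin M) (term z)) n ⟩
      (∑ (cube M) λ z → seq (∑ᴸ (allFin M) (term z)) n)
        ≡⟨ ∑-cong (cube M) (λ z → seq-∑ᴸ (allFin M) (term z) n) ⟩
      (∑ (cube M) λ z → ∑ (allFin M) λ r → pairWeight z r ℚ.* seq (norm (ψ z -ˢ ψ (flip r z))) n)
        ≡⟨ ∑-cong (cube M) (λ z → ∑-cong (allFin M) λ r → trans
             (cong (pairWeight z r ℚ.*_) (seq-norm-split (ψ z -ˢ ψ (flip r z)) n))
             (ℚ.*-distribˡ-+ (pairWeight z r) _ _)) ⟩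
      (∑ (cube M) λ z → ∑ (allFin M) λ r → R z r ℚ.+ I z r)
        ≡⟨ ∑-cong (cube M) (λ z → ∑-+ (allFin M) (R z) (I z)) ⟩
      (∑ (cube M) λ z → ∑ (allFin M) (R z) ℚ.+ ∑ (allFin M) (I z))
        ≡⟨ ∑-+ (cube M) (λ z → ∑ (allFin M) (R z)) (λ z → ∑ (allFin M) (I z)) ⟩
      rationalPotential (real ψ n) ℚ.+ rationalPotential (imag ψ n) ∎
      where
      open ≡-Reasoning
      term : Vec Bool M → Fin M → ℝ
      term z r = fromℚ (pairWeight z r) *ᴿ norm (ψ z -ˢ ψ (flip r z))
      R I : Vec Bool M → Fin M → ℚ
      R z r = pairWeight z r ℚ.* weight (λ b → real ψ n z b ℚ.- real ψ n (flip r z) b)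
      I z r = pairWeight z r ℚ.* weight (λ b → imag ψ n z b ℚ.- imag ψ n (flip r z) b)

    seq-mass : ∀ ψ n → seq (mass ψ) n ≡
      (∑ (cube M) λ z → charge z ℚ.* weight (real ψ n z)) ℚ.+
      (∑ (cube M) λ z → charge z ℚ.* weight (imag ψ n z))
    seq-mass ψ n = trans (seq-∑ᴸ (cube M) (λ z → fromℚ (charge z) *ᴿ norm (ψ z)) n)
      (trans (∑-cong (cube M) λ z → trans (cong (charge z ℚ.*_) (seq-norm-split (ψ z) n))
          (ℚ.*-distribˡ-+ (charge z) (weight (real ψ n z)) (weight (imag ψ n z))))
        (∑-+ (cube M) (λ z → charge z ℚ.* weight (real ψ n z))
                      (λ z → charge z ℚ.* weight (imag ψ n z))))

  mass-unit : ∀ ψ → (∀ z → norm (ψ z) ≃ 1ᴿ) → mass ψ ≃ fromℚ totalCharge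
  mass-unit ψ unit = ≃-trans (∑ᴸ-cong (cube M) λ z → *ᴿ-congˡ-ℚ (charge z) (unit z)) (≗⇒≃ λ n →
    trans (seq-∑ᴸ (cube M) (λ z → fromℚ (charge z) *ᴿ 1ᴿ) n)
      (∑-cong (cube M) λ z → ℚ.*-identityʳ (charge z)))

  potential-unitary : ∀ {U : Operator N w} → IsUnitary U → ∀ ψ →
                      potential (λ z → U · ψ z) ≃ potential ψ
  potential-unitary {U} unitary ψ = ∑ᴸ-cong (cube M) λ z → ∑ᴸ-cong (allFin M) λ r →
    *ᴿ-congˡ-ℚ (pairWeight z r) (dist-unitary {U = U} unitary (ψ z) (ψ (flip r z)))

  norm-oracle : ∀ x (φ : State N w) → norm (oracle x φ) ≃ norm φ
  norm-oracle x φ = ≗⇒≃ λ n → begin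
    seq (norm (oracle x φ)) n
      ≡⟨ seq-norm-split (oracle x φ) n ⟩
    weight (query x (λ b → seq (re (φ b)) n)) ℚ.+ weight (query x (λ b → seq (im (φ b)) n))
      ≡⟨ cong₂ ℚ._+_ (weight-query x λ b → seq (re (φ b)) n) (weight-query x λ b → seq (im (φ b)) n) ⟩
    weight (λ b → seq (re (φ b)) n) ℚ.+ weight (λ b → seq (im (φ b)) n)
      ≡⟨ seq-norm-split φ n ⟨
    seq (norm φ) n ∎
    where open ≡-Reasoning

  module _ (X : Vec Bool M → Fin N → Bool) (ι : Fin M → Fin N)
           (ι-injective : ∀ {r s} → ι r ≡ ι s → r ≡ s)
           (local : ∀ z r i → i ≢ ι r → X z i ≡ X (flip r z) i) where

    potential-oracle : ∀ ψ → potential (λ z → oracle (X z) (ψ z)) ≲ (potential ψ +ᴿ mass ψ)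
    potential-oracle ψ = pointwise-≲ λ n → begin
      seq (potential (λ z → oracle (X z) (ψ z))) n
        ≡⟨ seq-potential (λ z → oracle (X z) (ψ z)) n ⟩
      rationalPotential (λ z → query (X z) (real ψ n z)) ℚ.+
      rationalPotential (λ z → query (X z) (imag ψ n z))
        ≤⟨ ℚ.+-mono-≤ (query-potential v X ι ι-injective local (real ψ n))
                      (query-potential v X ι ι-injective local (imag ψ n)) ⟩
      (rationalPotential (real ψ n) ℚ.+ (∑ (cube M) λ z → charge z ℚ.* weight (real ψ n z))) ℚ.+
      (rationalPotential (imag ψ n) ℚ.+ (∑ (cube M) λ z → charge z ℚ.* weight (imag ψ n z)))
        ≡⟨ +-interchange (rationalPotential (real ψ n)) _ (rationalPotential (imag ψ n)) _ ⟩
      (rationalPotential (real ψ n) ℚ.+ rationalPotential (imag ψ n)) ℚ.+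
      ((∑ (cube M) λ z → charge z ℚ.* weight (real ψ n z)) ℚ.+
       (∑ (cube M) λ z → charge z ℚ.* weight (imag ψ n z)))
        ≡⟨ cong₂ ℚ._+_ (seq-potential ψ n) (seq-mass ψ n) ⟨
      seq (potential ψ +ᴿ mass ψ) n ∎
      where open ℚ.≤-Reasoning

    norm-run : ∀ {T} (U : Fin (suc T) → Operator N w) → (∀ t → IsUnitary (U t)) →
               ∀ x φ → norm (run U x φ) ≃ norm φ
    norm-run {zero}  U unitary x φ = norm-unitary {U = U zero} (unitary zero) φ
    norm-run {suc T} U unitary x φ = ≃-trans
      (norm-run (U ∘ suc) (λ t → unitary (suc t)) x (oracle x (U zero · φ)))
      (≃-trans (norm-oracle x (U zero · φ)) (norm-unitary {U = U zero} (unitary zero) φ))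

    -- Unitaries preserve the distances, and a query adds at most `mass`. The states stay
    -- normalised, so `mass` is the constant `totalCharge` at every query.
    potential-run : ∀ {T} (U : Fin (suc T) → Operator N w) → (∀ t → IsUnitary (U t)) →
      ∀ ψ → (∀ z → norm (ψ z) ≃ 1ᴿ) →
      potential (λ z → run U (X z) (ψ z)) ≲ (potential ψ +ᴿ fromℚ ((+ T / 1) ℚ.* totalCharge))
    potential-run {zero} U unitary ψ unit = ≲-trans
      (≃⇒≲ (potential-unitary {U = U zero} (unitary zero) ψ))
      (pointwise-≲ λ n → ℚ.≤-reflexive (sym (p+0≡p (seq (potential ψ) n) (ℚ.*-zeroˡ totalCharge))))
    potential-run {suc T} U unitary ψ unit = ≲-trans
      (potential-run (U ∘ suc) (λ t → unitary (suc t)) χ χ-unit)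
      (≲-trans (+ᴿ-mono step ≲-refl) (pointwise-≲ λ n →
        ℚ.≤-reflexive (trans (regroup (seq (potential ψ) n) totalCharge (+ T / 1))
          (cong (λ q → seq (potential ψ) n ℚ.+ q ℚ.* totalCharge) (sym (/-suc T 0))))))
      where
      φ χ : Vec Bool M → State N w
      φ z = U zero · ψ z
      χ z = oracle (X z) (φ z)
      φ-unit : ∀ z → norm (φ z) ≃ 1ᴿ
      φ-unit z = ≃-trans (norm-unitary {U = U zero} (unitary zero) (ψ z)) (unit z)
      χ-unit : ∀ z → norm (χ z) ≃ 1ᴿ
      χ-unit z = ≃-trans (norm-oracle (X z) (φ z)) (φ-unit z)
      regroup : ∀ p c t → (p ℚ.+ c) ℚ.+ t ℚ.* c ≡ p ℚ.+ (t ℚ.+ 1ℚ) ℚ.* c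
      regroup = let open ℚSolver.+-*-Solver in
        solve 3 (λ p c t → (p :+ c) :+ t :* c := p :+ (t :+ con 1ℚ) :* c) refl
      step : potential χ ≲ (potential ψ +ᴿ fromℚ totalCharge)
      step = ≲-trans (potential-oracle φ) (≃⇒≲ (+ᴿ-cong
        (potential-unitary {U = U zero} (unitary zero) ψ) (mass-unit φ φ-unit)))

-- From success probability to distance of final states, and the adversary bound

5/9ℚ 1/18ℚ 1/3ℚ 3ℚ : ℚ
5/9ℚ  = + 5 / 9
1/18ℚ = + 1 / 18
1/3ℚ  = + 1 / 3
3ℚ    = + 3 / 1

norm-ket : ∀ {N w} (s : Basis N w) → norm (ket s) ≃ 1ᴿ
norm-ket {N} {w} s = ≗⇒≃ λ n →
  trans (seq-∑ᴸ (basisList N w) (λ b → normSq (ket s b)) n)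
  (trans (∑-basis-single (λ b → seq (normSq (ket s b)) n) s λ c c≢s →
      cong (λ a → seq (normSq a) n) (ket-off (c≢s ∘ sym)))
    (cong (λ a → seq (normSq a) n) (ket-diag s)))

-- |a|² ≤ 3|a - c|² + (3/2)|c|² turns a gap between acceptance probabilities into a distance.
amplitude-gap : ∀ a c → 1/3ℚ ℚ.* square a ℚ.≤ square (a ℚ.- c) ℚ.+ ½ ℚ.* square c
amplitude-gap a c = ≤-by-difference (1/3ℚ ℚ.* (½ ℚ.* square (2ℚ ℚ.* a ℚ.- 3ℚ ℚ.* c)))
  (0≤* {1/3ℚ} (ℚ.nonNegative⁻¹ 1/3ℚ) (0≤* {½} (ℚ.nonNegative⁻¹ ½) (0≤square (2ℚ ℚ.* a ℚ.- 3ℚ ℚ.* c))))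
  (identity₁ a c)
  where
  identity₁ : ∀ a c → 1/3ℚ ℚ.* square a ℚ.+ 1/3ℚ ℚ.* (½ ℚ.* square (2ℚ ℚ.* a ℚ.- 3ℚ ℚ.* c)) ≡
              square (a ℚ.- c) ℚ.+ ½ ℚ.* square c
  identity₁ = let open ℚSolver.+-*-Solver in
    solve 2 (λ a c → con 1/3ℚ :* (a :* a) :+
        con 1/3ℚ :* (con ½ :* ((con 2ℚ :* a :- con 3ℚ :* c) :* (con 2ℚ :* a :- con 3ℚ :* c))) :=
      (a :- c) :* (a :- c) :+ con ½ :* (c :* c)) refl

module _ {N w : ℕ} where

  private
    bs : List (Basis N w)
    bs = basisList N w

    accept : (Basis N w → Bool) → State N w → ℝ
    accept p ψ = ∑ᴸ bs λ b → if p b then normSq (ψ b) else 0ᴿ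

  -- Label by label: where `p` holds, `amplitude-gap` applies and `q` contributes nothing; where `q`
  -- holds, its term is already the share of that label in half the norm of `φ`.
  accept-gap : ∀ (ψ φ : State N w) (p q : Basis N w → Bool) → (∀ b → p b ≡ true → q b ≡ false) →
    (fromℚ 1/3ℚ *ᴿ accept p ψ +ᴿ fromℚ ½ *ᴿ accept q φ) ≲ (norm (ψ -ˢ φ) +ᴿ fromℚ ½ *ᴿ norm φ)
  accept-gap ψ φ p q disjoint = pointwise-≲ bound
    where
    module _ (n : ℕ) where
      a a′ c c′ : Basis N w → ℚ
      a  b = seq (re (ψ b)) n
      a′ b = seq (im (ψ b)) n
      c  b = seq (re (φ b)) n
      c′ b = seq (im (φ b)) n
      left : Bool → State N w → Basis N w → ℚ
      left t χ b = seq (if t then normSq (χ b) else 0ᴿ) n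
      D S : Basis N w → ℚ
      D b = square (a b ℚ.- c b) ℚ.+ square (a′ b ℚ.- c′ b)
      S b = square (c b) ℚ.+ square (c′ b)
      0≤D : ∀ b → 0ℚ ℚ.≤ D b
      0≤D b = 0≤+ (0≤square (a b ℚ.- c b)) (0≤square (a′ b ℚ.- c′ b))
      0≤S : ∀ b → 0ℚ ℚ.≤ ½ ℚ.* S b
      0≤S b = 0≤* {½} (ℚ.nonNegative⁻¹ ½) (0≤+ (0≤square (c b)) (0≤square (c′ b)))
      pointwise : ∀ b s t → (s ≡ true → t ≡ false) →
        1/3ℚ ℚ.* left s ψ b ℚ.+ ½ ℚ.* left t φ b ℚ.≤ D b ℚ.+ ½ ℚ.* S b
      pointwise b true true d = contradiction (d refl) λ ()
      pointwise b true false d = ℚ.≤-trans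
        (ℚ.≤-reflexive (trans (p+0≡p _ (ℚ.*-zeroʳ ½)) (ℚ.*-distribˡ-+ 1/3ℚ (square (a b)) (square (a′ b)))))
        (ℚ.≤-trans (ℚ.+-mono-≤ (amplitude-gap (a b) (c b)) (amplitude-gap (a′ b) (c′ b)))
          (ℚ.≤-reflexive (trans (+-interchange (square (a b ℚ.- c b)) _ (square (a′ b ℚ.- c′ b)) _)
            (cong (D b ℚ.+_) (sym (ℚ.*-distribˡ-+ ½ (square (c b)) (square (c′ b))))))))
      pointwise b false true d = ℚ.+-mono-≤
        (ℚ.≤-trans (ℚ.≤-reflexive (ℚ.*-zeroʳ 1/3ℚ)) (0≤D b)) ℚ.≤-refl
      pointwise b false false d = ℚ.+-mono-≤
        (ℚ.≤-trans (ℚ.≤-reflexive (ℚ.*-zeroʳ 1/3ℚ)) (0≤D b))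
        (ℚ.≤-trans (ℚ.≤-reflexive (ℚ.*-zeroʳ ½)) (0≤S b))
      bound : 1/3ℚ ℚ.* seq (accept p ψ) n ℚ.+ ½ ℚ.* seq (accept q φ) n ℚ.≤
              seq (norm (ψ -ˢ φ)) n ℚ.+ ½ ℚ.* seq (norm φ) n
      bound = begin
        1/3ℚ ℚ.* seq (accept p ψ) n ℚ.+ ½ ℚ.* seq (accept q φ) n
          ≡⟨ cong₂ (λ s t → 1/3ℚ ℚ.* s ℚ.+ ½ ℚ.* t)
               (seq-∑ᴸ bs (λ b → if p b then normSq (ψ b) else 0ᴿ) n)
               (seq-∑ᴸ bs (λ b → if q b then normSq (φ b) else 0ᴿ) n) ⟩
        1/3ℚ ℚ.* ∑ bs (λ b → left (p b) ψ b) ℚ.+ ½ ℚ.* ∑ bs (λ b → left (q b) φ b)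
          ≡⟨ cong₂ ℚ._+_ (∑-* bs 1/3ℚ λ b → left (p b) ψ b) (∑-* bs ½ λ b → left (q b) φ b) ⟨
        ∑ bs (λ b → 1/3ℚ ℚ.* left (p b) ψ b) ℚ.+ ∑ bs (λ b → ½ ℚ.* left (q b) φ b)
          ≡⟨ ∑-+ bs (λ b → 1/3ℚ ℚ.* left (p b) ψ b) (λ b → ½ ℚ.* left (q b) φ b) ⟨
        (∑ bs λ b → 1/3ℚ ℚ.* left (p b) ψ b ℚ.+ ½ ℚ.* left (q b) φ b)
          ≤⟨ ∑-≤ bs (λ b → pointwise b (p b) (q b) (disjoint b)) ⟩
        (∑ bs λ b → D b ℚ.+ ½ ℚ.* S b)
          ≡⟨ ∑-+ bs D (λ b → ½ ℚ.* S b) ⟩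
        ∑ bs D ℚ.+ ∑ bs (λ b → ½ ℚ.* S b)
          ≡⟨ cong (∑ bs D ℚ.+_) (∑-* bs ½ S) ⟩
        ∑ bs D ℚ.+ ½ ℚ.* ∑ bs S
          ≡⟨ cong₂ (λ s t → s ℚ.+ ½ ℚ.* t) (seq-norm (ψ -ˢ φ) n) (seq-norm φ n) ⟨
        seq (norm (ψ -ˢ φ)) n ℚ.+ ½ ℚ.* seq (norm φ) n ∎
        where open ℚ.≤-Reasoning

  -- Both acceptance probabilities are at least 2/3, so the left side of `accept-gap` is at least
  -- (1/3 + 1/2) · 2/3 = 5/9. Half the norm of `φ` is 1/2, and 5/9 - 1/2 = 1/18.
  distinguish : ∀ (ψ φ : State N w) (output : Basis N w → Bool) u v → u ≢ v → norm φ ≃ 1ᴿ →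
    fromℚ (+ 2 / 3) ≲ (∑ᴿ λ b → if does (output b Bool.≟ u) then normSq (ψ b) else 0ᴿ) →
    fromℚ (+ 2 / 3) ≲ (∑ᴿ λ b → if does (output b Bool.≟ v) then normSq (φ b) else 0ᴿ) →
    fromℚ 1/18ℚ ≲ norm (ψ -ˢ φ)
  distinguish ψ φ output u v u≢v unit hu hv =
    ≲-trans (pointwise-≲ λ _ → ℚ.≤-refl)
    (≲-trans (+ᴿ-mono sum≥5/9 (≲-refl {fromℚ (ℚ.- ½)}))
      (pointwise-≲ λ n → ℚ.≤-reflexive (cancel (seq d n))))
    where
    d = norm (ψ -ˢ φ)
    p q : Basis N w → Bool
    p b = does (output b Bool.≟ u)
    q b = does (output b Bool.≟ v)
    P = accept p ψ
    Q = accept q φ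
    cancel : ∀ x → (x ℚ.+ ½) ℚ.+ (ℚ.- ½) ≡ x
    cancel = let open ℚSolver.+-*-Solver in solve 1 (λ x → (x :+ con ½) :+ con (ℚ.- ½) := x) refl
    disjoint : ∀ b → p b ≡ true → q b ≡ false
    disjoint b e with output b Bool.≟ u | output b Bool.≟ v
    ... | yes o≡u | yes o≡v = contradiction (trans (sym o≡u) o≡v) u≢v
    ... | yes _   | no  _   = refl
    sumForm : ∀ (t : Basis N w → Bool) χ →
      (∑ᴿ λ b → if t b then normSq (χ b) else 0ᴿ) ≲ accept t χ
    sumForm t χ = pointwise-≲ λ n →
      ℚ.≤-reflexive (trans (sumBasis-homo (λ x → seq x n) refl (λ _ _ → refl) λ b → if t b then normSq (χ b) else 0ᴿ)
        (sym (seq-∑ᴸ bs (λ b → if t b then normSq (χ b) else 0ᴿ) n)))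
    hP : fromℚ (+ 2 / 3) ≲ P
    hP = ≲-trans hu (sumForm p ψ)
    hQ : fromℚ (+ 2 / 3) ≲ Q
    hQ = ≲-trans hv (sumForm q φ)
    sum≥5/9 : fromℚ 5/9ℚ ≲ (d +ᴿ fromℚ ½)
    sum≥5/9 =
      ≲-trans (pointwise-≲ λ _ → ℚ.≤-refl)
      (≲-trans (+ᴿ-mono (*ᴿ-mono-ℚ 1/3ℚ (ℚ.nonNegative⁻¹ 1/3ℚ) hP) (*ᴿ-mono-ℚ ½ (ℚ.nonNegative⁻¹ ½) hQ))
      (≲-trans (accept-gap ψ φ p q disjoint)
        (≃⇒≲ (+ᴿ-cong ≃-refl (≃-trans (*ᴿ-congˡ-ℚ ½ unit) (≗⇒≃ λ _ → refl))))))

-- Every edge of nonzero weight must end with squared distance at least 1/18, while `T` queries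
-- raise the potential from 0 to at most `T` times the total charge. Read with `v` as a test vector,
-- the Rayleigh quotient of the sensitive edges is at most 72 T.
adversary : ∀ {N M T} {f : BoolFun N} → ComputableWith T f →
  ∀ (X : Vec Bool M → Fin N → Bool) (ι : Fin M → Fin N) →
  (∀ {r s} → ι r ≡ ι s → r ≡ s) →
  (∀ z r i → i ≢ ι r → X z i ≡ X (flip r z) i) →
  ∀ (v : Vec Bool M → ℚ) → (∀ z → 0ℚ ℚ.≤ v z) →
  (∀ z r → v z ℚ.* v (flip r z) ≡ 0ℚ ⊎ f (X z) ≢ f (X (flip r z))) →
  1/18ℚ ℚ.* (∑ (cube M) λ z → ∑ (allFin M) λ r → v z ℚ.* v (flip r z)) ℚ.≤
  (+ T / 1) ℚ.* (∑ (cube M) λ z → 4ℚ ℚ.* square (v z))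
adversary {N} {M} {T} {f} (A , correct) X ι ι-injective local v 0≤v sensitive =
  fromℚ-cancel (≲-trans
    (≲-trans (pointwise-≲ λ n → ℚ.≤-reflexive (sym (seq-lower n)))
      (∑ᴸ-mono (cube M) λ z → ∑ᴸ-mono (allFin M) (apart z)))
    (≲-trans (potential-run X ι ι-injective local U unitary start′ (λ _ → norm-ket start))
      (pointwise-≲ λ n → ℚ.≤-reflexive (0+q≡q t (seq-start n)))))
  where
  open QueryAlgorithm A
  open Potential {N} {workspace} {M} v
  pw : Vec Bool M → Fin M → ℚ
  pw z r = v z ℚ.* v (flip r z)
  p t : ℚ
  p = 1/18ℚ ℚ.* (∑ (cube M) λ z → ∑ (allFin M) (pw z))
  t = (+ T / 1) ℚ.* totalCharge
  start′ final : Vec Bool M → State N workspace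
  start′ z = ket start
  final z = finalState (X z)
  least : Vec Bool M → Fin M → ℝ
  least z r = fromℚ (pw z r) *ᴿ fromℚ 1/18ℚ
  lower : ℝ
  lower = ∑ᴸ (cube M) λ z → ∑ᴸ (allFin M) (least z)
  seq-lower : ∀ n → seq lower n ≡ p
  seq-lower n = begin
    seq lower n
      ≡⟨ seq-∑ᴸ (cube M) (λ z → ∑ᴸ (allFin M) (least z)) n ⟩
    (∑ (cube M) λ z → seq (∑ᴸ (allFin M) (least z)) n)
      ≡⟨ ∑-cong (cube M) (λ z → trans (seq-∑ᴸ (allFin M) (least z) n)
           (∑-*ʳ (allFin M) 1/18ℚ (pw z))) ⟩
    (∑ (cube M) λ z → ∑ (allFin M) (pw z) ℚ.* 1/18ℚ)
      ≡⟨ ∑-*ʳ (cube M) 1/18ℚ (λ z → ∑ (allFin M) (pw z)) ⟩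
    (∑ (cube M) λ z → ∑ (allFin M) (pw z)) ℚ.* 1/18ℚ
      ≡⟨ ℚ.*-comm (∑ (cube M) λ z → ∑ (allFin M) (pw z)) 1/18ℚ ⟩
    p ∎
    where open ≡-Reasoning
  seq-start : ∀ n → seq (potential start′) n ≡ 0ℚ
  seq-start n = trans
    (seq-∑ᴸ (cube M) (λ z → ∑ᴸ (allFin M) λ r → fromℚ (pw z r) *ᴿ norm (start′ z -ˢ start′ (flip r z))) n)
    (trans (∑-cong (cube M) λ z → trans
        (seq-∑ᴸ (allFin M) (λ r → fromℚ (pw z r) *ᴿ norm (start′ z -ˢ start′ (flip r z))) n)
        (trans (∑-cong (allFin M) λ r → trans (cong (pw z r ℚ.*_) dist-self) (ℚ.*-zeroʳ (pw z r)))
          (∑-0 (allFin M))))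
      (∑-0 (cube M)))
    where
    square-self : ∀ q → square (q ℚ.- q) ≡ 0ℚ
    square-self q = cong square (ℚ.+-inverseʳ q)
    dist-self : seq (norm (ket start -ˢ ket start)) n ≡ 0ℚ
    dist-self = trans (seq-norm (ket start -ˢ ket start) n)
      (trans (∑-cong (basisList N workspace) λ b →
          p+q≡0 (square-self (seq (re (ket start b)) n)) (square-self (seq (im (ket start b)) n)))
        (∑-0 (basisList N workspace)))
  apart : ∀ z r → least z r ≲ (fromℚ (pw z r) *ᴿ norm (final z -ˢ final (flip r z)))
  apart z r with sensitive z r
  ... | inj₁ e = pointwise-≲ λ n →
    ℚ.≤-reflexive (trans (vanish 1/18ℚ) (sym (vanish (seq (norm (final z -ˢ final (flip r z))) n))))
    where
    vanish : ∀ q → pw z r ℚ.* q ≡ 0ℚ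
    vanish q = trans (cong (ℚ._* q) e) (ℚ.*-zeroˡ q)
  ... | inj₂ ne = *ᴿ-mono-ℚ (pw z r) (0≤* (0≤v z) (0≤v (flip r z)))
    (distinguish (final z) (final (flip r z)) output (f (X z)) (f (X (flip r z))) ne
      (≃-trans (norm-run X ι ι-injective local U unitary (X (flip r z)) (ket start)) (norm-ket start))
      (≲-intro (correct (X z))) (≲-intro (correct (X (flip r z)))))

-- Homogeneous linear systems

-- Forms are functions with their linearity rather than coefficient vectors, so that evaluating
-- `eigenvector` at a point is a form without computing its coefficients.
record LinearForm (D : ℕ) : Set where
  field
    apply : (Fin D → ℚ) → ℚ
    resp  : ∀ {x y} → (∀ i → x i ≡ y i) → apply x ≡ apply y
    add   : ∀ x y → apply (λ i → x i ℚ.+ y i) ≡ apply x ℚ.+ apply y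
    scale : ∀ c x → apply (λ i → c ℚ.* x i) ≡ c ℚ.* apply x

open LinearForm

cons : ∀ {D} → ℚ → (Fin D → ℚ) → Fin (suc D) → ℚ
cons c x zero    = c
cons c x (suc i) = x i

e₀ : ∀ {D} → Fin (suc D) → ℚ
e₀ = cons 1ℚ λ _ → 0ℚ

apply-cons : ∀ {D} (ℓ : LinearForm (suc D)) c x →
             apply ℓ (cons c x) ≡ c ℚ.* apply ℓ e₀ ℚ.+ apply ℓ (cons 0ℚ x)
apply-cons ℓ c x = trans (resp ℓ decompose)
  (trans (add ℓ (λ i → c ℚ.* e₀ i) (cons 0ℚ x)) (cong (ℚ._+ apply ℓ (cons 0ℚ x)) (scale ℓ c e₀)))
  where
  decompose : ∀ i → cons c x i ≡ c ℚ.* e₀ i ℚ.+ cons 0ℚ x i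
  decompose zero    = sym (trans (ℚ.+-identityʳ _) (ℚ.*-identityʳ c))
  decompose (suc i) = sym (0+q≡q (x i) (ℚ.*-zeroʳ c))

-- Meant for k = 1 / p(e₀), when this combination of ℓ and p ignores the first coordinate.
eliminate : ∀ {D} → LinearForm (suc D) → ℚ → LinearForm (suc D) → LinearForm D
eliminate {D} p k ℓ = record
  { apply = λ x → apply ℓ (cons 0ℚ x) ℚ.+ c ℚ.* apply p (cons 0ℚ x)
  ; resp  = λ h → cong₂ (λ s t → s ℚ.+ c ℚ.* t) (resp ℓ (lift h)) (resp p (lift h))
  ; add   = λ x y → trans
      (cong₂ (λ s t → s ℚ.+ c ℚ.* t)
        (trans (resp ℓ (split-+ x y)) (add ℓ (cons 0ℚ x) (cons 0ℚ y)))
        (trans (resp p (split-+ x y)) (add p (cons 0ℚ x) (cons 0ℚ y))))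
      (regroup-+ (apply ℓ (cons 0ℚ x)) (apply ℓ (cons 0ℚ y)) (apply p (cons 0ℚ x)) (apply p (cons 0ℚ y)) c)
  ; scale = λ d x → trans
      (cong₂ (λ s t → s ℚ.+ c ℚ.* t)
        (trans (resp ℓ (split-* d x)) (scale ℓ d (cons 0ℚ x)))
        (trans (resp p (split-* d x)) (scale p d (cons 0ℚ x))))
      (regroup-* d (apply ℓ (cons 0ℚ x)) (apply p (cons 0ℚ x)) c)
  }
  where
  c = ℚ.- (apply ℓ e₀ ℚ.* k)
  lift : ∀ {x y : Fin D → ℚ} → (∀ i → x i ≡ y i) → ∀ i → cons 0ℚ x i ≡ cons 0ℚ y i
  lift h zero    = refl
  lift h (suc i) = h i
  split-+ : ∀ x y i → cons 0ℚ (λ i → x i ℚ.+ y i) i ≡ cons 0ℚ x i ℚ.+ cons 0ℚ y i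
  split-+ x y zero    = refl
  split-+ x y (suc i) = refl
  split-* : ∀ d x i → cons 0ℚ (λ i → d ℚ.* x i) i ≡ d ℚ.* cons 0ℚ x i
  split-* d x zero    = sym (ℚ.*-zeroʳ d)
  split-* d x (suc i) = refl
  regroup-+ : ∀ a b u v c → (a ℚ.+ b) ℚ.+ c ℚ.* (u ℚ.+ v) ≡ (a ℚ.+ c ℚ.* u) ℚ.+ (b ℚ.+ c ℚ.* v)
  regroup-+ = let open ℚSolver.+-*-Solver in
    solve 5 (λ a b u v c → (a :+ b) :+ c :* (u :+ v) := (a :+ c :* u) :+ (b :+ c :* v)) refl
  regroup-* : ∀ d a u c → d ℚ.* a ℚ.+ c ℚ.* (d ℚ.* u) ≡ d ℚ.* (a ℚ.+ c ℚ.* u)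
  regroup-* = let open ℚSolver.+-*-Solver in
    solve 4 (λ d a u c → d :* a :+ c :* (d :* u) := d :* (a :+ c :* u)) refl

inverse : ∀ q → q ≢ 0ℚ → ∃[ k ] q ℚ.* k ≡ 1ℚ
inverse q q≢0 = ℚ.1/_ q {{ℚ.≢-nonZero q≢0}} , ℚ.*-inverseʳ q {{ℚ.≢-nonZero q≢0}}

-- The last component puts `p` back among `rest`, for any property, so that its position in the list
-- never has to be recorded.
pivot : ∀ {D} (ℓs : List (LinearForm (suc D))) →
  All (λ ℓ → apply ℓ e₀ ≡ 0ℚ) ℓs ⊎
  ∃[ p ] ∃[ rest ] (apply p e₀ ≢ 0ℚ × length ℓs ≡ suc (length rest) ×
    ({P : LinearForm (suc D) → Set} → P p → All P rest → All P ℓs))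
pivot [] = inj₁ []
pivot (ℓ ∷ ℓs) with apply ℓ e₀ ℚ.≟ 0ℚ
... | no  ≢0 = inj₂ (ℓ , ℓs , ≢0 , refl , _∷_)
... | yes ≡0 with pivot ℓs
...   | inj₁ all = inj₁ (≡0 ∷ all)
...   | inj₂ (p , rest , ≢0 , len , rebuild) =
        inj₂ (p , ℓ ∷ rest , ≢0 , cong suc len , λ { hp (hℓ ∷ hs) → hℓ ∷ rebuild hp hs })

-- Gaussian elimination. If no form sees the first coordinate, `e₀` is a solution; otherwise a pivot
-- eliminates that coordinate from the others, leaving one form and one unknown fewer.
nontrivial-solution : ∀ D (ℓs : List (LinearForm D)) → length ℓs < D →
  ∃[ x ] (∃[ i ] x i ≢ 0ℚ) × All (λ ℓ → apply ℓ x ≡ 0ℚ) ℓs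
nontrivial-solution (suc D) ℓs few with pivot ℓs
... | inj₁ all = e₀ , (zero , λ ()) , all
... | inj₂ (p , rest , ≢0 , len , rebuild) =
      x , (suc i , x′i≢0) , rebuild atPivot (All.map (λ {ℓ} → atRest ℓ) (All.map⁻ zeros))
  where
  k = proj₁ (inverse (apply p e₀) ≢0)
  pk≡1 = proj₂ (inverse (apply p e₀) ≢0)
  recurse = nontrivial-solution D (map (eliminate p k) rest)
    (subst (_< D) (sym (length-map (eliminate p k) rest)) (ℕ.≤-pred (subst (_< suc D) len few)))
    where open import Data.List.Properties using (length-map)
  x′ = proj₁ recurse
  i = proj₁ (proj₁ (proj₂ recurse))
  x′i≢0 = proj₂ (proj₁ (proj₂ recurse))
  zeros = proj₂ (proj₂ recurse)
  p₀ = apply p (cons 0ℚ x′)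
  -- Back substitution: the value of the first coordinate at which the pivot vanishes.
  x = cons (ℚ.- (k ℚ.* p₀)) x′
  atPivot : apply p x ≡ 0ℚ
  atPivot = trans (apply-cons p (ℚ.- (k ℚ.* p₀)) x′)
    (trans (shuffle k p₀ (apply p e₀))
    (trans (cong (λ q → (ℚ.- q) ℚ.* p₀ ℚ.+ p₀) pk≡1) (cancel p₀)))
    where
    shuffle : ∀ k q e → (ℚ.- (k ℚ.* q)) ℚ.* e ℚ.+ q ≡ (ℚ.- (e ℚ.* k)) ℚ.* q ℚ.+ q
    shuffle = let open ℚSolver.+-*-Solver in
      solve 3 (λ k q e → (:- (k :* q)) :* e :+ q := (:- (e :* k)) :* q :+ q) refl
    cancel : ∀ q → (ℚ.- 1ℚ) ℚ.* q ℚ.+ q ≡ 0ℚ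
    cancel = let open ℚSolver.+-*-Solver in solve 1 (λ q → (:- con 1ℚ) :* q :+ q := con 0ℚ) refl
  atRest : ∀ ℓ → apply (eliminate p k ℓ) x′ ≡ 0ℚ → apply ℓ x ≡ 0ℚ
  atRest ℓ h = trans (apply-cons ℓ (ℚ.- (k ℚ.* p₀)) x′)
    (trans (shuffle k p₀ (apply ℓ e₀) (apply ℓ (cons 0ℚ x′))) h)
    where
    shuffle : ∀ k q e l → (ℚ.- (k ℚ.* q)) ℚ.* e ℚ.+ l ≡ l ℚ.+ (ℚ.- (e ℚ.* k)) ℚ.* q
    shuffle = let open ℚSolver.+-*-Solver in
      solve 4 (λ k q e l → (:- (k :* q)) :* e :+ l := l :+ (:- (e :* k)) :* q) refl

-- Huang's signed adjacency operator of the cube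

fromN : ℕ → ℚ
fromN n = + n / 1

-- The recursion A_0 = 0 and A_(M+1) = [[A_M, I], [I, -A_M]], as an operator. Up to signs it is the
-- adjacency matrix of the cube.
huang : ∀ {M} → (Vec Bool M → ℚ) → Vec Bool M → ℚ
huang f []          = 0ℚ
huang f (false ∷ z) = huang (f ∘ (false ∷_)) z ℚ.+ f (true ∷ z)
huang f (true  ∷ z) = f (false ∷ z) ℚ.+ (ℚ.- huang (f ∘ (true ∷_)) z)

huang-cong : ∀ {M} {f g : Vec Bool M → ℚ} → (∀ z → f z ≡ g z) → ∀ z → huang f z ≡ huang g z
huang-cong h []          = refl
huang-cong h (false ∷ z) = cong₂ ℚ._+_ (huang-cong (λ z → h (false ∷ z)) z) (h (true ∷ z))
huang-cong h (true  ∷ z) =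
  cong₂ (λ s t → s ℚ.+ (ℚ.- t)) (h (false ∷ z)) (huang-cong (λ z → h (true ∷ z)) z)

huang-linear : ∀ {M} c (f g : Vec Bool M → ℚ) z →
  huang (λ z → f z ℚ.+ c ℚ.* g z) z ≡ huang f z ℚ.+ c ℚ.* huang g z
huang-linear c f g [] = sym (p+q≡0 refl (ℚ.*-zeroʳ c))
huang-linear c f g (false ∷ z) =
  trans (cong (ℚ._+ (f (true ∷ z) ℚ.+ c ℚ.* g (true ∷ z))) (huang-linear c (f ∘ (false ∷_)) (g ∘ (false ∷_)) z))
    (regroup (huang (f ∘ (false ∷_)) z) (huang (g ∘ (false ∷_)) z) (f (true ∷ z)) (g (true ∷ z)) c)
  where
  regroup : ∀ a b u v c → (a ℚ.+ c ℚ.* b) ℚ.+ (u ℚ.+ c ℚ.* v) ≡ (a ℚ.+ u) ℚ.+ c ℚ.* (b ℚ.+ v)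
  regroup = let open ℚSolver.+-*-Solver in
    solve 5 (λ a b u v c → (a :+ c :* b) :+ (u :+ c :* v) := (a :+ u) :+ c :* (b :+ v)) refl
huang-linear c f g (true ∷ z) =
  trans (cong (λ q → (f (false ∷ z) ℚ.+ c ℚ.* g (false ∷ z)) ℚ.+ (ℚ.- q))
          (huang-linear c (f ∘ (true ∷_)) (g ∘ (true ∷_)) z))
    (regroup (huang (f ∘ (true ∷_)) z) (huang (g ∘ (true ∷_)) z) (f (false ∷ z)) (g (false ∷ z)) c)
  where
  regroup : ∀ a b u v c → (u ℚ.+ c ℚ.* v) ℚ.+ (ℚ.- (a ℚ.+ c ℚ.* b)) ≡
                          (u ℚ.+ (ℚ.- a)) ℚ.+ c ℚ.* (v ℚ.+ (ℚ.- b))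
  regroup = let open ℚSolver.+-*-Solver in
    solve 5 (λ a b u v c → (u :+ c :* v) :+ (:- (a :+ c :* b)) :=
                           (u :+ (:- a)) :+ c :* (v :+ (:- b))) refl

-- Squaring the block matrix, the off-diagonal blocks A - A cancel because of the sign, and each
-- diagonal block is A² + I.
huang² : ∀ {M} (f : Vec Bool M → ℚ) z → huang (huang f) z ≡ fromN M ℚ.* f z
huang² f [] = sym (ℚ.*-zeroˡ (f []))
huang² {suc M} f (false ∷ z) = begin
  huang (λ z → huang f₀ z ℚ.+ f₁ z) z ℚ.+ (f₀ z ℚ.+ (ℚ.- huang f₁ z))
    ≡⟨ cong (ℚ._+ (f₀ z ℚ.+ (ℚ.- huang f₁ z))) (trans
         (huang-cong (λ z → cong (huang f₀ z ℚ.+_) (sym (ℚ.*-identityˡ (f₁ z)))) z)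
         (huang-linear 1ℚ (huang f₀) f₁ z)) ⟩
  (huang (huang f₀) z ℚ.+ 1ℚ ℚ.* huang f₁ z) ℚ.+ (f₀ z ℚ.+ (ℚ.- huang f₁ z))
    ≡⟨ cong (λ q → (q ℚ.+ 1ℚ ℚ.* huang f₁ z) ℚ.+ (f₀ z ℚ.+ (ℚ.- huang f₁ z))) (huang² f₀ z) ⟩
  (fromN M ℚ.* f₀ z ℚ.+ 1ℚ ℚ.* huang f₁ z) ℚ.+ (f₀ z ℚ.+ (ℚ.- huang f₁ z))
    ≡⟨ collect (fromN M) (f₀ z) (huang f₁ z) ⟩
  (fromN M ℚ.+ 1ℚ) ℚ.* f₀ z
    ≡⟨ cong (ℚ._* f₀ z) (/-suc M 0) ⟨
  fromN (suc M) ℚ.* f₀ z ∎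
  where
  open ≡-Reasoning
  f₀ = f ∘ (false ∷_)
  f₁ = f ∘ (true ∷_)
  collect : ∀ m a h → (m ℚ.* a ℚ.+ 1ℚ ℚ.* h) ℚ.+ (a ℚ.+ (ℚ.- h)) ≡ (m ℚ.+ 1ℚ) ℚ.* a
  collect = let open ℚSolver.+-*-Solver in
    solve 3 (λ m a h → (m :* a :+ con 1ℚ :* h) :+ (a :+ (:- h)) := (m :+ con 1ℚ) :* a) refl
huang² {suc M} f (true ∷ z) = begin
  (huang f₀ z ℚ.+ f₁ z) ℚ.+ (ℚ.- huang (λ z → f₀ z ℚ.+ (ℚ.- huang f₁ z)) z)
    ≡⟨ cong (λ q → (huang f₀ z ℚ.+ f₁ z) ℚ.+ (ℚ.- q)) (trans
         (huang-cong (λ z → cong (f₀ z ℚ.+_) (neg (huang f₁ z))) z)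
         (huang-linear (ℚ.- 1ℚ) f₀ (huang f₁) z)) ⟩
  (huang f₀ z ℚ.+ f₁ z) ℚ.+ (ℚ.- (huang f₀ z ℚ.+ (ℚ.- 1ℚ) ℚ.* huang (huang f₁) z))
    ≡⟨ cong (λ q → (huang f₀ z ℚ.+ f₁ z) ℚ.+ (ℚ.- (huang f₀ z ℚ.+ (ℚ.- 1ℚ) ℚ.* q))) (huang² f₁ z) ⟩
  (huang f₀ z ℚ.+ f₁ z) ℚ.+ (ℚ.- (huang f₀ z ℚ.+ (ℚ.- 1ℚ) ℚ.* (fromN M ℚ.* f₁ z)))
    ≡⟨ collect (fromN M) (f₁ z) (huang f₀ z) ⟩
  (fromN M ℚ.+ 1ℚ) ℚ.* f₁ z
    ≡⟨ cong (ℚ._* f₁ z) (/-suc M 0) ⟨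
  fromN (suc M) ℚ.* f₁ z ∎
  where
  open ≡-Reasoning
  f₀ = f ∘ (false ∷_)
  f₁ = f ∘ (true ∷_)
  neg : ∀ p → ℚ.- p ≡ (ℚ.- 1ℚ) ℚ.* p
  neg = let open ℚSolver.+-*-Solver in solve 1 (λ p → :- p := (:- con 1ℚ) :* p) refl
  collect : ∀ m a h → (h ℚ.+ a) ℚ.+ (ℚ.- (h ℚ.+ (ℚ.- 1ℚ) ℚ.* (m ℚ.* a))) ≡ (m ℚ.+ 1ℚ) ℚ.* a
  collect = let open ℚSolver.+-*-Solver in
    solve 3 (λ m a h → (h :+ a) :+ (:- (h :+ (:- con 1ℚ) :* (m :* a))) := (m :+ con 1ℚ) :* a) refl

-- The first block row of A v = s v determines the second half of v from the first.
eigenvector : ∀ {M} → ℚ → (Vec Bool M → ℚ) → Vec Bool (suc M) → ℚ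
eigenvector s a (false ∷ z) = a z
eigenvector s a (true  ∷ z) = s ℚ.* a z ℚ.+ (ℚ.- 1ℚ) ℚ.* huang a z

-- The second block row needs a - A(sa - Aa) = s(sa - Aa), which follows from A² = M and s² = M + 1.
-- As `a` is arbitrary, this is an eigenspace of dimension 2^M, half that of the whole space.
huang-eigenvector : ∀ {M} s → s ℚ.* s ≡ fromN (suc M) → ∀ a z →
  huang (eigenvector {M} s a) z ≡ s ℚ.* eigenvector s a z
huang-eigenvector s s² a (false ∷ z) = cancel (huang a z) (s ℚ.* a z)
  where
  cancel : ∀ h q → h ℚ.+ (q ℚ.+ (ℚ.- 1ℚ) ℚ.* h) ≡ q
  cancel = let open ℚSolver.+-*-Solver in
    solve 2 (λ h q → h :+ (q :+ (:- con 1ℚ) :* h) := q) refl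
huang-eigenvector {M} s s² a (true ∷ z) = begin
  a z ℚ.+ (ℚ.- huang (λ z → s ℚ.* a z ℚ.+ (ℚ.- 1ℚ) ℚ.* huang a z) z)
    ≡⟨ cong (λ q → a z ℚ.+ (ℚ.- q)) (huang-linear (ℚ.- 1ℚ) (λ z → s ℚ.* a z) (huang a) z) ⟩
  a z ℚ.+ (ℚ.- (huang (λ z → s ℚ.* a z) z ℚ.+ (ℚ.- 1ℚ) ℚ.* huang (huang a) z))
    ≡⟨ cong₂ (λ p q → a z ℚ.+ (ℚ.- (p ℚ.+ (ℚ.- 1ℚ) ℚ.* q))) scaled (huang² a z) ⟩
  a z ℚ.+ (ℚ.- (s ℚ.* huang a z ℚ.+ (ℚ.- 1ℚ) ℚ.* (fromN M ℚ.* a z)))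
    ≡⟨ collect (fromN M) (a z) (s ℚ.* huang a z) ⟩
  (fromN M ℚ.+ 1ℚ) ℚ.* a z ℚ.+ (ℚ.- 1ℚ) ℚ.* (s ℚ.* huang a z)
    ≡⟨ cong (λ q → q ℚ.* a z ℚ.+ (ℚ.- 1ℚ) ℚ.* (s ℚ.* huang a z)) (trans s² (/-suc M 0)) ⟨
  (s ℚ.* s) ℚ.* a z ℚ.+ (ℚ.- 1ℚ) ℚ.* (s ℚ.* huang a z)
    ≡⟨ factor s (a z) (huang a z) ⟩
  s ℚ.* (s ℚ.* a z ℚ.+ (ℚ.- 1ℚ) ℚ.* huang a z) ∎
  where
  open ≡-Reasoning
  huang-0 : ∀ {M} (z : Vec Bool M) → huang (λ _ → 0ℚ) z ≡ 0ℚ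
  huang-0 []          = refl
  huang-0 (false ∷ z) = p+q≡0 (huang-0 z) refl
  huang-0 (true  ∷ z) = p+q≡0 refl (cong ℚ.-_ (huang-0 z))
  scaled : huang (λ z → s ℚ.* a z) z ≡ s ℚ.* huang a z
  scaled = trans (huang-cong (λ z → sym (ℚ.+-identityˡ (s ℚ.* a z))) z)
    (trans (huang-linear s (λ _ → 0ℚ) a z) (0+q≡q (s ℚ.* huang a z) (huang-0 z)))
  collect : ∀ m a h → a ℚ.+ (ℚ.- (h ℚ.+ (ℚ.- 1ℚ) ℚ.* (m ℚ.* a))) ≡
                      (m ℚ.+ 1ℚ) ℚ.* a ℚ.+ (ℚ.- 1ℚ) ℚ.* h
  collect = let open ℚSolver.+-*-Solver in
    solve 3 (λ m a h → a :+ (:- (h :+ (:- con 1ℚ) :* (m :* a))) :=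
                       (m :+ con 1ℚ) :* a :+ (:- con 1ℚ) :* h) refl
  factor : ∀ s a h → (s ℚ.* s) ℚ.* a ℚ.+ (ℚ.- 1ℚ) ℚ.* (s ℚ.* h) ≡
                     s ℚ.* (s ℚ.* a ℚ.+ (ℚ.- 1ℚ) ℚ.* h)
  factor = let open ℚSolver.+-*-Solver in
    solve 3 (λ s a h → (s :* s) :* a :+ (:- con 1ℚ) :* (s :* h) :=
                       s :* (s :* a :+ (:- con 1ℚ) :* h)) refl

∑-allFin-suc : ∀ {M} (f : Fin (suc M) → ℚ) →
               ∑ (allFin (suc M)) f ≡ f zero ℚ.+ ∑ (allFin M) (f ∘ suc)
∑-allFin-suc f = cong (f zero ℚ.+_)
  (trans (∑-tabulate suc f) (sym (∑-tabulate id (f ∘ suc))))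

∣huang∣≤ : ∀ {M} (f : Vec Bool M → ℚ) z → ∣ huang f z ∣ ℚ.≤ ∑ (allFin M) λ r → ∣ f (flip r z) ∣
∣huang∣≤ f [] = ℚ.≤-refl
∣huang∣≤ {suc M} f (false ∷ z) = begin
  ∣ huang (f ∘ (false ∷_)) z ℚ.+ f (true ∷ z) ∣
    ≤⟨ ℚ.∣p+q∣≤∣p∣+∣q∣ (huang (f ∘ (false ∷_)) z) (f (true ∷ z)) ⟩
  ∣ huang (f ∘ (false ∷_)) z ∣ ℚ.+ ∣ f (true ∷ z) ∣
    ≤⟨ ℚ.+-monoˡ-≤ ∣ f (true ∷ z) ∣ (∣huang∣≤ (f ∘ (false ∷_)) z) ⟩
  (∑ (allFin M) λ r → ∣ f (false ∷ flip r z) ∣) ℚ.+ ∣ f (true ∷ z) ∣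
    ≡⟨ ℚ.+-comm (∑ (allFin M) λ r → ∣ f (false ∷ flip r z) ∣) ∣ f (true ∷ z) ∣ ⟩
  ∣ f (true ∷ z) ∣ ℚ.+ (∑ (allFin M) λ r → ∣ f (false ∷ flip r z) ∣)
    ≡⟨ ∑-allFin-suc (λ r → ∣ f (flip r (false ∷ z)) ∣) ⟨
  (∑ (allFin (suc M)) λ r → ∣ f (flip r (false ∷ z)) ∣) ∎
  where open ℚ.≤-Reasoning
∣huang∣≤ {suc M} f (true ∷ z) = begin
  ∣ f (false ∷ z) ℚ.+ (ℚ.- huang (f ∘ (true ∷_)) z) ∣
    ≤⟨ ℚ.∣p+q∣≤∣p∣+∣q∣ (f (false ∷ z)) (ℚ.- huang (f ∘ (true ∷_)) z) ⟩
  ∣ f (false ∷ z) ∣ ℚ.+ ∣ ℚ.- huang (f ∘ (true ∷_)) z ∣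
    ≡⟨ cong (∣ f (false ∷ z) ∣ ℚ.+_) (ℚ.∣-p∣≡∣p∣ (huang (f ∘ (true ∷_)) z)) ⟩
  ∣ f (false ∷ z) ∣ ℚ.+ ∣ huang (f ∘ (true ∷_)) z ∣
    ≤⟨ ℚ.+-monoʳ-≤ ∣ f (false ∷ z) ∣ (∣huang∣≤ (f ∘ (true ∷_)) z) ⟩
  ∣ f (false ∷ z) ∣ ℚ.+ (∑ (allFin M) λ r → ∣ f (true ∷ flip r z) ∣)
    ≡⟨ ∑-allFin-suc (λ r → ∣ f (flip r (true ∷ z)) ∣) ⟨
  (∑ (allFin (suc M)) λ r → ∣ f (flip r (true ∷ z)) ∣) ∎
  where open ℚ.≤-Reasoning

-- Parity of a Boolean function on the cube

xorSum : {A : Set} → List A → (A → Bool) → Bool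
xorSum []       h = false
xorSum (x ∷ xs) h = h x xor xorSum xs h

odd : ℕ → Bool
odd zero    = false
odd (suc n) = not (odd n)

parity : ∀ {M} → Vec Bool M → Bool
parity []      = false
parity (b ∷ z) = b xor parity z

xor-interchange : ∀ a b c d → (a xor b) xor (c xor d) ≡ (a xor c) xor (b xor d)
xor-interchange false false c d = refl
xor-interchange false true  c d = Bool.not-distribʳ-xor c d
xor-interchange true  false c d = Bool.not-distribˡ-xor c d
xor-interchange true  true  c d =
  sym (trans (sym (Bool.not-distribˡ-xor c (not d)))
    (trans (cong not (sym (Bool.not-distribʳ-xor c d))) (Bool.not-involutive (c xor d))))

module _ {A : Set} where

  xorSum-cong : ∀ (xs : List A) {g h} → (∀ x → g x ≡ h x) → xorSum xs g ≡ xorSum xs h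
  xorSum-cong []       e = refl
  xorSum-cong (x ∷ xs) e = cong₂ _xor_ (e x) (xorSum-cong xs e)

  xorSum-xor : ∀ (xs : List A) g h → xorSum xs (λ x → g x xor h x) ≡ xorSum xs g xor xorSum xs h
  xorSum-xor []       g h = refl
  xorSum-xor (x ∷ xs) g h = trans (cong ((g x xor h x) xor_) (xorSum-xor xs g h))
    (xor-interchange (g x) (h x) (xorSum xs g) (xorSum xs h))

  xorSum-++ : ∀ (xs ys : List A) h → xorSum (xs ++ ys) h ≡ xorSum xs h xor xorSum ys h
  xorSum-++ []       ys h = refl
  xorSum-++ (x ∷ xs) ys h = trans (cong (h x xor_) (xorSum-++ xs ys h))
    (sym (Bool.xor-assoc (h x) (xorSum xs h) (xorSum ys h)))

  xorSum-map : ∀ {B : Set} (k : B → A) xs h → xorSum (map k xs) h ≡ xorSum xs (h ∘ k)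
  xorSum-map k []       h = refl
  xorSum-map k (x ∷ xs) h = cong (h (k x) xor_) (xorSum-map k xs h)

  odd-length : ∀ (xs : List A) → odd (length xs) ≡ xorSum xs λ _ → true
  odd-length []       = refl
  odd-length (x ∷ xs) = cong not (odd-length xs)

  odd-count : ∀ (h : A → Bool) xs → odd (length (filterᵇ h xs)) ≡ xorSum xs h
  odd-count h [] = refl
  odd-count h (x ∷ xs) with h x
  ... | true  = cong not (odd-count h xs)
  ... | false = odd-count h xs

  count+count : ∀ (h : A → Bool) xs →
    length (filterᵇ h xs) ℕ.+ length (filterᵇ (not ∘ h) xs) ≡ length xs
  count+count h [] = refl
  count+count h (x ∷ xs) with h x
  ... | true  = cong suc (count+count h xs)
  ... | false = trans (ℕ.+-suc (length (filterᵇ h xs)) (length (filterᵇ (not ∘ h) xs)))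
                  (cong suc (count+count h xs))

  ∈-filterᵇ : ∀ (h : A → Bool) {x} xs → x ∈ xs → h x ≡ true → x ∈ filterᵇ h xs
  ∈-filterᵇ h (y ∷ xs) (here refl) e with h y | e
  ... | true | refl = here refl
  ∈-filterᵇ h (y ∷ xs) (there x∈) e with h y
  ... | true  = there (∈-filterᵇ h xs x∈ e)
  ... | false = ∈-filterᵇ h xs x∈ e

xorSum-cube-suc : ∀ {M} (h : Vec Bool (suc M) → Bool) →
  xorSum (cube (suc M)) h ≡ xorSum (cube M) (h ∘ (false ∷_)) xor xorSum (cube M) (h ∘ (true ∷_))
xorSum-cube-suc {M} h = trans (xorSum-++ (map (false ∷_) (cube M)) (map (true ∷_) (cube M)) h)
  (cong₂ _xor_ (xorSum-map (false ∷_) (cube M) h) (xorSum-map (true ∷_) (cube M) h))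

-- The power 2^d, written as a sum of two equal halves so that `Fin` and `Vec` of this size split in
-- two without any conversion.
dim : ℕ → ℕ
dim zero    = 1
dim (suc d) = dim d ℕ.+ dim d

dim-positive : ∀ b → 1 ≤ dim b
dim-positive zero    = ℕ.≤-refl
dim-positive (suc b) = ℕ.≤-trans (dim-positive b) (ℕ.m≤m+n (dim b) (dim b))

length-cube : ∀ M → length (cube M) ≡ dim M
length-cube zero    = refl
length-cube (suc M) = trans (length-++ (map (false ∷_) (cube M)))
  (cong₂ ℕ._+_ (trans (length-map _ (cube M)) (length-cube M))
               (trans (length-map _ (cube M)) (length-cube M)))

∈-cube : ∀ {M} (z : Vec Bool M) → z ∈ cube M
∈-cube []          = here refl
∈-cube (false ∷ z) = ∈-++⁺ˡ (∈-map⁺ (false ∷_) (∈-cube z))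
∈-cube (true  ∷ z) = ∈-++⁺ʳ _ (∈-map⁺ (true ∷_) (∈-cube z))

xorSum-parity : ∀ M → xorSum (cube (suc M)) parity ≡ odd (dim M)
xorSum-parity M = begin
  xorSum (cube (suc M)) parity
    ≡⟨ xorSum-cube-suc {M} parity ⟩
  xorSum (cube M) parity xor xorSum (cube M) (not ∘ parity)
    ≡⟨ xorSum-xor (cube M) parity (not ∘ parity) ⟨
  xorSum (cube M) (λ z → parity z xor not (parity z))
    ≡⟨ xorSum-cong (cube M) (λ z → xor-not (parity z)) ⟩
  xorSum (cube M) (λ _ → true)
    ≡⟨ odd-length (cube M) ⟨
  odd (length (cube M))
    ≡⟨ cong odd (length-cube M) ⟩
  odd (dim M) ∎
  where
  open ≡-Reasoning
  xor-not : ∀ b → b xor not b ≡ true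
  xor-not false = refl
  xor-not true  = refl

parity-flip : ∀ {M} r (z : Vec Bool M) → parity (flip r z) ≡ not (parity z)
parity-flip zero    (false ∷ z) = refl
parity-flip zero    (true  ∷ z) = sym (Bool.not-involutive (parity z))
parity-flip (suc r) (false ∷ z) = parity-flip r z
parity-flip (suc r) (true  ∷ z) = cong not (parity-flip r z)

-- g xor parity cannot split the cube evenly, since the size of its support has the other
-- parity than half of the cube.
unbalanced : ∀ M (g : Vec Bool (suc M) → Bool) → xorSum (cube (suc M)) g ≡ true →
  ∃[ bad ] (length (filterᵇ bad (cube (suc M))) < dim M ×
    (∀ z r → bad z ≡ true ⊎ bad (flip r z) ≡ true ⊎ g z ≢ g (flip r z)))
unbalanced M g g-odd = choose (ℕ.<-cmp (length (filterᵇ h all)) (dim M))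
  where
  open import Relation.Binary.Definitions using (Tri; tri<; tri≈; tri>)
  all = cube (suc M)
  h : Vec Bool (suc M) → Bool
  h z = g z xor parity z
  cancel : ∀ a b → a xor b ≡ a xor not b → ⊥
  cancel false false ()
  cancel false true  ()
  cancel true  false ()
  cancel true  true  ()
  sensitive : ∀ z r → h z ≡ h (flip r z) → g z ≢ g (flip r z)
  sensitive z r hz≡ gz≡ = cancel (g z) (parity z)
    (trans hz≡ (cong₂ _xor_ (sym gz≡) (parity-flip r z)))
  h-odd : odd (length (filterᵇ h all)) ≡ not (odd (dim M))
  h-odd = trans (odd-count h all) (trans (xorSum-xor all g parity)
    (cong₂ _xor_ g-odd (xorSum-parity M)))
  not-self : ∀ b → b ≢ not b
  not-self false ()
  not-self true  ()
  complement-few : dim M < length (filterᵇ h all) → length (filterᵇ (not ∘ h) all) < dim M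
  complement-few many = ℕ.+-cancelˡ-< (dim M) _ _ (begin-strict
    dim M ℕ.+ length (filterᵇ (not ∘ h) all)                   <⟨ ℕ.+-monoˡ-< _ many ⟩
    length (filterᵇ h all) ℕ.+ length (filterᵇ (not ∘ h) all)  ≡⟨ count+count h all ⟩
    length all                                                 ≡⟨ length-cube (suc M) ⟩
    dim M ℕ.+ dim M                                            ∎)
    where open ℕ.≤-Reasoning
  sides : ∀ z r → h z ≡ true ⊎ h (flip r z) ≡ true ⊎ g z ≢ g (flip r z)
  sides z r with h z in e | h (flip r z) in e′
  ... | true  | _     = inj₁ refl
  ... | false | true  = inj₂ (inj₁ refl)
  ... | false | false = inj₂ (inj₂ (sensitive z r (trans e (sym e′))))
  sides′ : ∀ z r → not (h z) ≡ true ⊎ not (h (flip r z)) ≡ true ⊎ g z ≢ g (flip r z)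
  sides′ z r with h z in e | h (flip r z) in e′
  ... | false | _     = inj₁ refl
  ... | true  | false = inj₂ (inj₁ refl)
  ... | true  | true  = inj₂ (inj₂ (sensitive z r (trans e (sym e′))))
  choose : Tri (length (filterᵇ h all) < dim M) (length (filterᵇ h all) ≡ dim M)
               (dim M < length (filterᵇ h all)) → _
  -- `bad` is the smaller side. The eigenvector has to vanish there, and the number of these
  -- constraints must stay below the dimension `dim M` of the eigenspace.
  choose (tri< few _ _)  = h , few , sides
  choose (tri≈ _ e _)    = contradiction (trans (sym (cong odd e)) h-odd) (not-self _)
  choose (tri> _ _ many) = not ∘ h , complement-few many , sides′

-- Bit strings as indices, naturals as rationals

encode : ∀ {m} → Vec Bool m → Fin (dim m)
encode             []          = zero
encode {m = suc m} (false ∷ z) = encode z Fin.↑ˡ dim m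
encode {m = suc m} (true  ∷ z) = dim m Fin.↑ʳ encode z

decodeBits : ∀ {m} → Fin (dim m) → Vec Bool m
decodeBits {zero}  i = []
decodeBits {suc m} i with Fin.splitAt (dim m) i
... | inj₁ j = false ∷ decodeBits j
... | inj₂ j = true ∷ decodeBits j

decode-encode : ∀ {m} (z : Vec Bool m) → decodeBits (encode z) ≡ z
decode-encode []      = refl
decode-encode {suc m} (false ∷ z)
  rewrite Fin.splitAt-↑ˡ (dim m) (encode z) (dim m) = cong (false ∷_) (decode-encode z)
decode-encode {suc m} (true ∷ z)
  rewrite Fin.splitAt-↑ʳ (dim m) (dim m) (encode z) = cong (true ∷_) (decode-encode z)

encode-decode : ∀ {m} (i : Fin (dim m)) → encode (decodeBits {m} i) ≡ i
encode-decode {zero}  zero = refl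
encode-decode {suc m} i with Fin.splitAt (dim m) i in e
... | inj₁ j = trans (cong (Fin._↑ˡ dim m) (encode-decode {m} j)) (Fin.splitAt⁻¹-↑ˡ e)
... | inj₂ j = trans (cong (dim m Fin.↑ʳ_) (encode-decode {m} j)) (Fin.splitAt⁻¹-↑ʳ e)

fromN-+ : ∀ m n → fromN (m ℕ.+ n) ≡ fromN m ℚ.+ fromN n
fromN-+ zero    n = sym (ℚ.+-identityˡ (fromN n))
fromN-+ (suc m) n = trans (/-suc (m ℕ.+ n) 0)
  (trans (cong (ℚ._+ 1ℚ) (fromN-+ m n))
  (trans (regroup (fromN m) (fromN n)) (cong (ℚ._+ fromN n) (sym (/-suc m 0)))))
  where
  regroup : ∀ a b → (a ℚ.+ b) ℚ.+ 1ℚ ≡ (a ℚ.+ 1ℚ) ℚ.+ b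
  regroup = let open ℚSolver.+-*-Solver in
    solve 2 (λ a b → (a :+ b) :+ con 1ℚ := (a :+ con 1ℚ) :+ b) refl

fromN-* : ∀ m n → fromN (m ℕ.* n) ≡ fromN m ℚ.* fromN n
fromN-* zero    n = sym (ℚ.*-zeroˡ (fromN n))
fromN-* (suc m) n = trans (fromN-+ n (m ℕ.* n))
  (trans (cong (fromN n ℚ.+_) (fromN-* m n))
  (trans (regroup (fromN m) (fromN n)) (cong (ℚ._* fromN n) (sym (/-suc m 0)))))
  where
  regroup : ∀ a b → b ℚ.+ a ℚ.* b ≡ (a ℚ.+ 1ℚ) ℚ.* b
  regroup = let open ℚSolver.+-*-Solver in
    solve 2 (λ a b → b :+ a :* b := (a :+ con 1ℚ) :* b) refl

fromN-mono : ∀ {m n} → m ≤ n → fromN m ℚ.≤ fromN n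
fromN-mono {m} {n} m≤n = /-mono m 0 n 0 (ℕ.*-monoˡ-≤ 1 m≤n)

-- Huang's eigenvector as adversary weights

module _ {N T : ℕ} {f : BoolFun N} (computes : ComputableWith T f) {M : ℕ}
  (X : Vec Bool (suc M) → Fin N → Bool) (ι : Fin (suc M) → Fin N)
  (ι-injective : ∀ {r s} → ι r ≡ ι s → r ≡ s)
  (local : ∀ z r i → i ≢ ι r → X z i ≡ X (flip r z) i)
  (f-odd : xorSum (cube (suc M)) (f ∘ X) ≡ true)
  (s : ℕ) (s² : s ℕ.* s ≡ suc M) where

  private
    S : ℚ
    S = fromN s

    S² : S ℚ.* S ≡ fromN (suc M)
    S² = trans (sym (fromN-* s s)) (cong fromN s²)

    split = unbalanced M (f ∘ X) f-odd
    bad : Vec Bool (suc M) → Bool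
    bad = proj₁ split

    coefficients : (Fin (dim M) → ℚ) → Vec Bool M → ℚ
    coefficients x z = x (encode z)

    row : Vec Bool (suc M) → LinearForm (dim M)
    row z = record
      { apply = λ x → eigenvector S (coefficients x) z
      ; resp  = λ h → resp′ h z
      ; add   = λ x y → add′ x y z
      ; scale = λ c x → scale′ c x z
      }
      where
      resp′ : ∀ {x y} → (∀ i → x i ≡ y i) → ∀ z →
        eigenvector S (coefficients x) z ≡ eigenvector S (coefficients y) z
      resp′ h (false ∷ z) = h (encode z)
      resp′ h (true  ∷ z) = cong₂ (λ p q → S ℚ.* p ℚ.+ (ℚ.- 1ℚ) ℚ.* q)
        (h (encode z)) (huang-cong (λ z → h (encode z)) z)
      combination : ∀ c x y z → eigenvector S (coefficients λ i → x i ℚ.+ c ℚ.* y i) z ≡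
        eigenvector S (coefficients x) z ℚ.+ c ℚ.* eigenvector S (coefficients y) z
      combination c x y (false ∷ z) = refl
      combination c x y (true  ∷ z) =
        trans (cong (λ q → S ℚ.* (x (encode z) ℚ.+ c ℚ.* y (encode z)) ℚ.+ (ℚ.- 1ℚ) ℚ.* q)
                (huang-linear c (coefficients x) (coefficients y) z))
          (regroup S c (x (encode z)) (y (encode z)) (huang (coefficients x) z) (huang (coefficients y) z))
        where
        regroup : ∀ s c a b u v → s ℚ.* (a ℚ.+ c ℚ.* b) ℚ.+ (ℚ.- 1ℚ) ℚ.* (u ℚ.+ c ℚ.* v) ≡
          (s ℚ.* a ℚ.+ (ℚ.- 1ℚ) ℚ.* u) ℚ.+ c ℚ.* (s ℚ.* b ℚ.+ (ℚ.- 1ℚ) ℚ.* v)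
        regroup = let open ℚSolver.+-*-Solver in
          solve 6 (λ s c a b u v → s :* (a :+ c :* b) :+ (:- con 1ℚ) :* (u :+ c :* v) :=
            (s :* a :+ (:- con 1ℚ) :* u) :+ c :* (s :* b :+ (:- con 1ℚ) :* v)) refl
      add′ : ∀ x y z → eigenvector S (coefficients λ i → x i ℚ.+ y i) z ≡
        eigenvector S (coefficients x) z ℚ.+ eigenvector S (coefficients y) z
      add′ x y z = trans (resp′ (λ i → cong (x i ℚ.+_) (sym (ℚ.*-identityˡ (y i)))) z)
        (trans (combination 1ℚ x y z)
          (cong (eigenvector S (coefficients x) z ℚ.+_) (ℚ.*-identityˡ _)))
      -- `combination` scales only its second vector, so a plain multiple is obtained by taking x -
      -- x as the first one.
      zero-vector : ∀ x z → eigenvector S (coefficients λ i → x i ℚ.+ (ℚ.- 1ℚ) ℚ.* x i) z ≡ 0ℚ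
      zero-vector x z = trans (combination (ℚ.- 1ℚ) x x z) (cancel (eigenvector S (coefficients x) z))
        where
        cancel : ∀ p → p ℚ.+ (ℚ.- 1ℚ) ℚ.* p ≡ 0ℚ
        cancel = let open ℚSolver.+-*-Solver in solve 1 (λ p → p :+ (:- con 1ℚ) :* p := con 0ℚ) refl
      scale′ : ∀ c x z → eigenvector S (coefficients λ i → c ℚ.* x i) z ≡
        c ℚ.* eigenvector S (coefficients x) z
      scale′ c x z = trans (resp′ (λ i → expand c (x i)) z)
        (trans (combination c (λ i → x i ℚ.+ (ℚ.- 1ℚ) ℚ.* x i) x z)
          (0+q≡q (c ℚ.* eigenvector S (coefficients x) z) (zero-vector x z)))
        where
        expand : ∀ c p → c ℚ.* p ≡ (p ℚ.+ (ℚ.- 1ℚ) ℚ.* p) ℚ.+ c ℚ.* p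
        expand = let open ℚSolver.+-*-Solver in
          solve 2 (λ c p → c :* p := (p :+ (:- con 1ℚ) :* p) :+ c :* p) refl

    solution = nontrivial-solution (dim M) (map row (filterᵇ bad (cube (suc M))))
      (subst (_< dim M) (sym (length-map row (filterᵇ bad (cube (suc M))))) (proj₁ (proj₂ split)))

    x : Fin (dim M) → ℚ
    x = proj₁ solution

    v u : Vec Bool (suc M) → ℚ
    v = eigenvector S (coefficients x)
    -- The adversary bound asks for nonnegative weights. Under absolute values the zeros of `v`
    -- persist, and the eigenvalue equation becomes an inequality in the useful direction, since all
    -- matrix entries are 0 or ±1.
    u z = ∣ v z ∣

    vanishes : ∀ z → bad z ≡ true → v z ≡ 0ℚ
    vanishes z e = All.lookup (All.map⁻ (proj₂ (proj₂ solution))) (∈-filterᵇ bad (cube (suc M)) (∈-cube z) e)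

    sensitive : ∀ z r → u z ℚ.* u (flip r z) ≡ 0ℚ ⊎ f (X z) ≢ f (X (flip r z))
    sensitive z r with proj₂ (proj₂ split) z r
    ... | inj₁ e = inj₁ (trans (cong (λ p → ∣ p ∣ ℚ.* u (flip r z)) (vanishes z e)) (ℚ.*-zeroˡ (u (flip r z))))
    ... | inj₂ (inj₁ e) = inj₁ (trans (cong (λ p → u z ℚ.* ∣ p ∣) (vanishes (flip r z) e)) (ℚ.*-zeroʳ (u z)))
    ... | inj₂ (inj₂ ne) = inj₂ ne

    total pairs : ℚ
    total = ∑ (cube (suc M)) (square ∘ u)
    pairs = ∑ (cube (suc M)) λ z → ∑ (allFin (suc M)) λ r → u z ℚ.* u (flip r z)

    0<square : ∀ p → p ≢ 0ℚ → 0ℚ ℚ.< square p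
    0<square p p≢0 = ℚ.≰⇒> λ p²≤0 → p≢0 (square≡0 (ℚ.≤-antisym p²≤0 (0≤square p)))
      where
      square≡0 : square p ≡ 0ℚ → p ≡ 0ℚ
      square≡0 e = let k , pk≡1 = inverse p p≢0 in begin
        p                ≡⟨ ℚ.*-identityʳ p ⟨
        p ℚ.* 1ℚ         ≡⟨ cong (p ℚ.*_) pk≡1 ⟨
        p ℚ.* (p ℚ.* k)  ≡⟨ ℚ.*-assoc p p k ⟨
        square p ℚ.* k   ≡⟨ cong (ℚ._* k) e ⟩
        0ℚ ℚ.* k         ≡⟨ ℚ.*-zeroˡ k ⟩
        0ℚ               ∎
        where open ≡-Reasoning

    ∑-≥-term : ∀ {A : Set} (xs : List A) (g : A → ℚ) → (∀ a → 0ℚ ℚ.≤ g a) → ∀ {a} → a ∈ xs → g a ℚ.≤ ∑ xs g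
    ∑-≥-term (_ ∷ xs) g 0≤g {a} (here refl) = ≤-by-difference (∑ xs g) (∑-nonneg xs 0≤g) refl
    ∑-≥-term (b ∷ xs) g 0≤g (there a∈) = ℚ.≤-trans (∑-≥-term xs g 0≤g a∈)
      (≤-by-difference (g b) (0≤g b) (ℚ.+-comm (∑ xs g) (g b)))

    0<total : 0ℚ ℚ.< total
    0<total = ℚ.<-≤-trans (0<square (u z) uz≢0)
      (∑-≥-term (cube (suc M)) (square ∘ u) (λ z → 0≤square (u z)) (∈-cube z))
      where
      i = proj₁ (proj₁ (proj₂ solution))
      z : Vec Bool (suc M)
      -- The `false` half of `v` is the solution `x` itself, whose coordinate `i` is nonzero.
      z = false ∷ decodeBits i
      uz≢0 : u z ≢ 0ℚ
      uz≢0 e = proj₂ (proj₁ (proj₂ solution))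
        (trans (cong x (sym (encode-decode {M} i))) (ℚ.∣p∣≡0⇒p≡0 (v z) e))

    0≤S : 0ℚ ℚ.≤ S
    0≤S = fromN-mono {0} {s} z≤n

    eigenvalue-bound : S ℚ.* total ℚ.≤ pairs
    eigenvalue-bound = begin
      S ℚ.* total
        ≡⟨ ∑-* (cube (suc M)) S (square ∘ u) ⟨
      (∑ (cube (suc M)) λ z → S ℚ.* square (u z))
        ≤⟨ ∑-≤ (cube (suc M)) at ⟩
      pairs ∎
      where
      open ℚ.≤-Reasoning
      at : ∀ z → S ℚ.* square (u z) ℚ.≤ ∑ (allFin (suc M)) λ r → u z ℚ.* u (flip r z)
      at z = begin
        S ℚ.* (u z ℚ.* u z)                                ≡⟨ swap S (u z) ⟩
        u z ℚ.* (S ℚ.* u z)                                ≡⟨ cong (λ p → u z ℚ.* (p ℚ.* u z)) (ℚ.0≤p⇒∣p∣≡p 0≤S) ⟨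
        u z ℚ.* (∣ S ∣ ℚ.* u z)                            ≡⟨ cong (u z ℚ.*_) (ℚ.∣p*q∣≡∣p∣*∣q∣ S (v z)) ⟨
        u z ℚ.* ∣ S ℚ.* v z ∣                              ≡⟨ cong (λ p → u z ℚ.* ∣ p ∣) (huang-eigenvector S S² (coefficients x) z) ⟨
        u z ℚ.* ∣ huang v z ∣                              ≤⟨ ℚ.*-monoˡ-≤-nonNeg (u z) {{ℚ.nonNegative (ℚ.0≤∣p∣ (v z))}} (∣huang∣≤ v z) ⟩
        u z ℚ.* (∑ (allFin (suc M)) λ r → u (flip r z))    ≡⟨ ∑-* (allFin (suc M)) (u z) (λ r → u (flip r z)) ⟨
        (∑ (allFin (suc M)) λ r → u z ℚ.* u (flip r z))    ∎
        where
        swap : ∀ s p → s ℚ.* (p ℚ.* p) ≡ p ℚ.* (s ℚ.* p)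
        swap = let open ℚSolver.+-*-Solver in solve 2 (λ s p → s :* (p :* p) := p :* (s :* p)) refl

  -- The eigenvector gives `S` times `total` at most `pairs`, and the adversary gives `pairs` at
  -- most 18 · 4 · T times `total`. As `total` is positive, s ≥ 72 T + 1 would leave a surplus of at
  -- least 1/18 of `total`.
  odd-adversary : s ≤ 72 ℕ.* T
  odd-adversary = ℕ.≮⇒≥ λ 72T<s → ℚ.<-irrefl refl (begin-strict
    fromN T ℚ.* (4ℚ ℚ.* total)
      <⟨ increase ⟩
    fromN T ℚ.* (4ℚ ℚ.* total) ℚ.+ 1/18ℚ ℚ.* total
      ≡⟨ regroup (fromN T) total ⟩
    1/18ℚ ℚ.* ((fromN 72 ℚ.* fromN T ℚ.+ 1ℚ) ℚ.* total)
      ≡⟨ cong (λ q → 1/18ℚ ℚ.* (q ℚ.* total)) (trans (/-suc (72 ℕ.* T) 0) (cong (ℚ._+ 1ℚ) (fromN-* 72 T))) ⟨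
    1/18ℚ ℚ.* (fromN (suc (72 ℕ.* T)) ℚ.* total)
      ≤⟨ ℚ.*-monoˡ-≤-nonNeg 1/18ℚ (ℚ.*-monoʳ-≤-nonNeg total {{ℚ.nonNegative (ℚ.<⇒≤ 0<total)}} (fromN-mono 72T<s)) ⟩
    1/18ℚ ℚ.* (S ℚ.* total)
      ≤⟨ ℚ.*-monoˡ-≤-nonNeg 1/18ℚ eigenvalue-bound ⟩
    1/18ℚ ℚ.* pairs
      ≤⟨ adversary computes X ι ι-injective local u (λ z → ℚ.0≤∣p∣ (v z)) sensitive ⟩
    fromN T ℚ.* (∑ (cube (suc M)) λ z → 4ℚ ℚ.* square (u z))
      ≡⟨ cong (fromN T ℚ.*_) (∑-* (cube (suc M)) 4ℚ (square ∘ u)) ⟩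
    fromN T ℚ.* (4ℚ ℚ.* total) ∎)
    where
    open ℚ.≤-Reasoning
    increase : fromN T ℚ.* (4ℚ ℚ.* total) ℚ.< fromN T ℚ.* (4ℚ ℚ.* total) ℚ.+ 1/18ℚ ℚ.* total
    increase = subst (ℚ._< fromN T ℚ.* (4ℚ ℚ.* total) ℚ.+ 1/18ℚ ℚ.* total)
      (ℚ.+-identityʳ (fromN T ℚ.* (4ℚ ℚ.* total)))
      (ℚ.+-monoʳ-< (fromN T ℚ.* (4ℚ ℚ.* total))
        (subst (ℚ._< 1/18ℚ ℚ.* total) (ℚ.*-zeroʳ 1/18ℚ) (ℚ.*-monoʳ-<-pos 1/18ℚ 0<total)))
    regroup : ∀ t w → t ℚ.* (4ℚ ℚ.* w) ℚ.+ 1/18ℚ ℚ.* w ≡ 1/18ℚ ℚ.* ((fromN 72 ℚ.* t ℚ.+ 1ℚ) ℚ.* w)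
    regroup = let open ℚSolver.+-*-Solver in
      solve 2 (λ t w → t :* (con 4ℚ :* w) :+ con 1/18ℚ :* w :=
        con 1/18ℚ :* ((con (fromN 72) :* t :+ con 1ℚ) :* w)) refl

-- Functions on the cube that are invariant under a transitive 2-group

xorSum-cube-++ : ∀ m {n} (h : Vec Bool (m ℕ.+ n) → Bool) →
  xorSum (cube (m ℕ.+ n)) h ≡ xorSum (cube m) λ u → xorSum (cube n) λ w → h (u ++ⱽ w)
xorSum-cube-++ zero    {n} h = sym (Bool.xor-identityʳ (xorSum (cube n) h))
xorSum-cube-++ (suc m) {n} h = trans (xorSum-cube-suc {m ℕ.+ n} h)
  (trans (cong₂ _xor_ (xorSum-cube-++ m (h ∘ (false ∷_))) (xorSum-cube-++ m (h ∘ (true ∷_))))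
    (sym (xorSum-cube-suc {m} λ u → xorSum (cube n) λ w → h (u ++ⱽ w))))

-- The terms for (x, y) and (y, x) cancel in pairs.
xorSum-diagonal : ∀ {A : Set} (xs : List A) (G : A → A → Bool) → (∀ x y → G x y ≡ G y x) →
  (xorSum xs λ x → xorSum xs (G x)) ≡ xorSum xs λ x → G x x
xorSum-diagonal []       G sy = refl
xorSum-diagonal (x ∷ xs) G sy = begin
  (G x x xor a) xor (xorSum xs λ y → G y x xor xorSum xs (G y))
    ≡⟨ cong ((G x x xor a) xor_) (xorSum-xor xs (λ y → G y x) (λ y → xorSum xs (G y))) ⟩
  (G x x xor a) xor (xorSum xs (λ y → G y x) xor rest)
    ≡⟨ cong (λ b → (G x x xor a) xor (b xor rest)) (xorSum-cong xs λ y → sy y x) ⟩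
  (G x x xor a) xor (a xor rest)
    ≡⟨ Bool.xor-assoc (G x x) a (a xor rest) ⟩
  G x x xor (a xor (a xor rest))
    ≡⟨ cong (G x x xor_) (Bool.xor-assoc a a rest) ⟨
  G x x xor ((a xor a) xor rest)
    ≡⟨ cong (λ b → G x x xor (b xor rest)) (Bool.xor-same a) ⟩
  G x x xor rest
    ≡⟨ cong (G x x xor_) (xorSum-diagonal xs G sy) ⟩
  G x x xor (xorSum xs λ x → G x x) ∎
  where
  open ≡-Reasoning
  a = xorSum xs (G x)
  rest = xorSum xs λ y → xorSum xs (G y)

at : ∀ d → Vec Bool (dim d) → Vec Bool d → Bool
at d z i = lookup z (encode i)

at-false : ∀ {d} (u w : Vec Bool (dim d)) i → at (suc d) (u ++ⱽ w) (false ∷ i) ≡ at d u i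
at-false u w i = lookup-++ˡ u w (encode i)

at-true : ∀ {d} (u w : Vec Bool (dim d)) i → at (suc d) (u ++ⱽ w) (true ∷ i) ≡ at d w i
at-true u w i = lookup-++ʳ u w (encode i)

replicate-++ : ∀ m n {A : Set} (x : A) → replicate m x ++ⱽ replicate n x ≡ replicate (m ℕ.+ n) x
replicate-++ zero    n x = refl
replicate-++ (suc m) n x = cong (x ∷_) (replicate-++ m n x)

lookup-flip : ∀ {M} r (z : Vec Bool M) k → k ≢ r → lookup (flip r z) k ≡ lookup z k
lookup-flip zero    (b ∷ z) zero    k≢r = contradiction refl k≢r
lookup-flip zero    (b ∷ z) (suc k) k≢r = refl
lookup-flip (suc r) (b ∷ z) zero    k≢r = refl
lookup-flip (suc r) (b ∷ z) (suc k) k≢r = lookup-flip r z k (k≢r ∘ cong suc)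

-- The bit flips generate a transitive 2-group on the coordinates, so the only
-- orbits of odd size are those of the two constant points.
invariant-parity : ∀ d (g : Vec Bool (dim d) → Bool) →
  (∀ p z z′ → (∀ i → at d z′ i ≡ at d z (flip p i)) → g z ≡ g z′) →
  xorSum (cube (dim d)) g ≡ g (replicate (dim d) false) xor g (replicate (dim d) true)
invariant-parity zero g inv = cong (g (false ∷ []) xor_) (Bool.xor-identityʳ (g (true ∷ [])))
invariant-parity (suc d) g inv = begin
  xorSum (cube (dim d ℕ.+ dim d)) g
    ≡⟨ xorSum-cube-++ (dim d) g ⟩
  (xorSum (cube (dim d)) λ u → xorSum (cube (dim d)) λ w → g (u ++ⱽ w))
    -- Flipping the leading index bit swaps the two halves of a point, so only the points with equal
    -- halves survive; on these the remaining bits act as in dimension `dim d`.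
    ≡⟨ xorSum-diagonal (cube (dim d)) (λ u w → g (u ++ⱽ w)) (λ u w →
         inv zero (u ++ⱽ w) (w ++ⱽ u) (swap u w)) ⟩
  (xorSum (cube (dim d)) λ u → g (u ++ⱽ u))
    ≡⟨ invariant-parity d (λ u → g (u ++ⱽ u)) (λ p u u′ e →
         inv (suc p) (u ++ⱽ u) (u′ ++ⱽ u′) (double p u u′ e)) ⟩
  g (replicate (dim d) false ++ⱽ replicate (dim d) false) xor
  g (replicate (dim d) true ++ⱽ replicate (dim d) true)
    ≡⟨ cong₂ (λ s t → g s xor g t) (replicate-++ (dim d) (dim d) false) (replicate-++ (dim d) (dim d) true) ⟩
  g (replicate (dim (suc d)) false) xor g (replicate (dim (suc d)) true) ∎
  where
  open ≡-Reasoning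
  swap : ∀ u w i → at (suc d) (w ++ⱽ u) i ≡ at (suc d) (u ++ⱽ w) (flip zero i)
  swap u w (false ∷ i) = trans (at-false w u i) (sym (at-true u w i))
  swap u w (true  ∷ i) = trans (at-true w u i) (sym (at-false u w i))
  double : ∀ p u u′ → (∀ i → at d u′ i ≡ at d u (flip p i)) →
    ∀ i → at (suc d) (u′ ++ⱽ u′) i ≡ at (suc d) (u ++ⱽ u) (flip (suc p) i)
  double p u u′ e (false ∷ i) = trans (at-false u′ u′ i) (trans (e i) (sym (at-false u u (flip p i))))
  double p u u′ e (true  ∷ i) = trans (at-true u′ u′ i) (trans (e i) (sym (at-true u u (flip p i))))

-- Fixing one coordinate splits an odd function into two, exactly one of which is odd.
odd-restriction : ∀ {N T} {f : BoolFun N} → ComputableWith T f →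
  ∀ {m} (X : Vec Bool m → Fin N → Bool) (ι : Fin m → Fin N) →
  (∀ {r s} → ι r ≡ ι s → r ≡ s) →
  (∀ z r i → i ≢ ι r → X z i ≡ X (flip r z) i) →
  xorSum (cube m) (f ∘ X) ≡ true → ∀ s → s ℕ.* s ≤ m → s ≤ 72 ℕ.* T
odd-restriction {N} {T} {f} computes {m} X ι inj local f-odd s s²≤m = restrict (ℕ.≤⇒≤′ s²≤m) X ι inj local f-odd
  where
  Claim : ∀ {m} → (Vec Bool m → Fin N → Bool) → (Fin m → Fin N) → Set
  Claim {m} X ι = (∀ {r s} → ι r ≡ ι s → r ≡ s) → (∀ z r i → i ≢ ι r → X z i ≡ X (flip r z) i) →
    xorSum (cube m) (f ∘ X) ≡ true → s ≤ 72 ℕ.* T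
  exact : ∀ {m} → s ℕ.* s ≡ m → (X : Vec Bool m → Fin N → Bool) (ι : Fin m → Fin N) → Claim X ι
  exact {zero} s²≡0 X ι inj local f-odd = subst (_≤ 72 ℕ.* T) (sym s≡0) z≤n
    where
    s≡0 : s ≡ 0
    s≡0 = Data.Sum.reduce (ℕ.m*n≡0⇒m≡0∨n≡0 s s²≡0)
  exact {suc m} s²≡ X ι inj local f-odd = odd-adversary computes X ι inj local f-odd s s²≡
  restrict : ∀ {m} → s ℕ.* s ℕ.≤′ m → (X : Vec Bool m → Fin N → Bool) (ι : Fin m → Fin N) → Claim X ι
  restrict (ℕ.≤′-reflexive s²≡m) X ι inj local f-odd = exact s²≡m X ι inj local f-odd
  restrict {suc m} (ℕ.≤′-step h) X ι inj local f-odd =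
    choose (xorSum (cube m) (f ∘ X ∘ (false ∷_))) refl
    where
    choose : ∀ b → xorSum (cube m) (f ∘ X ∘ (false ∷_)) ≡ b → s ≤ 72 ℕ.* T
    choose true  e = restrict h (X ∘ (false ∷_)) (ι ∘ suc) (Fin.suc-injective ∘ inj)
      (λ z r → local (false ∷ z) (suc r)) e
    choose false e = restrict h (X ∘ (true ∷_)) (ι ∘ suc) (Fin.suc-injective ∘ inj)
      (λ z r → local (true ∷ z) (suc r))
      (trans (cong (_xor xorSum (cube m) (f ∘ X ∘ (true ∷_))) (sym e))
        (trans (sym (xorSum-cube-suc {m} (f ∘ X))) f-odd))

-- Triples of vertices

module _ {V : Set} where

  Distinct : V → V → V → Set
  Distinct a b c = a ≢ b × a ≢ c × b ≢ c

  -- Hyperedges are unordered. The two adjacent transpositions generate all orders, so a relation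
  -- has to be specified in one convenient order only.
  data Sym (Φ : V → V → V → Set) : V → V → V → Set where
    base   : ∀ {a b c} → Φ a b c → Sym Φ a b c
    swap₁₂ : ∀ {a b c} → Sym Φ a b c → Sym Φ b a c
    swap₂₃ : ∀ {a b c} → Sym Φ a b c → Sym Φ a c b

  Matches : V → V → V → V → V → V → Set
  Matches a b c u v w = u ≡ a × v ≡ b × w ≡ c

  OneOf : V → V → V → V → Set
  OneOf a b c v = v ≡ a ⊎ v ≡ b ⊎ v ≡ c

  matches-oneOf : ∀ {a b c u v w} → Sym (Matches a b c) u v w → OneOf a b c u × OneOf a b c v × OneOf a b c w
  matches-oneOf (base (e₁ , e₂ , e₃)) = inj₁ e₁ , inj₂ (inj₁ e₂) , inj₂ (inj₂ e₃)
  matches-oneOf (swap₁₂ s) = let o₁ , o₂ , o₃ = matches-oneOf s in o₂ , o₁ , o₃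
  matches-oneOf (swap₂₃ s) = let o₁ , o₂ , o₃ = matches-oneOf s in o₁ , o₃ , o₂

  distinct₁₂ : ∀ {a b c} → Distinct a b c → Distinct b a c
  distinct₁₂ (ab , ac , bc) = ab ∘ sym , bc , ac

  distinct₂₃ : ∀ {a b c} → Distinct a b c → Distinct a c b
  distinct₂₃ (ab , ac , bc) = ac , ab , bc ∘ sym

distinct-map : ∀ {V W : Set} (φ : V → W) → (∀ {a b} → φ a ≡ φ b → a ≡ b) →
               ∀ {a b c} → Distinct a b c → Distinct (φ a) (φ b) (φ c)
distinct-map φ inj (ab , ac , bc) = ab ∘ inj , ac ∘ inj , bc ∘ inj

module _ {n : ℕ} where

  triple₁₂ : ∀ (u v w : Fin n) → triple u v w ≡ triple v u w
  triple₁₂ u v w = trans (sym (∪-assoc ⁅ u ⁆ ⁅ v ⁆ ⁅ w ⁆))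
    (trans (cong (_∪ ⁅ w ⁆) (∪-comm ⁅ u ⁆ ⁅ v ⁆)) (∪-assoc ⁅ v ⁆ ⁅ u ⁆ ⁅ w ⁆))

  triple₂₃ : ∀ (u v w : Fin n) → triple u v w ≡ triple u w v
  triple₂₃ u v w = cong (⁅ u ⁆ ∪_) (∪-comm ⁅ v ⁆ ⁅ w ⁆)

  ∈-triple : ∀ {x u v w : Fin n} → x ∈ˢ triple u v w → x ≡ u ⊎ x ≡ v ⊎ x ≡ w
  ∈-triple {x} {u} {v} {w} x∈ with x∈p∪q⁻ ⁅ u ⁆ (⁅ v ⁆ ∪ ⁅ w ⁆) x∈
  ... | inj₁ x∈u = inj₁ (x∈⁅y⁆⇒x≡y u x∈u)
  ... | inj₂ x∈vw with x∈p∪q⁻ ⁅ v ⁆ ⁅ w ⁆ x∈vw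
  ...   | inj₁ x∈v = inj₂ (inj₁ (x∈⁅y⁆⇒x≡y v x∈v))
  ...   | inj₂ x∈w = inj₂ (inj₂ (x∈⁅y⁆⇒x≡y w x∈w))

  ∈-triple₁ : ∀ (u v w : Fin n) → u ∈ˢ triple u v w
  ∈-triple₁ u v w = x∈p∪q⁺ (inj₁ (x∈⁅x⁆ u))

  ∈-triple₂ : ∀ (u v w : Fin n) → v ∈ˢ triple u v w
  ∈-triple₂ u v w = subst (v ∈ˢ_) (triple₁₂ v u w) (∈-triple₁ v u w)

  ∈-triple₃ : ∀ (u v w : Fin n) → w ∈ˢ triple u v w
  ∈-triple₃ u v w = subst (w ∈ˢ_) (triple₂₃ u w v) (∈-triple₂ u w v)

card-insert : ∀ {n} (a : Fin n) q → a ∉ q → card (⁅ a ⁆ ∪ q) ≡ suc (card q)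
card-insert zero    (inside  ∷ q) a∉q = contradiction Vec.here a∉q
card-insert zero    (outside ∷ q) a∉q = cong (suc ∘ card) (∪-identityˡ q)
card-insert (suc a) (inside  ∷ q) a∉q = cong suc (card-insert a q (a∉q ∘ Vec.there))
card-insert (suc a) (outside ∷ q) a∉q = card-insert a q (a∉q ∘ Vec.there)

card-pair : ∀ {n} {v w : Fin n} → v ≢ w → card (⁅ v ⁆ ∪ ⁅ w ⁆) ≡ 2
card-pair {v = v} {w} v≢w = trans (card-insert v ⁅ w ⁆ (v≢w ∘ x∈⁅y⁆⇒x≡y w)) (cong suc (∣⁅x⁆∣≡1 w))

card-triple : ∀ {n} {u v w : Fin n} → Distinct u v w → card (triple u v w) ≡ 3
card-triple {u = u} {v} {w} (uv , uw , vw) =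
  trans (card-insert u (⁅ v ⁆ ∪ ⁅ w ⁆) outside-pair) (cong suc (card-pair vw))
  where
  outside-pair : u ∉ (⁅ v ⁆ ∪ ⁅ w ⁆)
  outside-pair u∈ with x∈p∪q⁻ ⁅ v ⁆ ⁅ w ⁆ u∈
  ... | inj₁ u∈v = uv (x∈⁅y⁆⇒x≡y v u∈v)
  ... | inj₂ u∈w = uw (x∈⁅y⁆⇒x≡y w u∈w)

card-degenerate : ∀ {n} (u w : Fin n) → card (triple u u w) ≢ 3
card-degenerate u w e with u Fin.≟ w
... | no u≢w   = contradiction (trans (sym (card-pair u≢w)) (trans (cong card (sym collapse)) e)) λ ()
  where
  collapse : triple u u w ≡ ⁅ u ⁆ ∪ ⁅ w ⁆
  collapse = trans (sym (∪-assoc ⁅ u ⁆ ⁅ u ⁆ ⁅ w ⁆)) (cong (_∪ ⁅ w ⁆) (∪-idem ⁅ u ⁆))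
... | yes refl = contradiction (trans (sym (∣⁅x⁆∣≡1 u)) (trans (cong card (sym collapse)) e)) λ ()
  where
  collapse : triple u u u ≡ ⁅ u ⁆
  collapse = trans (cong (⁅ u ⁆ ∪_) (∪-idem ⁅ u ⁆)) (∪-idem ⁅ u ⁆)

distinct-triple : ∀ {n} {u v w : Fin n} → card (triple u v w) ≡ 3 → Distinct u v w
distinct-triple {u = u} {v} {w} e =
    (λ { refl → card-degenerate u w e })
  , (λ { refl → card-degenerate u v (trans (cong card (triple₂₃ u u v)) e) })
  , (λ { refl → card-degenerate v u (trans (cong card (trans (triple₂₃ v v u) (triple₁₂ v u v))) e) })

triple-permutation : ∀ {n} {u v w a b c : Fin n} → triple u v w ≡ triple a b c → Distinct u v w →
                     Sym (Matches a b c) u v w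
triple-permutation {u = u} {v} {w} {a} {b} {c} e (uv , uw , vw)
  with ∈-triple (subst (u ∈ˢ_) e (∈-triple₁ u v w))
     | ∈-triple (subst (v ∈ˢ_) e (∈-triple₂ u v w))
     | ∈-triple (subst (w ∈ˢ_) e (∈-triple₃ u v w))
... | inj₁ refl        | inj₁ refl        | _                = contradiction refl uv
... | inj₁ refl        | inj₂ (inj₁ refl) | inj₁ refl        = contradiction refl uw
... | inj₁ refl        | inj₂ (inj₁ refl) | inj₂ (inj₁ refl) = contradiction refl vw
... | inj₁ refl        | inj₂ (inj₁ refl) | inj₂ (inj₂ refl) = base (refl , refl , refl)
... | inj₁ refl        | inj₂ (inj₂ refl) | inj₁ refl        = contradiction refl uw
... | inj₁ refl        | inj₂ (inj₂ refl) | inj₂ (inj₁ refl) = swap₂₃ (base (refl , refl , refl))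
... | inj₁ refl        | inj₂ (inj₂ refl) | inj₂ (inj₂ refl) = contradiction refl vw
... | inj₂ (inj₁ refl) | inj₁ refl        | inj₁ refl        = contradiction refl vw
... | inj₂ (inj₁ refl) | inj₁ refl        | inj₂ (inj₁ refl) = contradiction refl uw
... | inj₂ (inj₁ refl) | inj₁ refl        | inj₂ (inj₂ refl) = swap₁₂ (base (refl , refl , refl))
... | inj₂ (inj₁ refl) | inj₂ (inj₁ refl) | _                = contradiction refl uv
... | inj₂ (inj₁ refl) | inj₂ (inj₂ refl) | inj₁ refl        = swap₂₃ (swap₁₂ (base (refl , refl , refl)))
... | inj₂ (inj₁ refl) | inj₂ (inj₂ refl) | inj₂ (inj₁ refl) = contradiction refl uw
... | inj₂ (inj₁ refl) | inj₂ (inj₂ refl) | inj₂ (inj₂ refl) = contradiction refl vw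
... | inj₂ (inj₂ refl) | inj₁ refl        | inj₁ refl        = contradiction refl vw
... | inj₂ (inj₂ refl) | inj₁ refl        | inj₂ (inj₁ refl) = swap₁₂ (swap₂₃ (base (refl , refl , refl)))
... | inj₂ (inj₂ refl) | inj₁ refl        | inj₂ (inj₂ refl) = contradiction refl uw
... | inj₂ (inj₂ refl) | inj₂ (inj₁ refl) | inj₁ refl        = swap₁₂ (swap₂₃ (swap₁₂ (base (refl , refl , refl))))
... | inj₂ (inj₂ refl) | inj₂ (inj₁ refl) | inj₂ (inj₁ refl) = contradiction refl vw
... | inj₂ (inj₂ refl) | inj₂ (inj₁ refl) | inj₂ (inj₂ refl) = contradiction refl uw
... | inj₂ (inj₂ refl) | inj₂ (inj₂ refl) | _                = contradiction refl uv

extract : ∀ {n k} (S : Subset n) → card S ≡ suc k → ∃[ u ] ∃[ S′ ] (S ≡ ⁅ u ⁆ ∪ S′ × card S′ ≡ k)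
extract (inside  ∷ S) e = zero , outside ∷ S , cong (inside ∷_) (sym (∪-identityˡ S)) , ℕ.suc-injective e
extract (outside ∷ S) e = let u , S′ , eq , e′ = extract S e in
  suc u , outside ∷ S′ , cong (outside ∷_) eq , e′

card≡0 : ∀ {n} (S : Subset n) → card S ≡ 0 → S ≡ ∅
card≡0 []            e = refl
card≡0 (outside ∷ S) e = cong (outside ∷_) (card≡0 S e)

card≡3 : ∀ {n} (S : Subset n) → card S ≡ 3 → ∃[ u ] ∃[ v ] ∃[ w ] S ≡ triple u v w
card≡3 S e with extract S e
... | u , S₁ , refl , e₁ with extract S₁ e₁
...   | v , S₂ , refl , e₂ with extract S₂ e₂
...     | w , S₃ , refl , e₃ = u , v , w ,
          cong (λ T → ⁅ u ⁆ ∪ ⁅ v ⁆ ∪ T) (trans (cong (⁅ w ⁆ ∪_) (card≡0 S₃ e₃)) (∪-identityʳ ⁅ w ⁆))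

-- Homomorphisms into a hypergraph generated by a ternary relation

HomTo : ∀ {n} → Hypergraph n → {V : Set} → (V → V → V → Set) → Set
HomTo {n} H {V} Φ = Σ (Fin n → V) λ h → ∀ u v w → triple u v w ∈ᴱ H →
  Distinct (h u) (h v) (h w) × Sym Φ (h u) (h v) (h w)

-- Distinctness is asked for on generating triples rather than as injectivity of `φ`, so that
-- vertices on no common hyperedge may be identified, as happens in `bottom`.
hom-map : ∀ {n} {H : Hypergraph n} {V W : Set} {Φ : V → V → V → Set} {Ψ : W → W → W → Set} (φ : V → W) →
  (∀ {a b c} → Distinct a b c → Φ a b c → Distinct (φ a) (φ b) (φ c) × Sym Ψ (φ a) (φ b) (φ c)) →
  HomTo H Φ → HomTo H Ψ
hom-map {Φ = Φ} {Ψ} φ k (h , edges) = φ ∘ h , λ u v w e →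
  let d , s = edges u v w e in go d s
  where
  go : ∀ {a b c} → Distinct a b c → Sym Φ a b c → Distinct (φ a) (φ b) (φ c) × Sym Ψ (φ a) (φ b) (φ c)
  go d (base e)   = k d e
  go d (swap₁₂ s) = let d′ , s′ = go (distinct₁₂ d) s in distinct₁₂ d′ , swap₁₂ s′
  go d (swap₂₃ s) = let d′ , s′ = go (distinct₂₃ d) s in distinct₂₃ d′ , swap₂₃ s′

hom-mono : ∀ {n} {H : Hypergraph n} {V : Set} {Φ Ψ : V → V → V → Set} →
  (∀ {a b c} → Distinct a b c → Φ a b c → Sym Ψ a b c) → HomTo H Φ → HomTo H Ψ
hom-mono {H = H} k = hom-map {H = H} id λ d e → d , k d e

-- Inputs extending a base hypergraph

module Extensions {n : ℕ} {V : Set} (j : V → Fin n) (r : Fin n → V) (r∘j : ∀ v → r (j v) ≡ v)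
  (Φ : V → V → V → Set) (Φ? : ∀ a b c → Dec (Φ a b c))
  {d : ℕ} (κ : Vec Bool d → V × V × V) where

  κ₁ κ₂ κ₃ : Vec Bool d → V
  κ₁ = proj₁ ∘ κ
  κ₂ = proj₁ ∘ proj₂ ∘ κ
  κ₃ = proj₂ ∘ proj₂ ∘ κ

  private
    j-injective : ∀ {a b} → j a ≡ j b → a ≡ b
    j-injective {a} {b} e = trans (sym (r∘j a)) (trans (cong r e) (r∘j b))

    κˢ : Fin (dim d) → Subset n
    κˢ k = let i = decodeBits k in triple (j (κ₁ i)) (j (κ₂ i)) (j (κ₃ i))

    index : KSubset n 3 → Fin _
    index = Inverse.to (subsetIndex n 3)

    edge : Fin _ → KSubset n 3
    edge = Inverse.from (subsetIndex n 3)

    edge-index : ∀ S → edge (index S) ≡ S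
    edge-index S = Inverse.strictlyInverseʳ (subsetIndex n 3) S

  Extension : Vec Bool (dim d) → V → V → V → Set
  Extension z a b c = Φ a b c ⊎ ∃[ i ] (at d z i ≡ true × a ≡ κ₁ i × b ≡ κ₂ i × c ≡ κ₃ i)

  private
    -- Vertices of `V` are searched for as values of `r` on `Fin n`, which keeps this decidable. All
    -- hyperedges lie in the image of `j`; the remaining vertices of `Fin n` are isolated.
    Present : Vec Bool (dim d) → Subset n → Set
    Present z S =
      (∃[ a ] ∃[ b ] ∃[ c ] (Φ (r a) (r b) (r c) × triple (j (r a)) (j (r b)) (j (r c)) ≡ S)) ⊎
      (∃[ k ] (lookup z k ≡ true × κˢ k ≡ S))

    _≟ˢ_ : (S S′ : Subset n) → Dec (S ≡ S′)
    _≟ˢ_ = Vec.≡-dec Bool._≟_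

    present? : ∀ z S → Dec (Present z S)
    present? z S =
      (Fin.any? λ a → Fin.any? λ b → Fin.any? λ c →
        Φ? (r a) (r b) (r c) ×-dec (triple (j (r a)) (j (r b)) (j (r c)) ≟ˢ S)) ⊎-dec
      (Fin.any? λ k → (lookup z k Bool.≟ true) ×-dec (κˢ k ≟ˢ S))

  input : Vec Bool (dim d) → Fin _ → Bool
  input z k = does (present? z (proj₁ (edge k)))

  private
    decode-input : ∀ z S → decode n (input z) S ≡ does (present? z (proj₁ S))
    decode-input z S = cong (λ S → does (present? z (proj₁ S))) (edge-index S)

    does-true : ∀ {A : Set} (a? : Dec A) → does a? ≡ true → A
    does-true (yes a) e = a

  hom-input : ∀ {H : Hypergraph n} z → HomTo H (Extension z) → Hom H (decode n (input z))
  hom-input z (h , edges) = j ∘ h , λ u v w e → let d , s = edges u v w e in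
      card-triple (distinct-map j j-injective d)
    , trans (decode-input z _) (dec-true (present? z _) (present s))
    where
    present : ∀ {a b c} → Sym (Extension z) a b c → Present z (triple (j a) (j b) (j c))
    present {a} {b} {c} (base (inj₁ e)) = inj₁ (j a , j b , j c , fixed)
      where
      fixed : Φ (r (j a)) (r (j b)) (r (j c)) ×
              triple (j (r (j a))) (j (r (j b))) (j (r (j c))) ≡ triple (j a) (j b) (j c)
      fixed rewrite r∘j a | r∘j b | r∘j c = e , refl
    present (base (inj₂ (i , on , refl , refl , refl))) = inj₂ (encode i , on ,
      cong (λ i → triple (j (κ₁ i)) (j (κ₂ i)) (j (κ₃ i))) (decode-encode i))
    present (swap₁₂ {a} {b} {c} s) = subst (Present z) (triple₁₂ (j a) (j b) (j c)) (present s)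
    present (swap₂₃ {a} {b} {c} s) = subst (Present z) (triple₂₃ (j a) (j b) (j c)) (present s)

  -- The homomorphism is composed with `r`. This is harmless because every hyperedge of the input
  -- lies in the image of `j`, where `r` inverts `j`.
  input-hom : ∀ {H : Hypergraph n} z → Hom H (decode n (input z)) → HomTo H (Extension z)
  input-hom z (h , edges) = r ∘ h , λ u v w e → let p , on = edges u v w e in
    related (distinct-triple p) (does-true (present? z _) (trans (sym (decode-input z _)) on))
    where
    match : ∀ {x y w a b c} → Distinct x y w → triple (j a) (j b) (j c) ≡ triple x y w → Extension z a b c →
            Distinct (r x) (r y) (r w) × Sym (Extension z) (r x) (r y) (r w)
    match {x} {y} {w} {a} {b} {c} d e ext = transport d (triple-permutation (sym e) d)
      where
      transport : ∀ {x y w} → Distinct x y w → Sym (Matches (j a) (j b) (j c)) x y w →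
                  Distinct (r x) (r y) (r w) × Sym (Extension z) (r x) (r y) (r w)
      transport (ab , ac , bc) (base (refl , refl , refl)) rewrite r∘j a | r∘j b | r∘j c =
        (ab ∘ cong j , ac ∘ cong j , bc ∘ cong j) , base ext
      transport d (swap₁₂ s) = let d′ , s′ = transport (distinct₁₂ d) s in distinct₁₂ d′ , swap₁₂ s′
      transport d (swap₂₃ s) = let d′ , s′ = transport (distinct₂₃ d) s in distinct₂₃ d′ , swap₂₃ s′
    related : ∀ {x y w} → Distinct x y w → Present z (triple x y w) →
              Distinct (r x) (r y) (r w) × Sym (Extension z) (r x) (r y) (r w)
    related δ (inj₁ (a , b , c , φ , e)) = match δ e (inj₁ φ)
    related δ (inj₂ (k , on , e)) = match δ e
      (inj₂ (decodeBits k , trans (cong (lookup z) (encode-decode {d} k)) on , refl , refl , refl))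

  module _ (κ-distinct : ∀ i → Distinct (κ₁ i) (κ₂ i) (κ₃ i)) where

    coordinate : Fin (dim d) → Fin _
    coordinate k = index (κˢ k , card-triple (distinct-map j j-injective (κ-distinct (decodeBits k))))

    edge-coordinate : ∀ k → proj₁ (edge (coordinate k)) ≡ κˢ k
    edge-coordinate k = cong proj₁ (edge-index _)

    input-local : ∀ z k i → i ≢ coordinate k → input z i ≡ input (flip k z) i
    input-local z k i i≢ = does-⇔
      (mk⇔ (forth {z} {flip k z} (λ l l≢k → sym (lookup-flip k z l l≢k))) (forth {flip k z} {z} (lookup-flip k z)))
      (present? z S) (present? (flip k z) S)
      where
      S = proj₁ (edge i)
      S≢ : ∀ {l} → κˢ l ≡ S → l ≢ k
      S≢ e refl = i≢ (trans (sym (Inverse.strictlyInverseˡ (subsetIndex n 3) i))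
        (cong index (KSubset-≡ (sym e))))
      forth : ∀ {z z′} → (∀ l → l ≢ k → lookup z l ≡ lookup z′ l) → Present z S → Present z′ S
      forth same (inj₁ p) = inj₁ p
      forth same (inj₂ (l , on , e)) = inj₂ (l , trans (sym (same l (S≢ e))) on , e)

    -- Input positions are unordered triples, so `κ` has to be injective even up to reordering.
    coordinate-injective :
      (∀ i i′ → Sym (Matches (κ₁ i′) (κ₂ i′) (κ₃ i′)) (κ₁ i) (κ₂ i) (κ₃ i) → i ≡ i′) →
      ∀ {k l} → coordinate k ≡ coordinate l → k ≡ l
    coordinate-injective κ-injective {k} {l} e = begin
      k                       ≡⟨ encode-decode {d} k ⟨
      encode (decodeBits {d} k) ≡⟨ cong encode (κ-injective (decodeBits k) (decodeBits l) pulled) ⟩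
      encode (decodeBits {d} l) ≡⟨ encode-decode {d} l ⟩
      l                       ∎
      where
      open ≡-Reasoning
      same : κˢ k ≡ κˢ l
      same = trans (sym (edge-coordinate k)) (trans (cong (proj₁ ∘ edge) e) (edge-coordinate l))
      pull : ∀ {x y w a b c} → Sym (Matches (j a) (j b) (j c)) x y w →
             Sym (Matches a b c) (r x) (r y) (r w)
      pull {a = a} {b} {c} (base (refl , refl , refl)) = base (r∘j a , r∘j b , r∘j c)
      pull (swap₁₂ s) = swap₁₂ (pull s)
      pull (swap₂₃ s) = swap₂₃ (pull s)
      pulled : Sym (Matches (κ₁ (decodeBits l)) (κ₂ (decodeBits l)) (κ₃ (decodeBits l)))
                   (κ₁ (decodeBits k)) (κ₂ (decodeBits k)) (κ₃ (decodeBits k))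
      pulled = retract (pull (triple-permutation same (distinct-map j j-injective (κ-distinct (decodeBits k)))))
        where
        retract : ∀ {Ψ : V → V → V → Set} {a b c} → Sym Ψ (r (j a)) (r (j b)) (r (j c)) → Sym Ψ a b c
        retract {a = a} {b} {c} s rewrite r∘j a | r∘j b | r∘j c = s

flip-involutive : ∀ {M} r (z : Vec Bool M) → flip r (flip r z) ≡ z
flip-involutive zero    (b ∷ z) = cong (_∷ z) (Bool.not-involutive b)
flip-involutive (suc r) (b ∷ z) = cong (b ∷_) (flip-involutive r z)

involutive⇒injective : ∀ {V : Set} {π : V → V} → (∀ v → π (π v) ≡ v) → ∀ {u v} → π u ≡ π v → u ≡ v
involutive⇒injective {π = π} inv {u} {v} e = trans (sym (inv u)) (trans (cong π e) (inv v))

-- Adding an orbit of hyperedges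

module Orbit {n T : ℕ} (H : Hypergraph n) (computes : ComputableWith T f[ H ])
  {V : Set} (j : V → Fin n) (r : Fin n → V) (r∘j : ∀ v → r (j v) ≡ v)
  (Φ : V → V → V → Set) (Φ? : ∀ a b c → Dec (Φ a b c))
  {d : ℕ} (κ : Vec Bool d → V × V × V) where

  open Extensions j r r∘j Φ Φ? κ

  WithOrbit : V → V → V → Set
  WithOrbit a b c = Φ a b c ⊎ ∃[ i ] (a ≡ κ₁ i × b ≡ κ₂ i × c ≡ κ₃ i)

  -- Composing with `π` turns a homomorphism for one set of added triples into one for the set with
  -- index bit `p` flipped, so `invariant-parity` applies to `g`. Its value is 0 when nothing is
  -- added and would be 1 when the whole orbit is, so `g` would be odd and `odd-restriction` would
  -- force s ≤ 72 T.
  orbit-step : (∀ i → Distinct (κ₁ i) (κ₂ i) (κ₃ i)) →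
    (∀ i i′ → Sym (Matches (κ₁ i′) (κ₂ i′) (κ₃ i′)) (κ₁ i) (κ₂ i) (κ₃ i) → i ≡ i′) →
    (∀ p → ∃[ π ] ((∀ {u v} → π u ≡ π v → u ≡ v) × (∀ {a b c} → Φ a b c → Sym Φ (π a) (π b) (π c)) ×
      (∀ i → π (κ₁ i) ≡ κ₁ (flip p i) × π (κ₂ i) ≡ κ₂ (flip p i) × π (κ₃ i) ≡ κ₃ (flip p i)))) →
    ∀ s → s ℕ.* s ≤ dim d → 72 ℕ.* T < s → ¬ HomTo H Φ → ¬ HomTo H WithOrbit
  orbit-step κ-distinct κ-injective symmetry s s²≤ 72T<s none some = ℕ.<⇒≱ 72T<s
    (odd-restriction computes input (coordinate κ-distinct)
      (coordinate-injective κ-distinct κ-injective) (input-local κ-distinct) f-odd s s²≤)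
    where
    empty full : Vec Bool (dim d)
    empty = replicate (dim d) false
    full  = replicate (dim d) true
    g : Vec Bool (dim d) → Bool
    g z = f[ H ] (input z)
    g-empty : g empty ≡ false
    g-empty = dec-false (hom? H (decode n (input empty))) λ hom →
      none (hom-mono {H = H} {Φ = Extension empty} {Ψ = Φ} restrict (input-hom {H = H} empty hom))
      where
      restrict : ∀ {a b c} → Distinct a b c → Extension empty a b c → Sym Φ a b c
      restrict _ (inj₁ e) = base e
      restrict _ (inj₂ (i , on , _)) =
        contradiction (trans (sym (lookup-replicate (encode i) false)) on) λ ()
    g-full : g full ≡ true
    g-full = dec-true (hom? H (decode n (input full)))
      (hom-input {H = H} full (hom-mono {H = H} {Φ = WithOrbit} {Ψ = Extension full} extend some))
      where
      extend : ∀ {a b c} → Distinct a b c → WithOrbit a b c → Sym (Extension full) a b c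
      extend _ (inj₁ e)       = base (inj₁ e)
      extend _ (inj₂ (i , e)) = base (inj₂ (i , lookup-replicate (encode i) true , e))
    transfer : ∀ p z z′ → (∀ i → at d z′ i ≡ at d z (flip p i)) →
               HomTo H (Extension z) → HomTo H (Extension z′)
    transfer p z z′ e = hom-map {H = H} {Φ = Extension z} {Ψ = Extension z′} π λ δ ext → distinct-map π inj δ , move ext
      where
      π = proj₁ (symmetry p)
      inj = proj₁ (proj₂ (symmetry p))
      preserve = proj₁ (proj₂ (proj₂ (symmetry p)))
      moves = proj₂ (proj₂ (proj₂ (symmetry p)))
      move : ∀ {a b c} → Extension z a b c → Sym (Extension z′) (π a) (π b) (π c)
      move (inj₁ φ) = widen (preserve φ)
        where
        widen : ∀ {a b c} → Sym Φ a b c → Sym (Extension z′) a b c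
        widen (base φ)   = base (inj₁ φ)
        widen (swap₁₂ s) = swap₁₂ (widen s)
        widen (swap₂₃ s) = swap₂₃ (widen s)
      move (inj₂ (i , on , refl , refl , refl)) = base (inj₂ (flip p i ,
        trans (e (flip p i)) (trans (cong (at d z) (flip-involutive p i)) on) , moves i))
    invariant : ∀ p z z′ → (∀ i → at d z′ i ≡ at d z (flip p i)) → g z ≡ g z′
    invariant p z z′ e = does-⇔ (mk⇔
        (λ hom → hom-input {H = H} z′ (transfer p z z′ e (input-hom {H = H} z hom)))
        (λ hom → hom-input {H = H} z (transfer p z′ z e′ (input-hom {H = H} z′ hom))))
      (hom? H (decode n (input z))) (hom? H (decode n (input z′)))
      where
      e′ : ∀ i → at d z i ≡ at d z′ (flip p i)
      e′ i = trans (cong (at d z) (sym (flip-involutive p i))) (sym (e (flip p i)))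
    f-odd : xorSum (cube (dim d)) g ≡ true
    f-odd = trans (invariant-parity d g invariant) (cong₂ _xor_ g-empty g-full)

-- Boxes as orbits of triples

front : ∀ m {n} → Vec Bool (m ℕ.+ n) → Vec Bool m
front zero    i       = []
front (suc m) (b ∷ i) = b ∷ front m i

back : ∀ m {n} → Vec Bool (m ℕ.+ n) → Vec Bool n
back zero    i       = i
back (suc m) (b ∷ i) = back m i

front-back-injective : ∀ m {n} (i i′ : Vec Bool (m ℕ.+ n)) →
                       front m i ≡ front m i′ → back m i ≡ back m i′ → i ≡ i′
front-back-injective zero    i       i′        _ e  = e
front-back-injective (suc m) (b ∷ i) (b′ ∷ i′) e e′ = cong₂ _∷_ (cong Vec.head e)
  (front-back-injective m i i′ (cong Vec.tail e) e′)

front-back : ∀ m {n} (u : Vec Bool m) (w : Vec Bool n) →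
             ∃[ i ] (front m i ≡ u × back m i ≡ w)
front-back zero    []      w = w , refl , refl
front-back (suc m) (b ∷ u) w = let i , e , e′ = front-back m u w in b ∷ i , cong (b ∷_) e , e′

flip-split : ∀ m {n} (p : Fin (m ℕ.+ n)) →
  (∃[ s ] ∀ i → front m (flip p i) ≡ flip s (front m i) × back m (flip p i) ≡ back m i) ⊎
  (∃[ s ] ∀ i → front m (flip p i) ≡ front m i × back m (flip p i) ≡ flip s (back m i))
flip-split zero    p       = inj₂ (p , λ i → refl , refl)
flip-split (suc m) zero    = inj₁ (zero , λ { (b ∷ i) → refl , refl })
flip-split (suc m) (suc p) with flip-split m p
... | inj₁ (s , h) = inj₁ (suc s , λ { (b ∷ i) → cong (b ∷_) (proj₁ (h i)) , proj₂ (h i) })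
... | inj₂ (s , h) = inj₂ (s , λ { (b ∷ i) → cong (b ∷_) (proj₁ (h i)) , proj₂ (h i) })

module _ {V : Set} where

  -- The index of a triple in a box concatenates the indices of its three vertices, so one bit flip
  -- moves a single side. The symmetry of the base realising it must flip that side and leave the
  -- other two, the `fixed` vertices, in place.
  record Mover (Φ : V → V → V → Set) {p : ℕ} (x : Vec Bool p → V) (fixed : V → Set) : Set where
    field
      π         : Fin p → V → V
      injective : ∀ s {u v} → π s u ≡ π s v → u ≡ v
      preserves : ∀ s {a b c} → Φ a b c → Sym Φ (π s a) (π s b) (π s c)
      moves     : ∀ s i → π s (x i) ≡ x (flip s i)
      fixes     : ∀ s {v} → fixed v → π s v ≡ v

  Image : {p : ℕ} → (Vec Bool p → V) → V → Set
  Image x v = ∃[ i ] v ≡ x i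

module Box {n T : ℕ} (H : Hypergraph n) (computes : ComputableWith T f[ H ])
  {V : Set} (j : V → Fin n) (r : Fin n → V) (r∘j : ∀ v → r (j v) ≡ v)
  (Φ : V → V → V → Set) (Φ? : ∀ a b c → Dec (Φ a b c))
  {p q t : ℕ} (x : Vec Bool p → V) (y : Vec Bool q → V) (z : Vec Bool t → V) where

  private
    κ : Vec Bool (p ℕ.+ (q ℕ.+ t)) → V × V × V
    κ i = x (front p i) , y (front q (back p i)) , z (back q (back p i))

  open Extensions j r r∘j Φ Φ? κ using (κ₁; κ₂; κ₃)
  open Orbit H computes j r r∘j Φ Φ? κ

  WithBox : V → V → V → Set
  WithBox a b c = Φ a b c ⊎ (Image x a × Image y b × Image z c)

  box-step :
    (∀ {i i′} → x i ≡ x i′ → i ≡ i′) → (∀ {i i′} → y i ≡ y i′ → i ≡ i′) → (∀ {i i′} → z i ≡ z i′ → i ≡ i′) →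
    (∀ i i′ → x i ≢ y i′) → (∀ i i′ → x i ≢ z i′) → (∀ i i′ → y i ≢ z i′) →
    Mover Φ x (λ v → Image y v ⊎ Image z v) → Mover Φ y (λ v → Image x v ⊎ Image z v) →
    Mover Φ z (λ v → Image x v ⊎ Image y v) →
    ∀ s → s ℕ.* s ≤ dim (p ℕ.+ (q ℕ.+ t)) → 72 ℕ.* T < s → ¬ HomTo H Φ → ¬ HomTo H WithBox
  box-step x-inj y-inj z-inj x≢y x≢z y≢z mx my mz s s²≤ 72T<s none some =
    orbit-step (λ i → x≢y _ _ , x≢z _ _ , y≢z _ _) (λ i i′ → injective′ i i′ ∘ coordinates i i′)
      symmetry s s²≤ 72T<s none (hom-mono {H = H} (λ _ → base ∘ convert) some)
    where
    convert : ∀ {a b c} → WithBox a b c → WithOrbit a b c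
    convert (inj₁ e) = inj₁ e
    convert (inj₂ ((i₁ , refl) , (i₂ , refl) , (i₃ , refl))) =
      let k , e₂ , e₃ = front-back q i₂ i₃
          i , e₁ , e  = front-back p i₁ k
      in inj₂ (i , cong x (sym e₁) , cong y (trans (sym e₂) (cong (front q) (sym e))) ,
                   cong z (trans (sym e₃) (cong (back q) (sym e))))
    injective′ : ∀ i i′ → κ₁ i ≡ κ₁ i′ × κ₂ i ≡ κ₂ i′ × κ₃ i ≡ κ₃ i′ → i ≡ i′
    injective′ i i′ (e₁ , e₂ , e₃) = front-back-injective p i i′ (x-inj e₁)
      (front-back-injective q (back p i) (back p i′) (y-inj e₂) (z-inj e₃))
    -- The sides are pairwise disjoint, so membership in them recovers the order of a permuted
    -- triple.
    coordinates : ∀ i i′ → Sym (Matches (κ₁ i′) (κ₂ i′) (κ₃ i′)) (κ₁ i) (κ₂ i) (κ₃ i) →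
                  κ₁ i ≡ κ₁ i′ × κ₂ i ≡ κ₂ i′ × κ₃ i ≡ κ₃ i′
    coordinates i i′ s = let o₁ , o₂ , o₃ = matches-oneOf s in first o₁ , second o₂ , third o₃
      where
      first : OneOf (κ₁ i′) (κ₂ i′) (κ₃ i′) (κ₁ i) → κ₁ i ≡ κ₁ i′
      first (inj₁ e)        = e
      first (inj₂ (inj₁ e)) = contradiction e (x≢y _ _)
      first (inj₂ (inj₂ e)) = contradiction e (x≢z _ _)
      second : OneOf (κ₁ i′) (κ₂ i′) (κ₃ i′) (κ₂ i) → κ₂ i ≡ κ₂ i′
      second (inj₁ e)        = contradiction (sym e) (x≢y _ _)
      second (inj₂ (inj₁ e)) = e
      second (inj₂ (inj₂ e)) = contradiction e (y≢z _ _)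
      third : OneOf (κ₁ i′) (κ₂ i′) (κ₃ i′) (κ₃ i) → κ₃ i ≡ κ₃ i′
      third (inj₁ e)        = contradiction (sym e) (x≢z _ _)
      third (inj₂ (inj₁ e)) = contradiction (sym e) (y≢z _ _)
      third (inj₂ (inj₂ e)) = e
    symmetry : ∀ k → ∃[ π ] ((∀ {u v} → π u ≡ π v → u ≡ v) × (∀ {a b c} → Φ a b c → Sym Φ (π a) (π b) (π c)) ×
      (∀ i → π (κ₁ i) ≡ κ₁ (flip k i) × π (κ₂ i) ≡ κ₂ (flip k i) × π (κ₃ i) ≡ κ₃ (flip k i)))
    symmetry k with flip-split p k
    ... | inj₁ (s , h) = Mover.π mx s , Mover.injective mx s , Mover.preserves mx s , λ i →
          trans (Mover.moves mx s (front p i)) (cong x (sym (proj₁ (h i))))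
        , trans (Mover.fixes mx s (inj₁ (_ , refl))) (cong (y ∘ front q) (sym (proj₂ (h i))))
        , trans (Mover.fixes mx s (inj₂ (_ , refl))) (cong (z ∘ back q) (sym (proj₂ (h i))))
    ... | inj₂ (k′ , h) with flip-split q k′
    ...   | inj₁ (s , h′) = Mover.π my s , Mover.injective my s , Mover.preserves my s , λ i →
            trans (Mover.fixes my s (inj₁ (_ , refl))) (cong x (sym (proj₁ (h i))))
          , trans (Mover.moves my s _) (cong y (trans (sym (proj₁ (h′ (back p i)))) (cong (front q) (sym (proj₂ (h i))))))
          , trans (Mover.fixes my s (inj₂ (_ , refl))) (cong z (trans (sym (proj₂ (h′ (back p i)))) (cong (back q) (sym (proj₂ (h i))))))
    ...   | inj₂ (s , h′) = Mover.π mz s , Mover.injective mz s , Mover.preserves mz s , λ i →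
            trans (Mover.fixes mz s (inj₁ (_ , refl))) (cong x (sym (proj₁ (h i))))
          , trans (Mover.fixes mz s (inj₂ (_ , refl))) (cong y (trans (sym (proj₁ (h′ (back p i)))) (cong (front q) (sym (proj₂ (h i))))))
          , trans (Mover.moves mz s _) (cong z (trans (sym (proj₂ (h′ (back p i)))) (cong (back q) (sym (proj₂ (h i))))))

-- The vertex set Vec Bool a ⊎ Fin c, whose first part carries a binary tree of blocks

Agree : ∀ {a} → ℕ → Vec Bool a → Vec Bool a → Set
Agree m u v = ∀ p → m ≤ toℕ p → lookup u p ≡ lookup v p

agree? : ∀ {a} m (u v : Vec Bool a) → Dec (Agree m u v)
agree? m u v = Fin.all? λ p → (m ℕ.≤? toℕ p) →-dec (lookup u p Bool.≟ lookup v p)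

lookup-flip-same : ∀ {M} r (z : Vec Bool M) → lookup (flip r z) r ≡ not (lookup z r)
lookup-flip-same zero    (b ∷ z) = refl
lookup-flip-same (suc r) (b ∷ z) = lookup-flip-same r z

lookup-flip-cong : ∀ {M} r (u v : Vec Bool M) p → lookup u p ≡ lookup v p →
                   lookup (flip r u) p ≡ lookup (flip r v) p
lookup-flip-cong r u v p e with p Fin.≟ r
... | yes refl = trans (lookup-flip-same r u) (trans (cong not e) (sym (lookup-flip-same r v)))
... | no  p≢r  = trans (lookup-flip r u p p≢r) (trans e (sym (lookup-flip r v p p≢r)))

toggle : ∀ {a} → Bool → Fin a → Vec Bool a → Vec Bool a
toggle b s u = if b then flip s u else u

agree-toggle : ∀ {a} {m b b′} s (u v : Vec Bool a) → b ≡ b′ → Agree m u v →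
               Agree m (toggle b s u) (toggle b′ s v)
agree-toggle {b = true}  s u v refl h p m≤p = lookup-flip-cong s u v p (h p m≤p)
agree-toggle {b = false} s u v refl h       = h

lookup-toggle : ∀ {a} b s (u : Vec Bool a) p → p ≢ s → lookup (toggle b s u) p ≡ lookup u p
lookup-toggle true  s u p p≢s = lookup-flip s u p p≢s
lookup-toggle false s u p p≢s = refl

module Blocks {a c : ℕ} where

  V : Set
  V = Vec Bool a ⊎ Fin c

  -- Blocks of the tree part at level `m` have equal bits from position `m` on: single vertices at
  -- level 0, everything at the top. `Fin c` is one block at every level, and no block meets both
  -- parts.
  Block : ℕ → V → V → Set
  Block m (inj₁ u) (inj₁ v) = Agree m u v
  Block m (inj₂ _) (inj₂ _) = ⊤
  Block m _        _        = ⊥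

  module _ (l : Fin a) where

    Side : Bool → V → Set
    Side β (inj₁ u) = lookup u l ≡ β
    Side β (inj₂ _) = ⊥

    Near : Bool → ℕ → V → V → Set
    Near β m (inj₁ u) (inj₁ v) = lookup u l ≡ β × lookup v l ≡ β × Agree m u v
    Near β m _        _        = ⊥

    Low : ℕ → V → Set
    Low t (inj₁ _) = ⊥
    Low t (inj₂ k) = toℕ k < t

    -- Raising m false, m true and t in turn leads from the hypergraph of all triples with two
    -- vertices in a common l-block to one that contains all those with two in a common (l+1)-block.
    Mixed : (Bool → ℕ) → ℕ → V → V → V → Set
    Mixed m t x y z = Block (toℕ l) x y ⊎
      (∃[ β ] (Near β (m β) x y × Side (not β) z)) ⊎
      (Side false x × Side true y × Low t z)

  block? : ∀ m x y → Dec (Block m x y)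
  block? m (inj₁ u) (inj₁ v) = agree? m u v
  block? m (inj₂ _) (inj₂ _) = yes tt
  block? m (inj₁ _) (inj₂ _) = no λ ()
  block? m (inj₂ _) (inj₁ _) = no λ ()

  side? : ∀ l β x → Dec (Side l β x)
  side? l β (inj₁ u) = lookup u l Bool.≟ β
  side? l β (inj₂ _) = no λ ()

  near? : ∀ l β m x y → Dec (Near l β m x y)
  near? l β m (inj₁ u) (inj₁ v) = (lookup u l Bool.≟ β) ×-dec (lookup v l Bool.≟ β) ×-dec agree? m u v
  near? l β m (inj₁ _) (inj₂ _) = no λ ()
  near? l β m (inj₂ _) (inj₁ _) = no λ ()
  near? l β m (inj₂ _) (inj₂ _) = no λ ()

  low? : ∀ l t x → Dec (Low l t x)
  low? l t (inj₁ _) = no λ ()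
  low? l t (inj₂ k) = toℕ k ℕ.<? t

  ∃Bool? : {P : Bool → Set} → (∀ β → Dec (P β)) → Dec (∃[ β ] P β)
  ∃Bool? P? with P? false | P? true
  ... | yes p | _     = yes (false , p)
  ... | no  _ | yes p = yes (true , p)
  ... | no ¬p | no ¬q = no λ { (false , p) → ¬p p ; (true , q) → ¬q q }

  mixed? : ∀ l m t x y z → Dec (Mixed l m t x y z)
  mixed? l m t x y z = block? (toℕ l) x y ⊎-dec
    (∃Bool? (λ β → near? l β (m β) x y ×-dec side? l (not β) z)) ⊎-dec
    (side? l false x ×-dec side? l true y ×-dec low? l t z)

  -- One side of the box is cut out by conditions on the bits `l` and `j`, encoded by `C`, and bit
  -- `s` is flipped on that side alone. Vertices in a common block or near each other must be
  -- flipped together, which is what `l≤j` and `uniform` secure. Taking `s` different from `l` and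
  -- `j` makes `π s` an involution that respects the sides of bit `l`.
  module Toggles (l j : Fin a) (C : Bool → Bool → Bool) (m : Bool → ℕ) (t : ℕ)
    (l≤j : toℕ l ≤ toℕ j)
    (uniform : ∀ β (u v : Vec Bool a) → Agree (m β) u v → C β (lookup u j) ≡ C β (lookup v j)) where

    on : Vec Bool a → Bool
    on u = C (lookup u l) (lookup u j)

    π : Fin a → V → V
    π s (inj₁ u) = inj₁ (toggle (on u) s u)
    π s (inj₂ k) = inj₂ k

    module _ (s : Fin a) (l≢s : l ≢ s) (j≢s : j ≢ s) where

      π-involutive : ∀ v → π s (π s v) ≡ v
      π-involutive (inj₂ k) = refl
      π-involutive (inj₁ u) = cong inj₁ (trans (cong (λ b → toggle b s (toggle (on u) s u)) on-stable) (twice (on u)))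
        where
        on-stable : on (toggle (on u) s u) ≡ on u
        on-stable = cong₂ C (lookup-toggle (on u) s u l l≢s) (lookup-toggle (on u) s u j j≢s)
        twice : ∀ b → toggle b s (toggle b s u) ≡ u
        twice true  = flip-involutive s u
        twice false = refl

      side-π : ∀ β v → Side l β v → Side l β (π s v)
      side-π β (inj₁ u) e = trans (lookup-toggle (on u) s u l l≢s) e

      low-π : ∀ v → Low l t v → Low l t (π s v)
      low-π (inj₂ k) h = h

      block-π : ∀ x y → Block (toℕ l) x y → Block (toℕ l) (π s x) (π s y)
      block-π (inj₁ u) (inj₁ v) h = agree-toggle s u v (cong₂ C (h l ℕ.≤-refl) (h j l≤j)) h
      block-π (inj₂ _) (inj₂ _) h = tt

      near-π : ∀ β x y → Near l β (m β) x y → Near l β (m β) (π s x) (π s y)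
      near-π β (inj₁ u) (inj₁ v) (refl , e , h) =
        side-π (lookup u l) (inj₁ u) refl , side-π (lookup u l) (inj₁ v) e ,
        agree-toggle s u v (trans (uniform (lookup u l) u v h) (cong (λ b → C b (lookup v j)) (sym e))) h

      mixed-π : ∀ {x y z} → Mixed l m t x y z → Sym (Mixed l m t) (π s x) (π s y) (π s z)
      mixed-π {x} {y} {z} (inj₁ h) = base (inj₁ (block-π x y h))
      mixed-π {x} {y} {z} (inj₂ (inj₁ (β , h , h′))) =
        base (inj₂ (inj₁ (β , near-π β x y h , side-π (not β) z h′)))
      mixed-π {x} {y} {z} (inj₂ (inj₂ (h , h′ , h″))) =
        base (inj₂ (inj₂ (side-π false x h , side-π true y h′ , low-π z h″)))

    Off : V → Set
    Off (inj₁ u) = on u ≡ false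
    Off (inj₂ _) = ⊤

    mover : ∀ {p} (x : Vec Bool p → Vec Bool a) (position : Fin p → Fin a) {fixed : V → Set} →
      (∀ s → l ≢ position s) → (∀ s → j ≢ position s) → (∀ i → on (x i) ≡ true) →
      (∀ s i → flip (position s) (x i) ≡ x (flip s i)) → (∀ {v} → fixed v → Off v) →
      Mover (Mixed l m t) (inj₁ ∘ x) fixed
    mover x position {fixed} l≢ j≢ x-on x-flip off = record
      { π         = λ s → π (position s)
      ; injective = λ s → involutive⇒injective (π-involutive (position s) (l≢ s) (j≢ s))
      ; preserves = λ s → mixed-π (position s) (l≢ s) (j≢ s)
      ; moves     = λ s i → cong inj₁ (trans (cong (λ b → toggle b (position s) (x i)) (x-on i)) (x-flip s i))
      ; fixes     = λ s h → fix s (off h)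
      }
      where
      fix : ∀ s {v} → Off v → π (position s) v ≡ v
      fix s {inj₁ u} e = cong (λ b → inj₁ (toggle b (position s) u)) e
      fix s {inj₂ k} e = refl

-- The two kinds of boxes: within the tree part, and reaching into `Fin c`

eq : Bool → Bool → Bool
eq false b = not b
eq true  b = b

eq-refl : ∀ b → eq b b ≡ true
eq-refl false = refl
eq-refl true  = refl

eq-notˡ : ∀ b → eq (not b) b ≡ false
eq-notˡ false = refl
eq-notˡ true  = refl

eq-notʳ : ∀ b → eq b (not b) ≡ false
eq-notʳ false = refl
eq-notʳ true  = refl

not-fixed : ∀ b → not b ≢ b
not-fixed false ()
not-fixed true  ()

flip-insertAt : ∀ {a} (u : Vec Bool a) l b s → flip (punchIn l s) (insertAt u l b) ≡ insertAt (flip s u) l b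
flip-insertAt u       zero    b s       = refl
flip-insertAt (x ∷ u) (suc l) b zero    = refl
flip-insertAt (x ∷ u) (suc l) b (suc s) = cong (x ∷_) (flip-insertAt u l b s)

insertAt-injective : ∀ {a} (u v : Vec Bool a) l b → insertAt u l b ≡ insertAt v l b → u ≡ v
insertAt-injective u v l b e =
  trans (sym (removeAt-insertAt u l b)) (trans (cong (λ w → removeAt w l) e) (removeAt-insertAt v l b))

inserted : ∀ {a} (w : Vec Bool (suc a)) l {b} → lookup w l ≡ b → ∃[ u ] w ≡ insertAt u l b
inserted w l refl = removeAt w l , sym (insertAt-removeAt w l)

eq-≢ : ∀ {b b′} → b ≢ b′ → eq b b′ ≡ false
eq-≢ {false} {false} ne = contradiction refl ne
eq-≢ {false} {true}  ne = refl
eq-≢ {true}  {false} ne = refl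
eq-≢ {true}  {true}  ne = contradiction refl ne

-- The box takes the two halves of side `β` given by bit `j`, and the opposite side as third factor.
-- Near pairs at level `j` agree in bit `j`, so the base respects flips in one half only. A pair
-- that becomes near at level `j` + 1 either was near already or differs in bit `j` and is covered
-- by the box, which also contains pairs that differ in higher bits. Fixing two bits for the halves
-- and one for the opposite side gives the exponents `a`, `a` and `suc a`; `punchIn l j′` is a
-- position other than `l`.
module NearStep {n T : ℕ} (H : Hypergraph n) (computes : ComputableWith T f[ H ]) {a c : ℕ}
  (j₀ : Vec Bool (suc (suc a)) ⊎ Fin c → Fin n) (r₀ : Fin n → Vec Bool (suc (suc a)) ⊎ Fin c)
  (r∘j : ∀ v → r₀ (j₀ v) ≡ v)
  (l : Fin (suc (suc a))) (j′ : Fin (suc a)) (l≤j : toℕ l ≤ toℕ (punchIn l j′))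
  (β : Bool) (m m′ : Bool → ℕ) (mβ : m β ≡ toℕ (punchIn l j′))
  (m′β : m′ β ≡ suc (m β)) (m′¬β : m′ (not β) ≡ m (not β)) (t : ℕ) where

  open Blocks {suc (suc a)} {c}

  private
    j = punchIn l j′

    corner : Bool → Vec Bool a → Vec Bool (suc (suc a))
    corner e i = insertAt (insertAt i j′ e) l β

    opposite : Vec Bool (suc a) → Vec Bool (suc (suc a))
    opposite i = insertAt i l (not β)

    corner-l : ∀ e i → lookup (corner e i) l ≡ β
    corner-l e i = insertAt-lookup (insertAt i j′ e) l β

    corner-j : ∀ e i → lookup (corner e i) j ≡ e
    corner-j e i = trans (insertAt-punchIn (insertAt i j′ e) l β j′) (insertAt-lookup i j′ e)

    opposite-l : ∀ i → lookup (opposite i) l ≡ not β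
    opposite-l i = insertAt-lookup i l (not β)

    corner-injective : ∀ e {i i′} → inj₁ (corner e i) ≡ inj₁ {B = Fin c} (corner e i′) → i ≡ i′
    corner-injective e {i} {i′} refl≡ = insertAt-injective i i′ j′ e
      (insertAt-injective _ _ l β (inj₁-injective refl≡))
      where open import Data.Sum.Properties using (inj₁-injective)

    opposite-injective : ∀ {i i′} → inj₁ (opposite i) ≡ inj₁ {B = Fin c} (opposite i′) → i ≡ i′
    opposite-injective {i} {i′} e = insertAt-injective i i′ l (not β) (inj₁-injective e)
      where open import Data.Sum.Properties using (inj₁-injective)

    separate : ∀ p {u v : Vec Bool (suc (suc a))} → lookup u p ≢ lookup v p → inj₁ u ≢ inj₁ {B = Fin c} v
    separate p ne refl = ne refl

    corners-apart : ∀ i i′ → inj₁ (corner false i) ≢ inj₁ {B = Fin c} (corner true i′)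
    corners-apart i i′ = separate j λ e → contradiction (trans (sym (corner-j false i)) (trans e (corner-j true i′))) λ ()

    corner-opposite : ∀ e i i′ → inj₁ (corner e i) ≢ inj₁ {B = Fin c} (opposite i′)
    corner-opposite e i i′ = separate l λ h →
      not-fixed β (trans (sym (opposite-l i′)) (trans (sym h) (corner-l e i)))

    inCorner : Bool → Bool → Bool → Bool
    inCorner e p q = eq p β ∧ eq q e

    inCorner-uniform : ∀ e β′ (u v : Vec Bool (suc (suc a))) → Agree (m β′) u v →
                       inCorner e β′ (lookup u j) ≡ inCorner e β′ (lookup v j)
    inCorner-uniform e β′ u v h with β′ Bool.≟ β
    ... | yes refl = cong (λ q → eq β β ∧ eq q e) (h j (ℕ.≤-reflexive mβ))
    ... | no  β′≢β rewrite eq-≢ β′≢β = refl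

    module Corner (e : Bool) =
      Toggles l j (inCorner e) m t l≤j (inCorner-uniform e)
    module Opposite = Toggles l l (λ p _ → eq p (not β)) m t ℕ.≤-refl (λ _ _ _ _ → refl)

    corner-mover : ∀ e → Mover (Mixed l m t) (inj₁ ∘ corner e)
                     (λ v → Image (inj₁ ∘ corner (not e)) v ⊎ Image (inj₁ ∘ opposite) v)
    corner-mover e = Corner.mover e (corner e) (λ s → punchIn l (punchIn j′ s))
      (λ s h → Fin.punchInᵢ≢i l (punchIn j′ s) (sym h))
      (λ s h → Fin.punchInᵢ≢i j′ s (sym (Fin.punchIn-injective l j′ (punchIn j′ s) h)))
      (λ i → cong₂ _∧_ (trans (cong (λ p → eq p β) (corner-l e i)) (eq-refl β))
                       (trans (cong (λ q → eq q e) (corner-j e i)) (eq-refl e)))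
      (λ s i → trans (flip-insertAt (insertAt i j′ e) l β (punchIn j′ s))
                 (cong (λ u → insertAt u l β) (flip-insertAt i j′ e s)))
      λ { (inj₁ (i , refl)) → trans (cong (eq (lookup (corner (not e) i) l) β ∧_)
              (trans (cong (λ q → eq q e) (corner-j (not e) i)) (eq-notˡ e))) (Bool.∧-zeroʳ _)
        ; (inj₂ (i , refl)) → cong (_∧ eq (lookup (opposite i) j) e)
              (trans (cong (λ p → eq p β) (opposite-l i)) (eq-notˡ β)) }

    opposite-mover : Mover (Mixed l m t) (inj₁ ∘ opposite)
                       (λ v → Image (inj₁ ∘ corner false) v ⊎ Image (inj₁ ∘ corner true) v)
    opposite-mover = Opposite.mover opposite (punchIn l)
      (λ s h → Fin.punchInᵢ≢i l s (sym h)) (λ s h → Fin.punchInᵢ≢i l s (sym h))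
      (λ i → trans (cong (λ p → eq p (not β)) (opposite-l i)) (eq-refl (not β)))
      (λ s i → flip-insertAt i l (not β) s)
      λ { (inj₁ (i , refl)) → trans (cong (λ p → eq p (not β)) (corner-l false i)) (eq-notʳ β)
        ; (inj₂ (i , refl)) → trans (cong (λ p → eq p (not β)) (corner-l true i)) (eq-notʳ β) }

  open Box H computes j₀ r₀ r∘j (Mixed l m t) (mixed? l m t)
    (inj₁ ∘ corner false) (inj₁ ∘ corner true) (inj₁ ∘ opposite)

  near-step : ∀ s → s ℕ.* s ≤ dim (a ℕ.+ (a ℕ.+ suc a)) → 72 ℕ.* T < s →
              ¬ HomTo H (Mixed l m t) → ¬ HomTo H (Mixed l m′ t)
  near-step s s²≤ 72T<s none some =
    box-step (corner-injective false) (corner-injective true) opposite-injective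
      corners-apart (corner-opposite false) (corner-opposite true)
      (corner-mover false) (corner-mover true) opposite-mover s s²≤ 72T<s none
      (hom-mono {H = H} {Φ = Mixed l m′ t} {Ψ = WithBox} (λ _ → cover) some)
    where
    inOpposite : ∀ z → Side l (not β) z → Image (inj₁ ∘ opposite) z
    inOpposite (inj₁ w) e = let u , e′ = inserted w l e in u , cong inj₁ e′
    inCornerImage : ∀ e w → lookup w l ≡ β → lookup w j ≡ e → Image {V} (inj₁ ∘ corner e) (inj₁ w)
    inCornerImage e w el ej with inserted w l el
    ... | u , refl with inserted u j′ (trans (sym (insertAt-punchIn u l β j′)) ej)
    ...   | i , refl = i , refl
    closer : ∀ u v → lookup u j ≡ lookup v j → Agree (suc (m β)) u v → Agree (m β) u v
    closer u v ej h p mβ≤p with ℕ.m≤n⇒m<n∨m≡n mβ≤p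
    ... | inj₁ lt = h p lt
    ... | inj₂ mβ≡p rewrite Fin.toℕ-injective {i = p} {j = j} (trans (sym mβ≡p) mβ) = ej
    nearer : ∀ x y z → Near l β (suc (m β)) x y → Side l (not β) z → Sym WithBox x y z
    nearer (inj₁ u) (inj₁ v) z (eu , ev , h) hz with lookup u j in e | lookup v j in e′
    ... | false | true  = base (inj₂ (inCornerImage false u eu e , inCornerImage true v ev e′ , inOpposite z hz))
    ... | true  | false = swap₁₂ (base (inj₂ (inCornerImage false v ev e′ , inCornerImage true u eu e , inOpposite z hz)))
    ... | false | false = base (inj₁ (inj₂ (inj₁ (β , (eu , ev , closer u v (trans e (sym e′)) h) , hz))))
    ... | true  | true  = base (inj₁ (inj₂ (inj₁ (β , (eu , ev , closer u v (trans e (sym e′)) h) , hz))))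
    cover : ∀ {x y z} → Mixed l m′ t x y z → Sym WithBox x y z
    cover (inj₁ h) = base (inj₁ (inj₁ h))
    cover (inj₂ (inj₂ h)) = base (inj₁ (inj₂ (inj₂ h)))
    cover {x} {y} {z} (inj₂ (inj₁ (β′ , h , hz))) with β′ Bool.≟ β
    ... | yes refl = nearer x y z (subst (λ k → Near l β k x y) m′β h) hz
    ... | no β′≢β rewrite Bool.¬-not β′≢β =
          base (inj₁ (inj₂ (inj₁ (not β , subst (λ k → Near l (not β) k x y) m′¬β h , hz))))

-- The box takes the two sides of bit `l` and the 2^b vertices of `Fin c` from `t` on. Permuting
-- this interval preserves the base: `Fin c` is a single block, and the vertices below `t` lie
-- outside the interval and stay fixed.
module LowStep {n T : ℕ} (H : Hypergraph n) (computes : ComputableWith T f[ H ]) {a c : ℕ}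
  (j₀ : Vec Bool (suc a) ⊎ Fin c → Fin n) (r₀ : Fin n → Vec Bool (suc a) ⊎ Fin c)
  (r∘j : ∀ v → r₀ (j₀ v) ≡ v) (l : Fin (suc a)) (m : Bool → ℕ)
  (b t : ℕ) (t+≤c : t ℕ.+ dim b ≤ c) where

  open Blocks {suc a} {c}

  private
    half : Bool → Vec Bool a → Vec Bool (suc a)
    half β i = insertAt i l β

    half-l : ∀ β i → lookup (half β i) l ≡ β
    half-l β i = insertAt-lookup i l β

    half-injective : ∀ β {i i′} → inj₁ (half β i) ≡ inj₁ {B = Fin c} (half β i′) → i ≡ i′
    half-injective β {i} {i′} e = insertAt-injective i i′ l β (inj₁-injective e)

    halves-apart : ∀ i i′ → inj₁ (half false i) ≢ inj₁ {B = Fin c} (half true i′)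
    halves-apart i i′ e = contradiction
      (trans (sym (half-l false i)) (trans (cong (λ u → lookup u l) (inj₁-injective e)) (half-l true i′))) λ ()

    bounded : ∀ (k : Fin (dim b)) → t ℕ.+ toℕ k < c
    bounded k = ℕ.<-≤-trans (ℕ.+-monoʳ-< t (Fin.toℕ<n k)) t+≤c

    interval : Vec Bool b → Fin c
    interval i = Fin.fromℕ< (bounded (encode i))

    toℕ-interval : ∀ i → toℕ (interval i) ≡ t ℕ.+ toℕ (encode i)
    toℕ-interval i = Fin.toℕ-fromℕ< (bounded (encode i))

    interval-injective : ∀ {i i′} → interval i ≡ interval i′ → i ≡ i′
    interval-injective {i} {i′} e = trans (sym (decode-encode i)) (trans (cong decodeBits
      (Fin.toℕ-injective (ℕ.+-cancelˡ-≡ t _ _ (trans (sym (toℕ-interval i)) (trans (cong toℕ e) (toℕ-interval i′))))))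
      (decode-encode i′))

    module Half (β : Bool) =
      Toggles l l (λ p _ → eq p β) m t ℕ.≤-refl (λ _ _ _ _ → refl)

    half-mover : ∀ β → Mover (Mixed l m t) (inj₁ ∘ half β)
                   (λ v → Image (inj₁ ∘ half (not β)) v ⊎ Image (inj₂ ∘ interval) v)
    half-mover β = Half.mover β (half β) (punchIn l)
      (λ s h → Fin.punchInᵢ≢i l s (sym h)) (λ s h → Fin.punchInᵢ≢i l s (sym h))
      (λ i → trans (cong (λ p → eq p β) (half-l β i)) (eq-refl β))
      (λ s i → flip-insertAt i l β s)
      λ { (inj₁ (i , refl)) → trans (cong (λ p → eq p β) (half-l (not β) i)) (eq-notˡ β)
        ; (inj₂ (i , refl)) → tt }

    position? : ∀ k → Dec (∃[ i ] interval (decodeBits i) ≡ k)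
    position? k = Fin.any? λ i → interval (decodeBits i) Fin.≟ k

    shift : ∀ (s : Fin b) k → Dec (∃[ i ] interval (decodeBits i) ≡ k) → Fin c
    shift s k (yes (i , _)) = interval (flip s (decodeBits i))
    shift s k (no _)        = k

    shift-interval : ∀ s i d → shift s (interval i) d ≡ interval (flip s i)
    shift-interval s i (yes (i′ , e)) = cong (interval ∘ flip s) (interval-injective e)
    shift-interval s i (no ∄) = contradiction (encode i , cong interval (decode-encode i)) ∄

    shift-involutive : ∀ s k d d′ → shift s (shift s k d) d′ ≡ k
    shift-involutive s k (yes (i , e)) d′ = trans (shift-interval s (flip s (decodeBits i)) d′)
      (trans (cong interval (flip-involutive s (decodeBits i))) e)
    shift-involutive s k (no ∄) (yes (i , e)) = contradiction (i , e) ∄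
    shift-involutive s k (no ∄) (no _) = refl

    shift-low : ∀ s k d → toℕ k < t → toℕ (shift s k d) < t
    shift-low s k (yes (i , refl)) k<t = contradiction
      (ℕ.≤-trans (ℕ.m≤m+n t _) (ℕ.≤-reflexive (sym (toℕ-interval (decodeBits i))))) (ℕ.<⇒≱ k<t)
    shift-low s k (no _) k<t = k<t

    π : Fin b → V → V
    π s (inj₁ u) = inj₁ u
    π s (inj₂ k) = inj₂ (shift s k (position? k))

    mixed-π : ∀ s {x y z} → Mixed l m t x y z → Mixed l m t (π s x) (π s y) (π s z)
    mixed-π s {x} {y} {z} (inj₁ h) = inj₁ (block x y h)
      where
      block : ∀ x y → Block (toℕ l) x y → Block (toℕ l) (π s x) (π s y)
      block (inj₁ _) (inj₁ _) h = h
      block (inj₂ _) (inj₂ _) h = tt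
    mixed-π s {x} {y} {z} (inj₂ h) = inj₂ (rest x y z h)
      where
      rest : ∀ x y z →
        (∃[ β ] (Near l β (m β) x y × Side l (not β) z)) ⊎ (Side l false x × Side l true y × Low l t z) →
        (∃[ β ] (Near l β (m β) (π s x) (π s y) × Side l (not β) (π s z))) ⊎
        (Side l false (π s x) × Side l true (π s y) × Low l t (π s z))
      rest (inj₁ _) (inj₁ _) (inj₁ _) (inj₁ h) = inj₁ h
      rest (inj₁ _) (inj₁ _) (inj₂ k) (inj₂ (h , h′ , k<t)) =
        inj₂ (h , h′ , shift-low s k (position? k) k<t)

    interval-mover : Mover (Mixed l m t) (inj₂ ∘ interval)
                       (λ v → Image (inj₁ ∘ half false) v ⊎ Image (inj₁ ∘ half true) v)
    interval-mover = record
      { π         = π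
      ; injective = λ s → involutive⇒injective (involutive s)
      ; preserves = λ s h → base (mixed-π s h)
      ; moves     = λ s i → cong inj₂ (shift-interval s i (position? (interval i)))
      ; fixes     = λ { s (inj₁ (_ , refl)) → refl ; s (inj₂ (_ , refl)) → refl }
      }
      where
      involutive : ∀ s v → π s (π s v) ≡ v
      involutive s (inj₁ u) = refl
      involutive s (inj₂ k) = cong inj₂ (shift-involutive s k (position? k) (position? _))

  open Box H computes j₀ r₀ r∘j (Mixed l m t) (mixed? l m t)
    (inj₁ ∘ half false) (inj₁ ∘ half true) (inj₂ ∘ interval)

  low-step : ∀ s → s ℕ.* s ≤ dim (a ℕ.+ (a ℕ.+ b)) → 72 ℕ.* T < s →
             ¬ HomTo H (Mixed l m t) → ¬ HomTo H (Mixed l m (t ℕ.+ dim b))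
  low-step s s²≤ 72T<s none some =
    box-step (half-injective false) (half-injective true) (λ e → interval-injective (inj₂-injective e))
      halves-apart (λ _ _ ()) (λ _ _ ())
      (half-mover false) (half-mover true) interval-mover s s²≤ 72T<s none
      (hom-mono {H = H} {Φ = Mixed l m (t ℕ.+ dim b)} {Ψ = WithBox} (λ _ → cover) some)
    where
    inHalf : ∀ β x → Side l β x → Image (inj₁ ∘ half β) x
    inHalf β (inj₁ u) e = let i , e′ = inserted u l e in i , cong inj₁ e′
    inInterval : ∀ k → t ≤ toℕ k → toℕ k < t ℕ.+ dim b → Image {V} (inj₂ ∘ interval) (inj₂ k)
    inInterval k t≤k k<t+ = decodeBits i , cong inj₂ (Fin.toℕ-injective (sym (begin
      toℕ (interval (decodeBits i))       ≡⟨ toℕ-interval (decodeBits i) ⟩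
      t ℕ.+ toℕ (encode (decodeBits {b} i)) ≡⟨ cong (λ i → t ℕ.+ toℕ i) (encode-decode {b} i) ⟩
      t ℕ.+ toℕ i                         ≡⟨ cong (t ℕ.+_) (Fin.toℕ-fromℕ< k∸t<) ⟩
      t ℕ.+ (toℕ k ∸ t)                   ≡⟨ ℕ.m+[n∸m]≡n t≤k ⟩
      toℕ k                               ∎)))
      where
      open ≡-Reasoning
      k∸t< : toℕ k ∸ t < dim b
      k∸t< = ℕ.+-cancelˡ-< t _ _ (subst (_< t ℕ.+ dim b) (sym (ℕ.m+[n∸m]≡n t≤k)) k<t+)
      i = Fin.fromℕ< k∸t<
    last : ∀ x y z → Side l false x → Side l true y → Low l (t ℕ.+ dim b) z → Sym WithBox x y z
    last x y (inj₂ k) hx hy k<t+ = choose (ℕ.<-≤-connex (toℕ k) t)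
      where
      choose : toℕ k < t ⊎ t ≤ toℕ k → Sym WithBox x y (inj₂ k)
      choose (inj₁ k<t) = base (inj₁ (inj₂ (inj₂ (hx , hy , k<t))))
      choose (inj₂ t≤k) = base (inj₂ (inHalf false x hx , inHalf true y hy , inInterval k t≤k k<t+))
    cover : ∀ {x y z} → Mixed l m (t ℕ.+ dim b) x y z → Sym WithBox x y z
    cover (inj₁ h)        = base (inj₁ (inj₁ h))
    cover (inj₂ (inj₁ h)) = base (inj₁ (inj₂ (inj₁ h)))
    cover {x} {y} {z} (inj₂ (inj₂ (hx , hy , hz))) = last x y z hx hy hz

-- From one block level to the next

sides : ℕ → ℕ → Bool → ℕ
sides p q false = p
sides p q true  = q

lookup-injective : ∀ {a} (u v : Vec Bool a) → (∀ p → lookup u p ≡ lookup v p) → u ≡ v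
lookup-injective []      []      h = refl
lookup-injective (x ∷ u) (y ∷ v) h = cong₂ _∷_ (h zero) (lookup-injective u v (h ∘ suc))

-- A homomorphism to the complete hypergraph on `k` vertices: three different colours on every
-- hyperedge.
Colourable : ∀ {n} → Hypergraph n → ℕ → Set
Colourable H k = HomTo H {Fin k} λ _ _ _ → ⊤

colourable-mono : ∀ {n} {H : Hypergraph n} {k l} → k ≤ l → Colourable H k → Colourable H l
colourable-mono {H = H} k≤l = hom-map {H = H} (λ i → Fin.inject≤ i k≤l) λ δ _ →
  distinct-map (λ i → Fin.inject≤ i k≤l) (Fin.inject≤-injective k≤l k≤l _ _) δ , base tt

module Chain {n T : ℕ} (H : Hypergraph n) (computes : ComputableWith T f[ H ]) {a c : ℕ}
  (j₀ : Vec Bool (suc a) ⊎ Fin c → Fin n) (r₀ : Fin n → Vec Bool (suc a) ⊎ Fin c)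
  (r∘j : ∀ v → r₀ (j₀ v) ≡ v) (b s : ℕ) (72T<s : 72 ℕ.* T < s)
  (low-size : s ℕ.* s ≤ dim (a ℕ.+ (a ℕ.+ b))) (room : 0 < c → dim b ≤ c) where

  open Blocks {suc a} {c}

  InBlock : ℕ → V → V → V → Set
  InBlock m x y z = Block m x y

  low-chain : ∀ l m t → t ≤ c → ¬ HomTo H (Mixed l m 0) → ¬ HomTo H (Mixed l m t)
  low-chain l m zero    _   none = none
  low-chain l m (suc t) t<c none some =
    LowStep.low-step H computes j₀ r₀ r∘j l m b t′ t′+≤c s low-size 72T<s
      (λ hom → low-chain l m t (ℕ.<⇒≤ t<c) none (widen t′≤t hom))
      (widen t<t′+ some)
    where
    -- The interval added has the fixed length `dim b`, so that the box is always large enough. It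
    -- ends at `suc t`, overlapping what is already there, or starts at 0 if `suc t` is smaller than
    -- its length; then `room` keeps it inside `Fin c`.
    t′ = suc t ∸ dim b
    t′≤t : t′ ≤ t
    t′≤t = ℕ.∸-monoʳ-≤ (suc t) (dim-positive b)
    t<t′+ : suc t ≤ t′ ℕ.+ dim b
    t<t′+ = subst (suc t ≤_) (ℕ.+-comm (dim b) t′) (ℕ.m≤n+m∸n (suc t) (dim b))
    t′+≤c : t′ ℕ.+ dim b ≤ c
    t′+≤c with ℕ.≤-total (suc t) (dim b)
    ... | inj₁ small rewrite ℕ.m≤n⇒m∸n≡0 small = room (ℕ.≤-trans (s≤s z≤n) t<c)
    ... | inj₂ large rewrite ℕ.m∸n+n≡m large = t<c
    low-mono : ∀ {p q} z → p ≤ q → Low l p z → Low l q z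
    low-mono (inj₂ k) p≤q h = ℕ.<-≤-trans h p≤q
    widen : ∀ {p q} → p ≤ q → HomTo H (Mixed l m p) → HomTo H (Mixed l m q)
    widen {p} {q} p≤q = hom-mono {H = H} {Φ = Mixed l m p} {Ψ = Mixed l m q} λ
      { _ (inj₁ h) → base (inj₁ h)
      ; _ (inj₂ (inj₁ h)) → base (inj₂ (inj₁ h))
      ; {c = z} _ (inj₂ (inj₂ (h , h′ , h″))) → base (inj₂ (inj₂ (h , h′ , low-mono z p≤q h″))) }

  -- Two vertices of the tree part in a common block of level 0 are equal, so a hyperedge has at
  -- most one vertex in the tree part, and the whole part can share one colour.
  bottom : HomTo H (InBlock 0) → Colourable H (suc c)
  bottom = hom-map {H = H} {Φ = InBlock 0} φ λ {x} {y} {z} δ h → image x y z δ h , base tt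
    where
    φ : V → Fin (suc c)
    φ (inj₁ _) = zero
    φ (inj₂ k) = suc k
    φ-suc : ∀ {k k′} → inj₂ {A = Vec Bool (suc a)} k ≢ inj₂ k′ → suc k ≢ suc k′
    φ-suc ne refl = ne refl
    image : ∀ x y z → Distinct x y z → Block 0 x y → Distinct (φ x) (φ y) (φ z)
    image (inj₁ u) (inj₁ v) z (xy , _) h =
      contradiction (cong inj₁ (lookup-injective u v λ p → h p z≤n)) xy
    image (inj₂ k) (inj₂ k′) (inj₁ w) (xy , _) h = φ-suc xy , (λ ()) , λ ()
    image (inj₂ k) (inj₂ k′) (inj₂ k″) (xy , xz , yz) h = φ-suc xy , φ-suc xz , φ-suc yz

  -- Pigeonhole: two of three vertices lie in the same part, and at this level each part is a single
  -- block.
  top : ∀ x y z → Sym (InBlock (suc a)) x y z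
  top (inj₁ u) (inj₁ v) z        = base λ p a<p → contradiction (Fin.toℕ<n p) (ℕ.≤⇒≯ a<p)
  top (inj₂ _) (inj₂ _) z        = base tt
  top (inj₁ u) (inj₂ _) (inj₁ w) = swap₂₃ (base λ p a<p → contradiction (Fin.toℕ<n p) (ℕ.≤⇒≯ a<p))
  top (inj₁ u) (inj₂ _) (inj₂ _) = swap₁₂ (swap₂₃ (base tt))
  top (inj₂ _) (inj₁ v) (inj₁ w) =
    swap₁₂ (swap₂₃ (base λ p a<p → contradiction (Fin.toℕ<n p) (ℕ.≤⇒≯ a<p)))
  top (inj₂ _) (inj₁ v) (inj₂ _) = swap₂₃ (base tt)

  deeper : ∀ l (u v : Vec Bool (suc a)) → lookup u l ≡ lookup v l → Agree (suc (toℕ l)) u v → Agree (toℕ l) u v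
  deeper l u v e h p l≤p with ℕ.m≤n⇒m<n∨m≡n l≤p
  ... | inj₁ l<p = h p l<p
  ... | inj₂ l≡p = subst (λ q → lookup u q ≡ lookup v q) (Fin.toℕ-injective l≡p) e

  -- Vertices on the same side of bit `l` that agree in all higher bits form an l-block, and no
  -- vertex is below 0, so these levels add nothing yet.
  start : ∀ l → HomTo H (Mixed l (sides (suc (toℕ l)) (suc (toℕ l))) 0) → HomTo H (InBlock (toℕ l))
  start l = hom-mono {H = H} {Φ = Mixed l (sides (suc (toℕ l)) (suc (toℕ l))) 0} {Ψ = InBlock (toℕ l)}
    λ {x} {y} {z} _ → shrink x y z
    where
    same-block : ∀ β x y → Near l β (suc (toℕ l)) x y → Block (toℕ l) x y
    same-block β (inj₁ u) (inj₁ v) (e , e′ , h) = deeper l u v (trans e (sym e′)) h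
    shrink : ∀ x y z → Mixed l (sides (suc (toℕ l)) (suc (toℕ l))) 0 x y z → Sym (InBlock (toℕ l)) x y z
    shrink x y z (inj₁ h) = base h
    shrink x y z (inj₂ (inj₁ (false , h , _))) = base (same-block false x y h)
    shrink x y z (inj₂ (inj₁ (true  , h , _))) = base (same-block true x y h)
    shrink x y (inj₂ k) (inj₂ (inj₂ (_ , _ , ())))
    shrink x y (inj₁ w) (inj₂ (inj₂ (_ , _ , ())))

  -- Two vertices of an (l+1)-block that are not in one l-block lie on opposite sides of bit `l`. A
  -- third vertex in the tree part shares its side with one of them, and at level `suc a` that pair
  -- counts as near; a third vertex in `Fin c` is below `c`.
  finish : ∀ l → HomTo H (InBlock (suc (toℕ l))) → HomTo H (Mixed l (sides (suc a) (suc a)) c)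
  finish l = hom-mono {H = H} {Φ = InBlock (suc (toℕ l))} {Ψ = Mixed l (sides (suc a) (suc a)) c}
    λ {x} {y} {z} _ → grow x y z
    where
    M = sides (suc a) (suc a)
    vacuous : ∀ β (u v : Vec Bool (suc a)) → Agree (M β) u v
    vacuous false u v p a<p = contradiction (Fin.toℕ<n p) (ℕ.≤⇒≯ a<p)
    vacuous true  u v p a<p = contradiction (Fin.toℕ<n p) (ℕ.≤⇒≯ a<p)
    across : ∀ u v z → lookup u l ≡ false → lookup v l ≡ true → Sym (Mixed l M c) (inj₁ u) (inj₁ v) z
    across u v (inj₂ k) e e′ = base (inj₂ (inj₂ (e , e′ , Fin.toℕ<n k)))
    across u v (inj₁ w) e e′ with lookup w l in e″
    ... | false = swap₂₃ (base (inj₂ (inj₁ (false , (e , e″ , vacuous false u w) , e′))))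
    ... | true  = swap₁₂ (swap₂₃ (base (inj₂ (inj₁ (true , (e′ , e″ , vacuous true v w) , e)))))
    grow : ∀ x y z → Block (suc (toℕ l)) x y → Sym (Mixed l M c) x y z
    grow (inj₂ _) (inj₂ _) z h = base (inj₁ tt)
    grow (inj₁ u) (inj₁ v) z h with lookup u l in e | lookup v l in e′
    ... | false | true  = across u v z e e′
    ... | true  | false = swap₁₂ (across v u z e′ e)
    ... | false | false = base (inj₁ (deeper l u v (trans e (sym e′)) h))
    ... | true  | true  = base (inj₁ (deeper l u v (trans e (sym e′)) h))

-- `M` is a path of levels that raises side `β` by one per step and keeps the other side fixed, so
-- that one statement serves both sides.
near-chain : ∀ {n T} (H : Hypergraph n) (computes : ComputableWith T f[ H ]) {a c}
  (j₀ : Vec Bool (suc a) ⊎ Fin c → Fin n) (r₀ : Fin n → Vec Bool (suc a) ⊎ Fin c)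
  (r∘j : ∀ v → r₀ (j₀ v) ≡ v) (s : ℕ) (72T<s : 72 ℕ.* T < s)
  (near-size : ∀ a′ → a ≡ suc a′ → s ℕ.* s ≤ dim (a′ ℕ.+ (a′ ℕ.+ suc a′))) →
  ∀ l β (M : ℕ → Bool → ℕ) → (∀ k → M k β ≡ k) → (∀ k → M (suc k) (not β) ≡ M k (not β)) →
  ∀ t k → toℕ l < k → k ≤ suc a →
  ¬ HomTo H (Blocks.Mixed {suc a} {c} l (M (suc (toℕ l))) t) → ¬ HomTo H (Blocks.Mixed {suc a} {c} l (M k) t)
-- With a single bit there is nothing to raise: `l` is 0 and `k` is 1. A `NearStep` needs a second
-- bit.
near-chain H computes {zero} {c} j₀ r₀ r∘j s 72T<s near-size zero β M Mβ M¬β t k 0<k k≤1 none =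
  subst (λ k → ¬ HomTo H (Blocks.Mixed {1} {c} zero (M k) t)) (ℕ.≤-antisym 0<k k≤1) none
near-chain H computes {suc a} {c} j₀ r₀ r∘j s 72T<s near-size l β M Mβ M¬β t = go
  where
  open Blocks {suc (suc a)} {c} using (Mixed)
  go : ∀ k → toℕ l < k → k ≤ suc (suc a) →
    ¬ HomTo H (Mixed l (M (suc (toℕ l))) t) → ¬ HomTo H (Mixed l (M k) t)
  go (suc k) (s≤s l≤k) k<a none = step (ℕ.m≤n⇒m<n∨m≡n l≤k)
    where
    step : toℕ l < k ⊎ toℕ l ≡ k → ¬ HomTo H (Mixed l (M (suc k)) t)
    step (inj₂ l≡k) = subst (λ k → ¬ HomTo H (Mixed l (M (suc k)) t)) l≡k none
    step (inj₁ l<k) = NearStep.near-step H computes j₀ r₀ r∘j l (punchOut l≢j)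
        (subst (λ i → toℕ l ≤ toℕ i) (sym j≡) (subst (toℕ l ≤_) (sym toℕ-j) l≤k)) β (M k) (M (suc k))
        (trans (Mβ k) (trans (sym toℕ-j) (cong toℕ (sym j≡))))
        (trans (Mβ (suc k)) (cong suc (sym (Mβ k)))) (M¬β k) t
        s (near-size a refl) 72T<s (go k l<k (ℕ.<⇒≤ k<a) none)
      where
      j : Fin (suc (suc a))
      j = Fin.fromℕ< k<a
      toℕ-j : toℕ j ≡ k
      toℕ-j = Fin.toℕ-fromℕ< k<a
      l≢j : l ≢ j
      l≢j l≡j = ℕ.<-irrefl (trans (cong toℕ l≡j) toℕ-j) l<k
      j≡ : punchIn l (punchOut l≢j) ≡ j
      j≡ = Fin.punchIn-punchOut l≢j

-- Vertices as numbers, and the ascent from one clique to a larger one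

vertex : ∀ {a c} → Fin (dim a ℕ.+ c) → Vec Bool a ⊎ Fin c
vertex {a} i = Data.Sum.map₁ decodeBits (Fin.splitAt (dim a) i)

vertexIndex : ∀ {a c} → Vec Bool a ⊎ Fin c → Fin (dim a ℕ.+ c)
vertexIndex {a} {c} v = Fin.join (dim a) c (Data.Sum.map₁ encode v)

vertex-index : ∀ {a c} (v : Vec Bool a ⊎ Fin c) → vertex (vertexIndex v) ≡ v
vertex-index {a} {c} (inj₁ u) =
  trans (cong (Data.Sum.map₁ decodeBits) (Fin.splitAt-↑ˡ (dim a) (encode u) c)) (cong inj₁ (decode-encode u))
vertex-index {a} {c} (inj₂ k) = cong (Data.Sum.map₁ decodeBits) (Fin.splitAt-↑ʳ (dim a) c k)

index-vertex : ∀ {a c} (i : Fin (dim a ℕ.+ c)) → vertexIndex (vertex {a} {c} i) ≡ i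
index-vertex {a} {c} i = trans (cong (Fin.join (dim a) c) (unmap (Fin.splitAt (dim a) i)))
  (Fin.join-splitAt (dim a) c i)
  where
  unmap : ∀ v → Data.Sum.map₁ encode (Data.Sum.map₁ (decodeBits {a}) v) ≡ v
  unmap (inj₁ k) = cong inj₁ (encode-decode {a} k)
  unmap (inj₂ k) = refl

module Ascent {n T : ℕ} (H : Hypergraph n) (computes : ComputableWith T f[ H ]) {a c : ℕ}
  (j₀ : Vec Bool (suc a) ⊎ Fin c → Fin n) (r₀ : Fin n → Vec Bool (suc a) ⊎ Fin c)
  (r∘j : ∀ v → r₀ (j₀ v) ≡ v) (b s : ℕ) (72T<s : 72 ℕ.* T < s)
  (near-size : ∀ a′ → a ≡ suc a′ → s ℕ.* s ≤ dim (a′ ℕ.+ (a′ ℕ.+ suc a′)))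
  (low-size : s ℕ.* s ≤ dim (a ℕ.+ (a ℕ.+ b))) (room : 0 < c → dim b ≤ c) where

  open Blocks {suc a} {c}
  open Chain H computes j₀ r₀ r∘j b s 72T<s low-size room

  -- To be read inside out: side `false` is raised first, then side `true`, and last the range of
  -- vertices of `Fin c`.
  level : ∀ l → ¬ HomTo H (InBlock (toℕ l)) → ¬ HomTo H (InBlock (suc (toℕ l)))
  level l none some = low-chain l (sides (suc a) (suc a)) c ℕ.≤-refl
    (raise true (sides (suc a)) (λ _ → refl) (λ _ → refl)
      (raise false (λ k → sides k (suc (toℕ l))) (λ _ → refl) (λ _ → refl) (none ∘ start l)))
    (finish l some)
    where
    raise : ∀ β (M : ℕ → Bool → ℕ) → (∀ k → M k β ≡ k) → (∀ k → M (suc k) (not β) ≡ M k (not β)) →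
      ¬ HomTo H (Mixed l (M (suc (toℕ l))) 0) → ¬ HomTo H (Mixed l (M (suc a)) 0)
    raise β M e e′ = near-chain H computes j₀ r₀ r∘j s 72T<s near-size l β M e e′ 0 (suc a)
      (Fin.toℕ<n l) ℕ.≤-refl

  levels : ∀ m → m ≤ suc a → ¬ HomTo H (InBlock 0) → ¬ HomTo H (InBlock m)
  levels zero    _   none = none
  levels (suc m) m<a none = subst (λ m → ¬ HomTo H (InBlock (suc m))) (Fin.toℕ-fromℕ< m<a)
    (level (Fin.fromℕ< m<a) (subst (λ m → ¬ HomTo H (InBlock m)) (sym (Fin.toℕ-fromℕ< m<a))
      (levels m (ℕ.<⇒≤ m<a) none)))

  ascent : ¬ Colourable H (suc c) → ¬ Colourable H (dim (suc a) ℕ.+ c)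
  ascent none some = levels (suc a) ℕ.≤-refl (none ∘ bottom)
    (hom-map {H = H} {Ψ = InBlock (suc a)} vertex
      (λ {x} {y} {z} δ _ → distinct-map vertex (λ {i} {i′} e → trans (sym (index-vertex {suc a} {c} i)) (trans (cong vertexIndex e) (index-vertex {suc a} {c} i′))) δ , top _ _ _) some)

-- The lower bound

restrict : ∀ {a c n} (i : Fin n) → Dec (toℕ i < dim a ℕ.+ c) → Vec Bool a ⊎ Fin c
restrict {a} i (yes i<) = vertex (Fin.fromℕ< i<)
-- An arbitrary default: vertices from `dim a + c` on lie on no hyperedge of the inputs.
restrict {a} i (no _)   = inj₁ (Vec.replicate a false)

restrict-inject : ∀ {a c n} (h : dim a ℕ.+ c ≤ n) (v : Vec Bool a ⊎ Fin c) d →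
                  restrict (Fin.inject≤ (vertexIndex v) h) d ≡ v
restrict-inject {a} {c} h v (yes i<) = trans (cong vertex (Fin.toℕ-injective
  (trans (Fin.toℕ-fromℕ< i<) (Fin.toℕ-inject≤ (vertexIndex v) h)))) (vertex-index v)
restrict-inject {a} {c} h v (no i≮) = contradiction
  (subst (_< dim a ℕ.+ c) (sym (Fin.toℕ-inject≤ (vertexIndex v) h)) (Fin.toℕ<n (vertexIndex v))) i≮

dim-+ : ∀ m n → dim (m ℕ.+ n) ≡ dim m ℕ.* dim n
dim-+ zero    n = sym (ℕ.+-identityʳ (dim n))
dim-+ (suc m) n = trans (cong₂ ℕ._+_ (dim-+ m n) (dim-+ m n)) (sym (ℕ.*-distribʳ-+ (dim n) (dim m) (dim m)))

dim-mono : ∀ {m n} → m ≤ n → dim m ≤ dim n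
dim-mono {n = n} z≤n = dim-positive n
dim-mono (s≤s m≤n)   = ℕ.+-mono-≤ (dim-mono m≤n) (dim-mono m≤n)

-- The binary logarithm of the size of the box in `NearStep` when the tree part has `suc a` bits.
-- The box of `LowStep` with `b = a` is at least as large. At 0 there is no `NearStep`.
exponent : ℕ → ℕ
exponent zero    = 0
exponent (suc a) = a ℕ.+ (a ℕ.+ suc a)

identity-colouring : ∀ {n} (H : Hypergraph n) → Colourable H n
identity-colouring H = id , λ u v w e → distinct-triple (proj₁ e) , base tt

edge⇒¬colourable : ∀ {n} (H : Hypergraph n) → ∃[ e ] H e ≡ true → ¬ Colourable H 1
edge⇒¬colourable H ((S , p) , on) (h , edges) with card≡3 S p
... | u , v , w , refl with h u | h v | proj₁ (proj₁ (edges u v w (p , on)))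
...   | zero | zero | ne = ne refl

-- With `c = 0` the ascent goes from K_1 to K_D. Then `c` has to be at least `q`, the length of the
-- intervals in `Fin c`; this is affordable because `q + 1` is at most `D`. From there `c` grows by
-- one at a time up to `n ∸ D`, each ascent starting from a clique no larger than the one just
-- excluded.
too-few-queries : ∀ {n T} (H : Hypergraph n) → ComputableWith T f[ H ] → ∃[ e ] H e ≡ true →
  ∀ a s → dim (suc a) ℕ.+ dim a ≤ n → s ℕ.* s ≤ dim (exponent a) → ¬ 72 ℕ.* T < s
too-few-queries {n} {T} H computes edge a s fits s²≤ 72T<s =
  subst (λ k → ¬ Colourable H k) (ℕ.m+[n∸m]≡n D≤n)
    (climb (n ∸ D) (ℕ.≤⇒≤′ q≤n∸D) (ℕ.≤-reflexive (ℕ.m+[n∸m]≡n D≤n))) (identity-colouring H)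
  where
  D = dim (suc a)
  q = dim a
  D≤n : D ≤ n
  D≤n = ℕ.≤-trans (ℕ.m≤m+n D q) fits
  q≤n∸D : q ≤ n ∸ D
  q≤n∸D = subst (_≤ n ∸ D) (ℕ.m+n∸m≡n D q) (ℕ.∸-monoˡ-≤ D fits)
  exponent-≤ : ∀ a → exponent a ≤ a ℕ.+ (a ℕ.+ a)
  exponent-≤ zero    = z≤n
  exponent-≤ (suc a) = ℕ.+-mono-≤ (ℕ.n≤1+n a) (ℕ.+-monoˡ-≤ (suc a) (ℕ.n≤1+n a))
  leap : ∀ c → D ℕ.+ c ≤ n → (0 < c → q ≤ c) → ¬ Colourable H (suc c) → ¬ Colourable H (D ℕ.+ c)
  leap c h room = Ascent.ascent H computes {a} {c} (λ v → Fin.inject≤ (vertexIndex {suc a} {c} v) h)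
    (λ i → restrict {suc a} {c} i (toℕ i ℕ.<? D ℕ.+ c))
    (λ v → restrict-inject {suc a} {c} h v (toℕ (Fin.inject≤ (vertexIndex {suc a} {c} v) h) ℕ.<? D ℕ.+ c)) a s 72T<s
    (λ { a′ refl → s²≤ }) (ℕ.≤-trans s²≤ (dim-mono (exponent-≤ a))) room
  first : ¬ Colourable H (D ℕ.+ 0)
  first = leap 0 (subst (_≤ n) (sym (ℕ.+-identityʳ D)) D≤n) (λ ()) (edge⇒¬colourable H edge)
  climb : ∀ c → q ℕ.≤′ c → D ℕ.+ c ≤ n → ¬ Colourable H (D ℕ.+ c)
  climb c (ℕ.≤′-reflexive refl) h = leap q h (λ _ → ℕ.≤-refl) (first ∘ colourable-mono {H = H} q<D)
    where
    q<D : suc q ≤ D ℕ.+ 0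
    q<D = subst (suc q ≤_) (sym (ℕ.+-identityʳ D)) (ℕ.+-monoˡ-≤ q (dim-positive a))
  climb (suc c) (ℕ.≤′-step q≤c) h = leap (suc c) h (λ _ → ℕ.m≤n⇒m≤1+n (ℕ.≤′⇒≤ q≤c))
    (climb c q≤c (ℕ.≤-trans (ℕ.+-monoʳ-≤ D (ℕ.n≤1+n c)) h) ∘ colourable-mono {H = H} 2+c≤)
    where
    2+c≤ : suc (suc c) ≤ D ℕ.+ c
    2+c≤ = ℕ.+-monoˡ-≤ c (ℕ.+-mono-≤ (dim-positive a) (dim-positive a))

-- Three times `dim a` is the room needed for a tree part of size 2 · 2^a and an interval of size
-- 2^a. Induction on `n` moves to the next power exactly when `n` reaches the upper bound.
scale-of : ∀ n → 3 ≤ n → ∃[ a ] (3 ℕ.* dim a ≤ n × n < 6 ℕ.* dim a)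
scale-of (suc n) (s≤s 2≤n) with ℕ.m≤n⇒m<n∨m≡n 2≤n
... | inj₂ refl = 0 , ℕ.≤-refl , s≤s (s≤s (s≤s (s≤s z≤n)))
... | inj₁ 3≤n with scale-of n 3≤n
...   | a , lower , upper with ℕ.m≤n⇒m<n∨m≡n upper
...     | inj₁ 1+n<6D = a , ℕ.m≤n⇒m≤1+n lower , 1+n<6D
...     | inj₂ 1+n≡6D = suc a , ℕ.≤-reflexive (trans (double 3) (sym 1+n≡6D)) ,
  ℕ.<-≤-trans (subst (ℕ._< 6 ℕ.* dim a ℕ.+ 6 ℕ.* dim a) (sym 1+n≡6D)
    (subst (λ k → k < 6 ℕ.* dim a ℕ.+ 6 ℕ.* dim a) (ℕ.+-identityʳ (6 ℕ.* dim a))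
      (ℕ.+-monoʳ-< (6 ℕ.* dim a) (ℕ.*-mono-≤ {1} {6} (s≤s z≤n) (dim-positive a)))))
    (ℕ.≤-reflexive (sym (ℕ.*-distribˡ-+ 6 (dim a) (dim a))))
  where
  double : ∀ k → k ℕ.* (dim a ℕ.+ dim a) ≡ (k ℕ.+ k) ℕ.* dim a
  double k = trans (ℕ.*-distribˡ-+ k (dim a) (dim a)) (sym (ℕ.*-distribʳ-+ (dim a) k k))

-- The factor 4 is the loss of one bit in each of two sides of the box of `NearStep`.
cube-≤ : ∀ a → dim a ℕ.* (dim a ℕ.* dim a) ≤ 4 ℕ.* dim (exponent a)
cube-≤ zero    = s≤s z≤n
cube-≤ (suc a) = ℕ.≤-reflexive (begin
  (D ℕ.+ D) ℕ.* ((D ℕ.+ D) ℕ.* (D ℕ.+ D))  ≡⟨ regroup D ⟩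
  4 ℕ.* (D ℕ.* (D ℕ.* (D ℕ.+ D)))          ≡⟨ cong (4 ℕ.*_) (trans (dim-+ a (a ℕ.+ suc a)) (cong (D ℕ.*_) (dim-+ a (suc a)))) ⟨
  4 ℕ.* dim (exponent (suc a))             ∎)
  where
  open ≡-Reasoning
  D = dim a
  regroup : ∀ d → (d ℕ.+ d) ℕ.* ((d ℕ.+ d) ℕ.* (d ℕ.+ d)) ≡ 4 ℕ.* (d ℕ.* (d ℕ.* (d ℕ.+ d)))
  regroup = let open +-*-Solver in
    solve 1 (λ d → (d :+ d) :* ((d :+ d) :* (d :+ d)) := con 4 :* (d :* (d :* (d :+ d)))) refl

-- For r ≥ 1 the upper bound (r + 1)² is at most (2r)².
<4-isqrt² : ∀ m → 1 ≤ m → m ≤ 4 ℕ.* (isqrt m ℕ.* isqrt m)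
<4-isqrt² m 1≤m = bound (isqrt m) refl
  where
  bound : ∀ r → isqrt m ≡ r → m ≤ 4 ℕ.* (r ℕ.* r)
  bound zero e = contradiction 1≤m (ℕ.<⇒≱ (subst (λ r → m < suc r ℕ.* suc r) e (isqrt-upper m)))
  bound (suc r) e = begin
    m                                    ≤⟨ ℕ.<⇒≤ (subst (λ r → m < suc r ℕ.* suc r) e (isqrt-upper m)) ⟩
    suc (suc r) ℕ.* suc (suc r)          ≤⟨ ℕ.m≤m+n _ _ ⟩
    suc (suc r) ℕ.* suc (suc r) ℕ.+ (3 ℕ.* (r ℕ.* r) ℕ.+ 4 ℕ.* r)  ≡⟨ regroup r ⟩
    4 ℕ.* (suc r ℕ.* suc r)              ∎
    where
    open ℕ.≤-Reasoning
    regroup : ∀ r → (2 ℕ.+ r) ℕ.* (2 ℕ.+ r) ℕ.+ (3 ℕ.* (r ℕ.* r) ℕ.+ 4 ℕ.* r) ≡ 4 ℕ.* ((1 ℕ.+ r) ℕ.* (1 ℕ.+ r))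
    regroup = let open +-*-Solver in
      solve 1 (λ r → (con 2 :+ r) :* (con 2 :+ r) :+ (con 3 :* (r :* r) :+ con 4 :* r) :=
        con 4 :* ((con 1 :+ r) :* (con 1 :+ r))) refl

-- The constants: 6³ = 216 from the scale, 4 from `cube-≤`, 4 from rounding to a perfect square.
-- Their product 3456 is at most 59² = 3481, whence the slack 25, and 59 · 72 = 4248 with the 72 of
-- the adversary bound.
query-bound : ∀ {n T} (H : Hypergraph n) → 3 ≤ n → ComputableWith T f[ H ] → ∃[ e ] H e ≡ true →
              n ^ 3 ≤ (4248 ℕ.* T) ℕ.* (4248 ℕ.* T)
query-bound {n} {T} H 3≤n computes edge = begin
  n ^ 3
    ≤⟨ ℕ.^-monoˡ-≤ 3 (ℕ.<⇒≤ upper) ⟩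
  (6 ℕ.* D) ^ 3
    ≡⟨ expand D ⟩
  216 ℕ.* (D ℕ.* (D ℕ.* D))
    ≤⟨ ℕ.*-monoʳ-≤ 216 (cube-≤ a) ⟩
  216 ℕ.* (4 ℕ.* dim (exponent a))
    ≤⟨ ℕ.*-monoʳ-≤ 216 (ℕ.*-monoʳ-≤ 4 (<4-isqrt² (dim (exponent a)) (dim-positive (exponent a)))) ⟩
  216 ℕ.* (4 ℕ.* (4 ℕ.* (s ℕ.* s)))
    ≤⟨ ℕ.m≤m+n _ (25 ℕ.* (s ℕ.* s)) ⟩
  216 ℕ.* (4 ℕ.* (4 ℕ.* (s ℕ.* s))) ℕ.+ 25 ℕ.* (s ℕ.* s)
    ≡⟨ complete s ⟩
  (59 ℕ.* s) ℕ.* (59 ℕ.* s)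
    ≤⟨ ℕ.*-mono-≤ 59s≤ 59s≤ ⟩
  (4248 ℕ.* T) ℕ.* (4248 ℕ.* T) ∎
  where
  open ℕ.≤-Reasoning
  a = proj₁ (scale-of n 3≤n)
  D = dim a
  lower = proj₁ (proj₂ (scale-of n 3≤n))
  upper = proj₂ (proj₂ (scale-of n 3≤n))
  s = isqrt (dim (exponent a))
  fits : dim (suc a) ℕ.+ dim a ≤ n
  fits = ℕ.≤-trans (ℕ.≤-reflexive (three D)) lower
    where
    three : ∀ d → d ℕ.+ d ℕ.+ d ≡ 3 ℕ.* d
    three = let open +-*-Solver in solve 1 (λ d → d :+ d :+ d := con 3 :* d) refl
  s≤72T : s ≤ 72 ℕ.* T
  s≤72T = ℕ.≮⇒≥ (too-few-queries H computes edge a s fits (isqrt-lower (dim (exponent a))))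
  59s≤ : 59 ℕ.* s ≤ 4248 ℕ.* T
  59s≤ = ℕ.≤-trans (ℕ.*-monoʳ-≤ 59 s≤72T) (ℕ.≤-reflexive (sym (ℕ.*-assoc 59 72 T)))
  expand : ∀ d → (6 ℕ.* d) ^ 3 ≡ 216 ℕ.* (d ℕ.* (d ℕ.* d))
  expand = let open +-*-Solver in
    solve 1 (λ d → (con 6 :* d) :^ 3 := con 216 :* (d :* (d :* d))) refl
  complete : ∀ s → 216 ℕ.* (4 ℕ.* (4 ℕ.* (s ℕ.* s))) ℕ.+ 25 ℕ.* (s ℕ.* s) ≡ (59 ℕ.* s) ℕ.* (59 ℕ.* s)
  complete = let open +-*-Solver in
    solve 1 (λ s → con 216 :* (con 4 :* (con 4 :* (s :* s))) :+ con 25 :* (s :* s) :=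
      (con 59 :* s) :* (con 59 :* s)) refl

√-bound : ∀ m C → m ≤ C ℕ.* C → ∀ k → √-seq m k ℚ.≤ fromN C
√-bound m C m≤C² k = /-mono r k C 0 (subst (_≤ C ℕ.* suc k) (sym (ℕ.*-identityʳ r)) (ℕ.≮⇒≥ λ CK<r →
  ℕ.<⇒≱ (ℕ.*-mono-< CK<r CK<r) (begin
    r ℕ.* r                          ≤⟨ isqrt-lower (m ℕ.* (K ℕ.* K)) ⟩
    m ℕ.* (K ℕ.* K)                  ≤⟨ ℕ.*-monoˡ-≤ (K ℕ.* K) m≤C² ⟩
    (C ℕ.* C) ℕ.* (K ℕ.* K)          ≡⟨ regroup C K ⟩
    (C ℕ.* K) ℕ.* (C ℕ.* K)          ∎)))
  where
  open ℕ.≤-Reasoning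
  K = suc k
  r = isqrt (m ℕ.* (K ℕ.* K))
  regroup : ∀ c k → (c ℕ.* c) ℕ.* (k ℕ.* k) ≡ (c ℕ.* k) ℕ.* (c ℕ.* k)
  regroup = let open +-*-Solver in
    solve 2 (λ c k → (c :* c) :* (k :* k) := (c :* k) :* (c :* k)) refl

constant : ℚ
constant = + 1 / 4248

theorem6 : ∃[ c ] ((0ᴿ <ᴿ c) ×
    (∀ n → 3 ≤ n → (H : Hypergraph n) → (∃[ e ] (H e ≡ true)) →
    Q[ f[ H ] ]≥ (c *ᴿ √ (n ^ 3))))
theorem6 = fromℚ constant , positive , bound
  where
  positive : 0ᴿ <ᴿ fromℚ constant
  positive = constant , ℚ.positive⁻¹ constant , 0 , λ _ _ → ℚ.≤-reflexive (ℚ.+-identityˡ constant)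
  bound : ∀ n → 3 ≤ n → (H : Hypergraph n) → (∃[ e ] (H e ≡ true)) →
    Q[ f[ H ] ]≥ (fromℚ constant *ᴿ √ (n ^ 3))
  bound n 3≤n H edge T computes =
    ≲-elim {fromℚ constant *ᴿ √ (n ^ 3)} {fromℕ T} (pointwise-≲ λ k → begin
      constant ℚ.* √-seq (n ^ 3) k             ≤⟨ ℚ.*-monoˡ-≤-nonNeg constant (√-bound (n ^ 3) (4248 ℕ.* T) (query-bound H 3≤n computes edge) k) ⟩
      constant ℚ.* fromN (4248 ℕ.* T)          ≡⟨ cong (constant ℚ.*_) (fromN-* 4248 T) ⟩
      constant ℚ.* (fromN 4248 ℚ.* fromN T)    ≡⟨ ℚ.*-assoc constant (fromN 4248) (fromN T) ⟨
      (constant ℚ.* fromN 4248) ℚ.* fromN T    ≡⟨ ℚ.*-identityˡ (fromN T) ⟩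
      fromN T                                  ∎)
    where open ℚ.≤-Reasoning
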